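{- Let $q=3^{2e}$ with $e\ge 1$, $E=\mathbb{F}_{q^3}$, $F=\mathbb{F}_q$, $\mathrm{Tr}:E\to F$ the relative trace, $N=q^2+q+1$, $\omega$ a primitive element of $E$, and $w_1\in E$ an element of order $N$. Model $\mathrm{AG}(2,q)$ as follows: identify the point $\langle w_1^i\rangle$ of $\mathrm{PG}(2,q)$ (with underlying $F$-space $E$) with $i\in\mathbb{Z}_N$; let $J=\{i\in\mathbb{Z}_N:\mathrm{Tr}(w_1^i)=0\}$; the points of $\mathrm{AG}(2,q)$ are the elements of $\mathbb{Z}_N\setminus J$ and the lines are $\ell_i=\{j\in\mathbb{Z}_N\setminus J:\mathrm{Tr}(w_1^{i+j})=0\}$, $1\le i\le N-1$. Let $w_0=\omega^N\in F$ and $C_k^{(4,q)}=w_0^k\langle w_0^4\rangle$ for $0\le k\le 3$. Then $$\mathcal K=\{k\in\mathbb{Z}_N:\mathrm{Tr}(w_1^k)\in C_0^{(4,q)}\cup C_1^{(4,q)}\}\subseteq\mathbb{Z}_N\setminus J$$ is a set of type $\left(\tfrac12(3^{2e}-3^e),\tfrac12(3^{2e}+3^e)\right)$ in $\mathrm{AG}(2,3^{2e})$.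
   Context: A set $\mathcal K$ of points of an affine plane is a set of type $(m,n)$ ($m<n$) if every line meets $\mathcal K$ in either $m$ or $n$ points, and both values occur. -}

module Defs where

open import Level using (Level)
open import Data.Nat as ℕ using (ℕ; zero; suc; _∸_; _<_; _≤_)
open import Data.Fin using (Fin; toℕ)
open import Data.List using (List; length)
open import Data.List.Relation.Unary.All using (All)
open import Data.List.Relation.Unary.Unique.Propositional using (Unique)
open import Data.List.Membership.Propositional using (_∈_)
open import Data.Product using (Σ; ∃; ∃-syntax; _×_; _,_)
open import Data.Sum using (_⊎_)
open import Relation.Nullary using (¬_)
open import Relation.Binary.PropositionalEquality using (_≡_)
import Relation.Binary.PropositionalEquality as P
open import Function.Bundles using (Inverse)
open import Algebra.Bundles using (CommutativeRing)

record IsField {c ℓ : Level} (R : CommutativeRing c ℓ) : Set (c Level.⊔ ℓ) where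
  open CommutativeRing R
  field
    0≉1     : ¬ (0# ≈ 1#)
    inverse : ∀ x → ¬ (x ≈ 0#) → ∃[ y ] (x * y ≈ 1#)

HasCardinality : {c ℓ : Level} (R : CommutativeRing c ℓ) → ℕ → Set (c Level.⊔ ℓ)
HasCardinality R n = Inverse (CommutativeRing.setoid R) (P.setoid (Fin n))

module FieldNotation {c ℓ : Level} (R : CommutativeRing c ℓ) where
  open CommutativeRing R

  _^_ : Carrier → ℕ → Carrier
  x ^ zero  = 1#
  x ^ suc n = x * (x ^ n)

  HasOrder : Carrier → ℕ → Set ℓ
  HasOrder x n = (0 < n) × (x ^ n ≈ 1#) × (∀ m → 0 < m → m < n → ¬ (x ^ m ≈ 1#))

  Tr : ℕ → Carrier → Carrier
  Tr q x = x + (x ^ q) + (x ^ (q ℕ.* q))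

  InCoset : Carrier → ℕ → Carrier → Set (c Level.⊔ ℓ)
  InCoset w0 k x = ∃[ y ] (∃[ j ] (y ≈ (w0 ^ 4) ^ j) × (x ≈ (w0 ^ k) * y))

HasSize : {p : Level} {N : ℕ} → (Fin N → Set p) → ℕ → Set p
HasSize {N = N} S m =
  Σ (List (Fin N)) λ l → Unique l × All S l × (∀ j → S j → j ∈ l) × length l ≡ m

module AGModel {c ℓ : Level} (E : CommutativeRing c ℓ) (q : ℕ) (w1 : CommutativeRing.Carrier E) where
  open CommutativeRing E
  open FieldNotation E

  N : ℕ
  N = q ℕ.* q ℕ.+ q ℕ.+ 1

  InJ : Fin N → Set ℓ
  InJ i = Tr q (w1 ^ toℕ i) ≈ 0#

  IsPoint : Fin N → Set ℓ
  IsPoint j = ¬ InJ j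

  OnLine : Fin N → Fin N → Set ℓ
  OnLine i j = IsPoint j × (Tr q (w1 ^ (toℕ i ℕ.+ toℕ j)) ≈ 0#)

  IsLineIndex : Fin N → Set
  IsLineIndex i = 1 ≤ toℕ i

  IsSetOfType : {p : Level} → (Fin N → Set p) → ℕ → ℕ → Set (ℓ Level.⊔ p)
  IsSetOfType K m n =
    (∀ k → K k → IsPoint k) ×
    (m < n) ×
    (∀ i → IsLineIndex i → HasSize (λ j → OnLine i j × K j) m ⊎ HasSize (λ j → OnLine i j × K j) n) ×
    (∃[ i ] IsLineIndex i × HasSize (λ j → OnLine i j × K j) m) ×
    (∃[ i ] IsLineIndex i × HasSize (λ j → OnLine i j × K j) n)

{-# OPTIONS --safe #-}

-- Represent an affine point by the x with Tr x = 1.  If x = t w1^k with t ∈ F, then Nm x = t³ and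
-- Tr(w1^k) = 1/t, so in characteristic 3 the point lies in 𝒦 iff Nm x ∈ C₀ ∪ C₁.  A line is β(Y + F) with
-- Y ∉ F, and its intersection with 𝒦 is read off from T = ∑_s κ(k g(s)), where g(s) = Nm(Y + s) is a cubic
-- without roots whose discriminant is a square, and κ is 1 on C₀ ∪ C₁ and −1 on C₂ ∪ C₃; the claim is T = ±√q.
-- Expand κ in additive characters ψ.  Since ψ(us³) is ψ of a linear function of s, the sum over s is a
-- quadratic Gauss sum and T = ±X for X = ∑_t χ(t) ψ(b(t + 1/t)) with χ quartic.  Substituting t = x² and then
-- z = x + 1/x turns X into ψ(−b) W ∓ √q ψ(b), where W = ∑_y ψ(b(y⁴ − y²)) is the exponential sum of a quadratic
-- form over the prime field, so |W|² = qρ with ρ a power of 3.  As X is an odd integer, this norm equation in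
-- ℤ[ζ₃] leaves only X = ±√q.  (If g has no quadratic term, T is computed directly.)
-- Both signs occur: for the lines given by Y + a, a ∈ F, one finds T = ε κ(m g(a)), and the sum of these
-- q signs is again ±√q, hence not ±q.
module Submission where

open import Defs
open import Algebra.Core using (Op₁; Op₂)
open import Algebra.Bundles using (CommutativeRing; RawRing)
import Algebra.Morphism.RingMonomorphism as RingMonomorphism
open import Algebra.Morphism.Structures using (IsRingMonomorphism)
open import Algebra.Structures using (IsCommutativeRing)
open import Data.Bool.Base using (Bool; true; false)
open import Data.Empty using (⊥-elim)
open import Data.Fin.Base as Fin using (Fin; zero; suc; toℕ; fromℕ<)
open import Data.Fin.Permutation using (permutation)
import Data.Fin.Properties as Fin
open import Data.Integer.Base as ℤ using (ℤ; +_; 0ℤ; 1ℤ; -1ℤ; ∣_∣)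
import Data.Integer.Divisibility.Signed as Signed
import Data.Integer.Properties as ℤ
open import Data.Integer.Tactic.RingSolver using (solve-∀)
open import Data.List.Base using (List; []; _∷_; length; allFin; filter; tabulate; map)
open import Data.List.Membership.Propositional using (_∈_)
open import Data.List.Membership.Propositional.Properties using (∈-map⁺; ∈-filter⁺; ∈-allFin)
open import Data.List.Properties using (length-map; length-tabulate; filter-accept; filter-reject)
open import Data.List.Relation.Unary.All as All using (All; []; _∷_)
import Data.List.Relation.Unary.All.Properties as All
open import Data.List.Relation.Unary.AllPairs using ([]; _∷_)
open import Data.List.Relation.Unary.Unique.Propositional using (Unique)
open import Data.List.Relation.Unary.Unique.Propositional.Properties as Unique using (allFin⁺)
open import Data.Maybe.Base using (Maybe; just; nothing)
open import Data.Nat.Base as ℕ using (ℕ; zero; suc)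
open import Data.Nat.Coprimality using (coprime-divisor)
open import Data.Nat.DivMod using (_%_; _/_; m%n<n; m≡m%n+[m/n]*n; m*n/n≡m)
open import Data.Nat.Divisibility using (_∣_; divides; _∣?_; ∣1⇒≡1; ∣-trans; m%n≡0⇒n∣m; ∣⇒≤; *-cancelˡ-∣; *-cancelʳ-∣)
open import Data.Nat.Primality using (Prime; prime?; prime[2]; euclidsLemma; prime⇒irreducible)
import Data.Nat.Properties as ℕ
open import Data.Nat.Tactic.RingSolver using () renaming (solve-∀ to ℕ-solve-∀)
open import Data.Product using (_,_; _×_; ∃-syntax; proj₁; proj₂)
open import Data.Sum using (_⊎_; inj₁; inj₂; [_,_]′)
open import Function.Bundles using (Inverse)
open import Function.Definitions using (Injective)
open import Level using (Level; 0ℓ)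
open import Relation.Binary.Definitions using (Decidable; tri<; tri≈; tri>)
open import Relation.Binary.PropositionalEquality as ≡ using (_≡_)
open import Relation.Nullary using (¬_; Dec; yes; no; does)
open import Relation.Nullary.Decidable using (dec-true; dec-false; map′; _×-dec_; toWitness; toWitnessFalse)

-- X is a Kloosterman sum twisted by a quartic character, and |W| determines it only up to the
-- unknown power ρ of 3. What closes the gap comes from T: it is a sum of q signs and q is odd, so X
-- is an odd rational integer. Descent then gives √q ∣ X, and X = mg with g = ±√q turns the norm
-- into m² - m + 1 = ρ or, when ψ(b) = 1, (m + 1)² = ρ. The first is never divisible by 9, so ρ is 1
-- or 3; the second contradicts parity. The square discriminant is what makes X symmetric in t and
-- 1/t: after the sum over s the phase is nu - 1/(uc³), and rescaling u makes the two coefficients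
-- equal exactly when -nc³ is a square. For a norm cubic it is one because Frobenius permutes the
-- three conjugates cyclically, so the product of their differences lies in F. No fourth root of
-- unity is adjoined to ℤ[ζ₃]: χ is kept as a pair (Re, Im). Since χ³ is the conjugate of χ while
-- ψ(x³) = ψ(x), the imaginary part of its Gauss sum vanishes.

CharThree : {c ℓ : Level} → CommutativeRing c ℓ → Set ℓ
CharThree R = 1# + 1# + 1# ≈ 0#
  where open CommutativeRing R

-- Ring solving in characteristic 3.

module CharThreeSolver {c ℓ : Level} (R : CommutativeRing c ℓ) (1+1+1≈0 : CharThree R) where

  open CommutativeRing R
  open import Algebra.Properties.Ring ring using (-0#≈0#; -‿distribˡ-*; -‿involutive)
  open import Algebra.Solver.Ring.AlmostCommutativeRing
  import Algebra.Properties.Group +-group as Group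

  -- With coefficients in 𝔽₃ instead of ℤ the normal form knows that 3 = 0, so identities such as (x
  -- + y)³ = x³ + y³ are solved by `refl`.
  data 𝔽₃ : Set where
    0₃ 1₃ 2₃ : 𝔽₃

  private
    _+₃_ _*₃_ : 𝔽₃ → 𝔽₃ → 𝔽₃
    0₃ +₃ y  = y
    1₃ +₃ 0₃ = 1₃
    1₃ +₃ 1₃ = 2₃
    1₃ +₃ 2₃ = 0₃
    2₃ +₃ 0₃ = 2₃
    2₃ +₃ 1₃ = 0₃
    2₃ +₃ 2₃ = 1₃
    0₃ *₃ _  = 0₃
    1₃ *₃ y  = y
    2₃ *₃ 0₃ = 0₃
    2₃ *₃ 1₃ = 2₃
    2₃ *₃ 2₃ = 1₃

    -₃_ : 𝔽₃ → 𝔽₃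
    -₃ 0₃ = 0₃
    -₃ 1₃ = 2₃
    -₃ 2₃ = 1₃

    rawRing₃ : RawRing _ _
    rawRing₃ = record { Carrier = 𝔽₃ ; _≈_ = _≡_ ; _+_ = _+₃_ ; _*_ = _*₃_ ; -_ = -₃_ ; 0# = 0₃ ; 1# = 1₃ }

    ⟦_⟧₃ : 𝔽₃ → Carrier
    ⟦ 0₃ ⟧₃ = 0#
    ⟦ 1₃ ⟧₃ = 1#
    ⟦ 2₃ ⟧₃ = - 1#

    1+1≈-1 : 1# + 1# ≈ - 1#
    1+1≈-1 = Group.inverseˡ-unique (1# + 1#) 1# 1+1+1≈0

    -1-1≈1 : - 1# + - 1# ≈ 1#
    -1-1≈1 = trans (+-congʳ (sym 1+1≈-1)) (trans (+-assoc _ _ _) (trans (+-congˡ (-‿inverseʳ 1#)) (+-identityʳ 1#)))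

    +-homo₃ : ∀ x y → ⟦ x +₃ y ⟧₃ ≈ ⟦ x ⟧₃ + ⟦ y ⟧₃
    +-homo₃ 0₃ y  = sym (+-identityˡ _)
    +-homo₃ 1₃ 0₃ = sym (+-identityʳ _)
    +-homo₃ 1₃ 1₃ = sym 1+1≈-1
    +-homo₃ 1₃ 2₃ = sym (-‿inverseʳ 1#)
    +-homo₃ 2₃ 0₃ = sym (+-identityʳ _)
    +-homo₃ 2₃ 1₃ = sym (-‿inverseˡ 1#)
    +-homo₃ 2₃ 2₃ = sym -1-1≈1

    *-homo₃ : ∀ x y → ⟦ x *₃ y ⟧₃ ≈ ⟦ x ⟧₃ * ⟦ y ⟧₃
    *-homo₃ 0₃ y  = sym (zeroˡ _)
    *-homo₃ 1₃ y  = sym (*-identityˡ _)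
    *-homo₃ 2₃ 0₃ = sym (zeroʳ _)
    *-homo₃ 2₃ 1₃ = sym (*-identityʳ _)
    *-homo₃ 2₃ 2₃ = trans (sym (-‿involutive 1#)) (trans (-‿cong (sym (*-identityˡ _))) (-‿distribˡ-* 1# (- 1#)))

    -‿homo₃ : ∀ x → ⟦ -₃ x ⟧₃ ≈ - ⟦ x ⟧₃
    -‿homo₃ 0₃ = sym -0#≈0#
    -‿homo₃ 1₃ = refl
    -‿homo₃ 2₃ = sym (-‿involutive 1#)

    morphism₃ : rawRing₃ -Raw-AlmostCommutative⟶ fromCommutativeRing R
    morphism₃ = record
      { ⟦_⟧ = ⟦_⟧₃ ; +-homo = +-homo₃ ; *-homo = *-homo₃ ; -‿homo = -‿homo₃ ; 0-homo = refl ; 1-homo = refl }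

    _≟₃_ : ∀ x y → Maybe (⟦ x ⟧₃ ≈ ⟦ y ⟧₃)
    0₃ ≟₃ 0₃ = just refl
    1₃ ≟₃ 1₃ = just refl
    2₃ ≟₃ 2₃ = just refl
    _  ≟₃ _  = nothing

  open import Algebra.Solver.Ring rawRing₃ (fromCommutativeRing R) morphism₃ _≟₃_ public
    using (solve; _:=_; _:+_; _:*_; :-_; _:-_; con)

-- Powers and orders; fields with decidable equality.

module PowerLaws {c ℓ : Level} (R : CommutativeRing c ℓ) where
  open CommutativeRing R
  open FieldNotation R
  open import Relation.Binary.Reasoning.Setoid setoid
  open import Algebra.Properties.CommutativeSemigroup *-commutativeSemigroup using (interchange)

  ^-cong : ∀ {x y} n → x ≈ y → x ^ n ≈ y ^ n
  ^-cong zero    x≈y = refl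
  ^-cong (suc n) x≈y = *-cong x≈y (^-cong n x≈y)

  ^-+ : ∀ x m n → x ^ (m ℕ.+ n) ≈ x ^ m * x ^ n
  ^-+ x zero    n = sym (*-identityˡ _)
  ^-+ x (suc m) n = trans (*-congˡ (^-+ x m n)) (sym (*-assoc _ _ _))

  1^ : ∀ n → 1# ^ n ≈ 1#
  1^ zero    = refl
  1^ (suc n) = trans (*-identityˡ _) (1^ n)

  0^ : ∀ n → 0# ^ suc n ≈ 0#
  0^ n = zeroˡ _

  *-^ : ∀ x y n → (x * y) ^ n ≈ x ^ n * y ^ n
  *-^ x y zero    = sym (*-identityˡ _)
  *-^ x y (suc n) = trans (*-congˡ (*-^ x y n)) (interchange _ _ _ _)

  ^-* : ∀ x m n → x ^ (m ℕ.* n) ≈ (x ^ m) ^ n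
  ^-* x zero    n = sym (1^ n)
  ^-* x (suc m) n = begin
    x ^ (n ℕ.+ m ℕ.* n)  ≈⟨ ^-+ x n (m ℕ.* n) ⟩
    x ^ n * x ^ (m ℕ.* n)  ≈⟨ *-congˡ (^-* x m n) ⟩
    x ^ n * (x ^ m) ^ n  ≈⟨ *-^ x (x ^ m) n ⟨
    (x * x ^ m) ^ n  ∎

  ^-1 : ∀ x → x ^ 1 ≈ x
  ^-1 x = *-identityʳ x

  ^-^-comm : ∀ x m n → (x ^ m) ^ n ≈ (x ^ n) ^ m
  ^-^-comm x m n = trans (sym (^-* x m n)) (trans (reflexive (≡.cong (x ^_) (ℕ.*-comm m n))) (^-* x n m))
    where import Data.Nat.Properties as ℕ

  order-∣ : ∀ {x n k} → HasOrder x n → x ^ k ≈ 1# → n ∣ k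
  order-∣ {x} {suc n} {k} (_ , x^n≈1 , minimal) x^k≈1 with k % suc n in k%n≡
  ... | zero  = m%n≡0⇒n∣m k (suc n) k%n≡
  ... | suc j = ⊥-elim (minimal (suc j) (ℕ.s≤s ℕ.z≤n) (≡.subst (ℕ._< suc n) k%n≡ (m%n<n k (suc n))) (begin
    x ^ suc j  ≡⟨ ≡.cong (x ^_) k%n≡ ⟨
    x ^ (k % suc n)  ≈⟨ *-identityʳ _ ⟨
    x ^ (k % suc n) * 1#  ≈⟨ *-congˡ (1^ (k / suc n)) ⟨
    x ^ (k % suc n) * 1# ^ (k / suc n)  ≈⟨ *-congˡ (^-cong (k / suc n) x^n≈1) ⟨
    x ^ (k % suc n) * (x ^ suc n) ^ (k / suc n)  ≈⟨ *-congˡ (^-* x (suc n) (k / suc n)) ⟨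
    x ^ (k % suc n) * x ^ (suc n ℕ.* (k / suc n)) ≈⟨ ^-+ x (k % suc n) _ ⟨
    x ^ (k % suc n ℕ.+ suc n ℕ.* (k / suc n))  ≡⟨ ≡.cong (λ m → x ^ (k % suc n ℕ.+ m)) (ℕ.*-comm (suc n) (k / suc n)) ⟩
    x ^ (k % suc n ℕ.+ (k / suc n) ℕ.* suc n)  ≡⟨ ≡.cong (x ^_) (m≡m%n+[m/n]*n k (suc n)) ⟨
    x ^ k  ≈⟨ x^k≈1 ⟩
    1#  ∎))

    where
    import Data.Nat.Properties as ℕ

module FieldProperties {c ℓ : Level} (R : CommutativeRing c ℓ) (isField : IsField R)
  (_≟_ : Decidable (CommutativeRing._≈_ R)) where
  open CommutativeRing R
  open FieldNotation R
  open IsField isField public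
  open import Relation.Binary.Reasoning.Setoid setoid
  open import Algebra.Properties.Ring ring using (-0#≈0#; -‿distribˡ-*; -‿involutive)
  import Algebra.Properties.Group +-group as Group

  infix 8 _⁻¹

  opaque
    -- The value 0 at 0 makes inversion an involution of the whole field: sums can be reindexed by
    -- it, and χ(x⁻¹) is the conjugate of χ(x) without exception.
    _⁻¹ : Carrier → Carrier
    x ⁻¹ with x ≟ 0#
    ... | yes _   = 0#
    ... | no  x≉0 = proj₁ (inverse x x≉0)

    inverseʳ : ∀ {x} → ¬ x ≈ 0# → x * x ⁻¹ ≈ 1#
    inverseʳ {x} x≉0 with x ≟ 0#
    ... | yes x≈0 = ⊥-elim (x≉0 x≈0)
    ... | no  p   = proj₂ (inverse x p)

    0⁻¹≈0 : 0# ⁻¹ ≈ 0#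
    0⁻¹≈0 with 0# ≟ 0#
    ... | yes _ = refl
    ... | no  p = ⊥-elim (p refl)

  inverseˡ : ∀ {x} → ¬ x ≈ 0# → x ⁻¹ * x ≈ 1#
  inverseˡ x≉0 = trans (*-comm _ _) (inverseʳ x≉0)

  *-cancelˡ : ∀ {x y z} → ¬ x ≈ 0# → x * y ≈ x * z → y ≈ z
  *-cancelˡ {x} {y} {z} x≉0 eq = begin
    y  ≈⟨ *-identityˡ y ⟨
    1# * y  ≈⟨ *-congʳ (inverseˡ x≉0) ⟨
    x ⁻¹ * x * y  ≈⟨ *-assoc _ _ _ ⟩
    x ⁻¹ * (x * y)  ≈⟨ *-congˡ eq ⟩
    x ⁻¹ * (x * z)  ≈⟨ *-assoc _ _ _ ⟨
    x ⁻¹ * x * z  ≈⟨ *-congʳ (inverseˡ x≉0) ⟩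
    1# * z  ≈⟨ *-identityˡ z ⟩
    z  ∎

  *-≉0 : ∀ {x y} → ¬ x ≈ 0# → ¬ y ≈ 0# → ¬ x * y ≈ 0#
  *-≉0 x≉0 y≉0 xy≈0 = y≉0 (*-cancelˡ x≉0 (trans xy≈0 (sym (zeroʳ _))))

  zero-product : ∀ {x y} → x * y ≈ 0# → x ≈ 0# ⊎ y ≈ 0#
  zero-product {x} {y} xy≈0 with x ≟ 0#
  ... | yes x≈0 = inj₁ x≈0
  ... | no  x≉0 = inj₂ (*-cancelˡ x≉0 (trans xy≈0 (sym (zeroʳ x))))

  ^-≉0 : ∀ {x} n → ¬ x ≈ 0# → ¬ x ^ n ≈ 0#
  ^-≉0 zero    x≉0 eq = 0≉1 (sym eq)
  ^-≉0 (suc n) x≉0 eq = *-≉0 x≉0 (^-≉0 n x≉0) eq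

  ⁻¹-≉0 : ∀ {x} → ¬ x ≈ 0# → ¬ x ⁻¹ ≈ 0#
  ⁻¹-≉0 x≉0 eq = 0≉1 (trans (sym (zeroʳ _)) (trans (*-congˡ (sym eq)) (inverseʳ x≉0)))

  -‿≉0 : ∀ {x} → ¬ x ≈ 0# → ¬ - x ≈ 0#
  -‿≉0 x≉0 eq = x≉0 (trans (sym (-‿involutive _)) (trans (-‿cong eq) -0#≈0#))

  x-y≈0⇒x≈y : ∀ {x y} → x - y ≈ 0# → x ≈ y
  x-y≈0⇒x≈y {x} {y} eq = trans (Group.inverseˡ-unique x (- y) eq) (-‿involutive y)

  x≈y⇒x-y≈0 : ∀ {x y} → x ≈ y → x - y ≈ 0#
  x≈y⇒x-y≈0 {x} {y} eq = trans (+-congʳ eq) (-‿inverseʳ y)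

  square-roots : ∀ {x y} → x * x ≈ y * y → x ≈ y ⊎ x ≈ - y
  square-roots {x} {y} eq with zero-product {x - y} {x + y} (begin
      (x - y) * (x + y)  ≈⟨ distribˡ _ _ _ ⟩
      (x - y) * x + (x - y) * y  ≈⟨ +-cong (distribʳ _ _ _) (distribʳ _ _ _) ⟩
      (x * x + - y * x) + (x * y + - y * y) ≈⟨ +-assoc _ _ _ ⟩
      x * x + (- y * x + (x * y + - y * y)) ≈⟨ +-congˡ (+-assoc _ _ _) ⟨
      x * x + ((- y * x + x * y) + - y * y) ≈⟨ +-congˡ (+-congʳ (+-congʳ (trans (sym (-‿distribˡ-* y x)) (-‿cong (*-comm y x))))) ⟩
      x * x + ((- (x * y) + x * y) + - y * y) ≈⟨ +-congˡ (+-congʳ (-‿inverseˡ _)) ⟩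
      x * x + (0# + - y * y)  ≈⟨ +-congˡ (+-identityˡ _) ⟩
      x * x + - y * y  ≈⟨ +-cong eq (sym (-‿distribˡ-* y y)) ⟩
      y * y - y * y  ≈⟨ -‿inverseʳ _ ⟩
      0#  ∎)
  ... | inj₁ x-y≈0 = inj₁ (x-y≈0⇒x≈y x-y≈0)
  ... | inj₂ x+y≈0 = inj₂ (Group.inverseˡ-unique x y x+y≈0)

-- The Eisenstein integers.

module Eisenstein where
  open ≡ using (refl; cong; cong₂; sym; trans)

  infix 4 _+ζ_

  data ℤ[ζ] : Set where
    _+ζ_ : ℤ → ℤ → ℤ[ζ]

  re im : ℤ[ζ] → ℤ
  re (a +ζ b) = a
  im (a +ζ b) = b

  infixl 7 _⊗_
  infixl 6 _⊕_
  infix  8 ⊖_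

  -- Coordinates are taken in the basis 1, ζ with ζ² = -1 - ζ. The conjugate of ζ is ζ², which also
  -- yields the formulas for `conj` and the form a² - ab + b² of `norm`.
  _⊕_ _⊗_ : ℤ[ζ] → ℤ[ζ] → ℤ[ζ]
  (a +ζ b) ⊕ (c +ζ d) = a ℤ.+ c +ζ b ℤ.+ d
  (a +ζ b) ⊗ (c +ζ d) = a ℤ.* c ℤ.- b ℤ.* d +ζ a ℤ.* d ℤ.+ b ℤ.* c ℤ.- b ℤ.* d

  ⊖_ conj : ℤ[ζ] → ℤ[ζ]
  ⊖ (a +ζ b)      = ℤ.- a +ζ ℤ.- b
  conj (a +ζ b) = a ℤ.- b +ζ ℤ.- b

  ι : ℤ → ℤ[ζ]
  ι a = a +ζ 0ℤ

  𝟘 𝟙 ζ ζ² : ℤ[ζ]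
  𝟘  = ι 0ℤ
  𝟙  = ι 1ℤ
  ζ  = 0ℤ +ζ 1ℤ
  ζ² = -1ℤ +ζ -1ℤ

  norm : ℤ[ζ] → ℤ
  norm (a +ζ b) = a ℤ.* a ℤ.- a ℤ.* b ℤ.+ b ℤ.* b

  infix 4 _≟_

  _≟_ : (x y : ℤ[ζ]) → Dec (x ≡ y)
  (a +ζ b) ≟ (c +ζ d) = map′ (λ (p , q) → cong₂ _+ζ_ p q) (λ eq → cong re eq , cong im eq) (a ℤ.≟ c ×-dec b ℤ.≟ d)

  ⊗-assoc : ∀ x y z → (x ⊗ y) ⊗ z ≡ x ⊗ (y ⊗ z)
  ⊗-assoc (a +ζ b) (c +ζ d) (f +ζ g) = cong₂ _+ζ_ (re-eq a b c d f g) (im-eq a b c d f g)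
    where
    re-eq : ∀ a b c d f g →
      (a ℤ.* c ℤ.- b ℤ.* d) ℤ.* f ℤ.- (a ℤ.* d ℤ.+ b ℤ.* c ℤ.- b ℤ.* d) ℤ.* g ≡
      a ℤ.* (c ℤ.* f ℤ.- d ℤ.* g) ℤ.- b ℤ.* (c ℤ.* g ℤ.+ d ℤ.* f ℤ.- d ℤ.* g)
    re-eq = solve-∀
    im-eq : ∀ a b c d f g →
      (a ℤ.* c ℤ.- b ℤ.* d) ℤ.* g ℤ.+ (a ℤ.* d ℤ.+ b ℤ.* c ℤ.- b ℤ.* d) ℤ.* f ℤ.- (a ℤ.* d ℤ.+ b ℤ.* c ℤ.- b ℤ.* d) ℤ.* g ≡
      a ℤ.* (c ℤ.* g ℤ.+ d ℤ.* f ℤ.- d ℤ.* g) ℤ.+ b ℤ.* (c ℤ.* f ℤ.- d ℤ.* g) ℤ.- b ℤ.* (c ℤ.* g ℤ.+ d ℤ.* f ℤ.- d ℤ.* g)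
    im-eq = solve-∀

  ⊗-comm : ∀ x y → x ⊗ y ≡ y ⊗ x
  ⊗-comm (a +ζ b) (c +ζ d) = cong₂ _+ζ_ (re-eq a b c d) (im-eq a b c d)
    where
    re-eq : ∀ a b c d → a ℤ.* c ℤ.- b ℤ.* d ≡ c ℤ.* a ℤ.- d ℤ.* b
    re-eq = solve-∀
    im-eq : ∀ a b c d → a ℤ.* d ℤ.+ b ℤ.* c ℤ.- b ℤ.* d ≡ c ℤ.* b ℤ.+ d ℤ.* a ℤ.- d ℤ.* b
    im-eq = solve-∀

  ⊗-identityˡ : ∀ x → 𝟙 ⊗ x ≡ x
  ⊗-identityˡ (a +ζ b) = cong₂ _+ζ_ (re-eq a b) (im-eq a b)
    where
    re-eq : ∀ a b → 1ℤ ℤ.* a ℤ.- 0ℤ ℤ.* b ≡ a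
    re-eq = solve-∀
    im-eq : ∀ a b → 1ℤ ℤ.* b ℤ.+ 0ℤ ℤ.* a ℤ.- 0ℤ ℤ.* b ≡ b
    im-eq = solve-∀

  ⊗-distribˡ-⊕ : ∀ x y z → x ⊗ (y ⊕ z) ≡ (x ⊗ y) ⊕ (x ⊗ z)
  ⊗-distribˡ-⊕ (a +ζ b) (c +ζ d) (f +ζ g) = cong₂ _+ζ_ (re-eq a b c d f g) (im-eq a b c d f g)
    where
    re-eq : ∀ a b c d f g → a ℤ.* (c ℤ.+ f) ℤ.- b ℤ.* (d ℤ.+ g) ≡ (a ℤ.* c ℤ.- b ℤ.* d) ℤ.+ (a ℤ.* f ℤ.- b ℤ.* g)
    re-eq = solve-∀
    im-eq : ∀ a b c d f g → a ℤ.* (d ℤ.+ g) ℤ.+ b ℤ.* (c ℤ.+ f) ℤ.- b ℤ.* (d ℤ.+ g) ≡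
      (a ℤ.* d ℤ.+ b ℤ.* c ℤ.- b ℤ.* d) ℤ.+ (a ℤ.* g ℤ.+ b ℤ.* f ℤ.- b ℤ.* g)
    im-eq = solve-∀

  isCommutativeRing : IsCommutativeRing _≡_ _⊕_ _⊗_ ⊖_ 𝟘 𝟙
  isCommutativeRing = record
    { isRing = record
      { +-isAbelianGroup = record
        { isGroup = record
          { isMonoid = record
            { isSemigroup = record
              { isMagma = record { isEquivalence = ≡.isEquivalence ; ∙-cong = cong₂ _⊕_ }
              ; assoc = λ { (a +ζ b) (c +ζ d) (f +ζ g) → cong₂ _+ζ_ (ℤ.+-assoc a c f) (ℤ.+-assoc b d g) } }
            ; identity = (λ { (a +ζ b) → cong₂ _+ζ_ (ℤ.+-identityˡ a) (ℤ.+-identityˡ b) })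
                       , (λ { (a +ζ b) → cong₂ _+ζ_ (ℤ.+-identityʳ a) (ℤ.+-identityʳ b) }) }
          ; inverse = (λ { (a +ζ b) → cong₂ _+ζ_ (ℤ.+-inverseˡ a) (ℤ.+-inverseˡ b) })
                    , (λ { (a +ζ b) → cong₂ _+ζ_ (ℤ.+-inverseʳ a) (ℤ.+-inverseʳ b) })
          ; ⁻¹-cong = cong ⊖_ }
        ; comm = λ { (a +ζ b) (c +ζ d) → cong₂ _+ζ_ (ℤ.+-comm a c) (ℤ.+-comm b d) } }
      ; *-cong = cong₂ _⊗_
      ; *-assoc = ⊗-assoc
      ; *-identity = ⊗-identityˡ , (λ x → trans (⊗-comm x 𝟙) (⊗-identityˡ x))
      ; distrib = ⊗-distribˡ-⊕
                , (λ x y z → trans (⊗-comm (y ⊕ z) x) (trans (⊗-distribˡ-⊕ x y z) (cong₂ _⊕_ (⊗-comm x y) (⊗-comm x z)))) }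
    ; *-comm = ⊗-comm }

  commutativeRing : CommutativeRing 0ℓ 0ℓ
  commutativeRing = record { isCommutativeRing = isCommutativeRing }

  conj-⊕ : ∀ x y → conj (x ⊕ y) ≡ conj x ⊕ conj y
  conj-⊕ (a +ζ b) (c +ζ d) = cong₂ _+ζ_ (re-eq a b c d) (ℤ.neg-distrib-+ b d)
    where
    re-eq : ∀ a b c d → (a ℤ.+ c) ℤ.- (b ℤ.+ d) ≡ (a ℤ.- b) ℤ.+ (c ℤ.- d)
    re-eq = solve-∀

  ⊗-conj : ∀ x → x ⊗ conj x ≡ ι (norm x)
  ⊗-conj (a +ζ b) = cong₂ _+ζ_ (re-eq a b) (im-eq a b)
    where
    re-eq : ∀ a b → a ℤ.* (a ℤ.- b) ℤ.- b ℤ.* ℤ.- b ≡ a ℤ.* a ℤ.- a ℤ.* b ℤ.+ b ℤ.* b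
    re-eq = solve-∀
    im-eq : ∀ a b → a ℤ.* ℤ.- b ℤ.+ b ℤ.* (a ℤ.- b) ℤ.- b ℤ.* ℤ.- b ≡ 0ℤ
    im-eq = solve-∀

  norm-⊗ : ∀ x y → norm (x ⊗ y) ≡ norm x ℤ.* norm y
  norm-⊗ (a +ζ b) (c +ζ d) = eq a b c d
    where
    eq : ∀ a b c d → (a ℤ.* c ℤ.- b ℤ.* d) ℤ.* (a ℤ.* c ℤ.- b ℤ.* d)
       ℤ.- (a ℤ.* c ℤ.- b ℤ.* d) ℤ.* (a ℤ.* d ℤ.+ b ℤ.* c ℤ.- b ℤ.* d)
       ℤ.+ (a ℤ.* d ℤ.+ b ℤ.* c ℤ.- b ℤ.* d) ℤ.* (a ℤ.* d ℤ.+ b ℤ.* c ℤ.- b ℤ.* d)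
       ≡ (a ℤ.* a ℤ.- a ℤ.* b ℤ.+ b ℤ.* b) ℤ.* (c ℤ.* c ℤ.- c ℤ.* d ℤ.+ d ℤ.* d)
    eq = solve-∀

  ι-⊗ : ∀ k x → ι k ⊗ x ≡ (k ℤ.* re x +ζ k ℤ.* im x)
  ι-⊗ k (a +ζ b) = cong₂ _+ζ_ (re-eq k a b) (im-eq k a b)
    where
    re-eq : ∀ k a b → k ℤ.* a ℤ.- 0ℤ ℤ.* b ≡ k ℤ.* a
    re-eq = solve-∀
    im-eq : ∀ k a b → k ℤ.* b ℤ.+ 0ℤ ℤ.* a ℤ.- 0ℤ ℤ.* b ≡ k ℤ.* b
    im-eq = solve-∀

  ι-* : ∀ a b → ι (a ℤ.* b) ≡ ι a ⊗ ι b
  ι-* a b = sym (trans (ι-⊗ a (ι b)) (cong (a ℤ.* b +ζ_) (ℤ.*-zeroʳ a)))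

  ι-injective : ∀ {a b} → ι a ≡ ι b → a ≡ b
  ι-injective = cong re

  ι-cancel : ∀ k {x y} → ¬ k ≡ 0ℤ → ι k ⊗ x ≡ ι k ⊗ y → x ≡ y
  ι-cancel k {x@(_ +ζ _)} {y@(_ +ζ _)} k≢0 eq = cong₂ _+ζ_ (cancel (cong re eq′)) (cancel (cong im eq′))
    where
    eq′ = trans (sym (ι-⊗ k x)) (trans eq (ι-⊗ k y))
    cancel : ∀ {a b} → k ℤ.* a ≡ k ℤ.* b → a ≡ b
    cancel {a} {b} = ℤ.*-cancelˡ-≡ k a b {{ℤ.≢-nonZero k≢0}}

  -- Kills every sum that some reindexing turns into its own negative.
  double≡𝟘 : ∀ {x} → x ≡ ⊖ x → x ≡ 𝟘
  double≡𝟘 {a +ζ b} eq = cong₂ _+ζ_ (half (cong re eq)) (half (cong im eq))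
    where
    half : ∀ {a} → a ≡ ℤ.- a → a ≡ 0ℤ
    half {+ 0} _ = refl

  square-abs : ∀ a → a ℤ.* a ≡ + (∣ a ∣ ℕ.* ∣ a ∣)
  square-abs (+ n)      = sym (ℤ.pos-* n n)
  square-abs ℤ.-[1+ n ] = refl

  square≡ : ∀ {a b} → a ℤ.* a ≡ b ℤ.* b → a ≡ b ⊎ a ≡ ℤ.- b
  square≡ {a} {b} eq with ℤ.i*j≡0⇒i≡0∨j≡0 (a ℤ.- b) {a ℤ.+ b} (trans (factor a b) (trans (cong (ℤ._- b ℤ.* b) eq) (ℤ.+-inverseʳ (b ℤ.* b))))
    where
    factor : ∀ a b → (a ℤ.- b) ℤ.* (a ℤ.+ b) ≡ a ℤ.* a ℤ.- b ℤ.* b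
    factor = solve-∀
  ... | inj₁ p = inj₁ (ℤ.i-j≡0⇒i≡j a b p)
  ... | inj₂ p = inj₂ (ℤ.i-j≡0⇒i≡j a (ℤ.- b) (trans (cong (λ c → a ℤ.+ c) (ℤ.neg-involutive b)) p))

  -- If x = a + bζ has x² = r² then b(2a − b) = 0, and b = 2a would give −3a² = r².
  square≡ι : ∀ {x r} → ¬ r ≡ 0ℤ → x ⊗ x ≡ ι (r ℤ.* r) → x ≡ ι r ⊎ x ≡ ι (ℤ.- r)
  square≡ι {a +ζ b} {r} r≢0 eq with ℤ.i*j≡0⇒i≡0∨j≡0 b {+ 2 ℤ.* a ℤ.- b} (trans (factor a b) (cong im eq))
    where
    factor : ∀ a b → b ℤ.* (+ 2 ℤ.* a ℤ.- b) ≡ a ℤ.* b ℤ.+ b ℤ.* a ℤ.- b ℤ.* b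
    factor = solve-∀
  ... | inj₁ refl with square≡ {a} {r} (trans (sym (drop a)) (cong re eq))
    where
    drop : ∀ a → a ℤ.* a ℤ.- 0ℤ ℤ.* 0ℤ ≡ a ℤ.* a
    drop = solve-∀
  ...   | inj₁ refl = inj₁ refl
  ...   | inj₂ refl = inj₂ refl
  square≡ι {a +ζ b} {r} r≢0 eq | inj₂ 2a≡b with ℤ.i-j≡0⇒i≡j (+ 2 ℤ.* a) b 2a≡b
  ... | refl = ⊥-elim (r≢0 (sum-of-squares (trans (cong (λ c → c ℤ.+ + 3 ℤ.* (a ℤ.* a)) (sym (cong re eq))) (vanish a))))
    where
    vanish : ∀ a → (a ℤ.* a ℤ.- (+ 2 ℤ.* a) ℤ.* (+ 2 ℤ.* a)) ℤ.+ + 3 ℤ.* (a ℤ.* a) ≡ 0ℤ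
    vanish = solve-∀
    sum-of-squares : r ℤ.* r ℤ.+ + 3 ℤ.* (a ℤ.* a) ≡ 0ℤ → r ≡ 0ℤ
    sum-of-squares p with ℤ.i*j≡0⇒i≡0∨j≡0 r (trans (square-abs r) (cong +_ (ℕ.m+n≡0⇒m≡0 (∣ r ∣ ℕ.* ∣ r ∣) (ℤ.+-injective
      (trans (sym (cong₂ ℤ._+_ (square-abs r) (trans (cong (+ 3 ℤ.*_) (square-abs a)) (sym (ℤ.pos-* 3 (∣ a ∣ ℕ.* ∣ a ∣)))))) p)))))
    ... | inj₁ r≡0 = r≡0
    ... | inj₂ r≡0 = r≡0

-- Finite sums with values in ℤ[ζ].

module FiniteSums where
  open ≡ using (refl; cong; cong₂; sym; trans)

  open Eisenstein
  open CommutativeRing Eisenstein.commutativeRing public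
    using (semiring; zeroˡ; zeroʳ)
    renaming (+-identityˡ to ⊕-identityˡ; +-identityʳ to ⊕-identityʳ;
              *-identityʳ to ⊗-identityʳ; distribʳ to ⊗-distribʳ-⊕; -‿inverseʳ to ⊖-inverseʳ)
  open import Algebra.Properties.Semiring.Sum semiring public
    using (sum; ∑-comm; ∑-distrib-+; *-distribˡ-sum; *-distribʳ-sum; sum-permute; sum-cong-≗)

  ∑-reindex : ∀ {n} (f : Fin n → ℤ[ζ]) (to from : Fin n → Fin n) →
    (∀ x → to (from x) ≡ x) → (∀ x → from (to x) ≡ x) → sum f ≡ sum (λ x → f (to x))
  ∑-reindex f to from to∘from from∘to = sum-permute f (permutation to from to∘from from∘to)

  [_] : Bool → ℤ[ζ]
  [ true  ] = 𝟙
  [ false ] = 𝟘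

  opaque
    δ : ∀ {n} → Fin n → Fin n → ℤ[ζ]
    δ x y = [ does (x Fin.≟ y) ]

    δ-refl : ∀ {n} (x : Fin n) → δ x x ≡ 𝟙
    δ-refl x = cong [_] (dec-true (x Fin.≟ x) refl)

    δ-≢ : ∀ {n} {x y : Fin n} → ¬ x ≡ y → δ x y ≡ 𝟘
    δ-≢ {_} {x} {y} x≢y = cong [_] (dec-false (x Fin.≟ y) x≢y)

    δ-⇔ : ∀ {m n} {x y : Fin m} {u v : Fin n} → (x ≡ y → u ≡ v) → (u ≡ v → x ≡ y) → δ x y ≡ δ u v
    δ-⇔ {x = x} {y} {u} {v} to from with x Fin.≟ y
    ... | yes x≡y = sym (cong [_] (dec-true (u Fin.≟ v) (to x≡y)))
    ... | no  x≢y = sym (cong [_] (dec-false (u Fin.≟ v) (λ u≡v → x≢y (from u≡v))))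

  ∑-𝟘 : ∀ {n} → sum {n} (λ _ → 𝟘) ≡ 𝟘
  ∑-𝟘 {zero}  = refl
  ∑-𝟘 {suc n} = trans (⊕-identityˡ _) (∑-𝟘 {n})

  ∑-𝟙 : ∀ {n} → sum {n} (λ _ → 𝟙) ≡ ι (+ n)
  ∑-𝟙 {zero}  = refl
  ∑-𝟙 {suc n} = cong (𝟙 ⊕_) (∑-𝟙 {n})

  opaque
    unfolding δ

    ∑-δ : ∀ {n} (a : Fin n) (f : Fin n → ℤ[ζ]) → sum (λ x → δ x a ⊗ f x) ≡ f a
    ∑-δ {suc n} zero    f = trans (cong₂ _⊕_ (⊗-identityˡ (f zero)) (trans (sum-cong-≗ (λ x → zeroˡ (f (suc x)))) (∑-𝟘 {n}))) (⊕-identityʳ _)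
    ∑-δ {suc n} (suc a) f = trans (cong₂ _⊕_ (zeroˡ (f zero)) (∑-δ a (λ x → f (suc x)))) (⊕-identityˡ _)

  ∑-δ′ : ∀ {n} (a : Fin n) (f : Fin n → ℤ[ζ]) → sum (λ x → δ a x ⊗ f x) ≡ f a
  ∑-δ′ a f = trans (sum-cong-≗ (λ x → cong (_⊗ f x) (δ-⇔ {x = a} {x} {x} {a} sym sym))) (∑-δ a f)

  -- Substitution along a map that need not be bijective: each value is weighted by the size of its
  -- fibre. It is applied to squaring.
  ∑-fibres : ∀ {m n} (h : Fin m → Fin n) (f : Fin n → ℤ[ζ]) → sum (λ x → f (h x)) ≡ sum (λ u → sum (λ x → δ (h x) u) ⊗ f u)
  ∑-fibres {m} {n} h f = trans (sum-cong-≗ (λ x → sym (∑-δ′ (h x) f)))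
    (trans (∑-comm {m} {n} (λ x u → δ (h x) u ⊗ f u)) (sum-cong-≗ (λ u → sym (*-distribʳ-sum (f u) (λ x → δ (h x) u)))))

  ∑-linear : ∀ {n} a b (f g : Fin n → ℤ[ζ]) → sum (λ x → a ⊗ f x ⊕ b ⊗ g x) ≡ a ⊗ sum f ⊕ b ⊗ sum g
  ∑-linear a b f g = trans (∑-distrib-+ (λ x → a ⊗ f x) (λ x → b ⊗ g x)) (cong₂ _⊕_ (sym (*-distribˡ-sum a f)) (sym (*-distribˡ-sum b g)))

  conj-sum : ∀ {n} (f : Fin n → ℤ[ζ]) → conj (sum f) ≡ sum (λ x → conj (f x))
  conj-sum {zero}  f = refl
  conj-sum {suc n} f = trans (conj-⊕ (f zero) _) (cong (conj (f zero) ⊕_) (conj-sum (λ x → f (suc x))))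

  open import Algebra.Solver.Ring.AlmostCommutativeRing using (fromCommutativeRing)
  module ℤ[ζ]-Solver where
    open import Algebra.Solver.Ring.Simple (fromCommutativeRing Eisenstein.commutativeRing) _≟_ public
      using () renaming (solve to solveᶻ; _:=_ to _:≡_; _:+_ to _:⊕_; _:*_ to _:⊗_; :-_ to :⊖_; con to conᶻ)

-- Divisibility by 3, parity, and the norm equation over ℤ.

module IntegerLemmas where
  open ≡ using (refl; cong; cong₂; sym; trans)

  prime[3] : Prime 3
  prime[3] = toWitness {a? = prime? 3} _

  ¬2∣3^ : ∀ k → ¬ 2 ∣ 3 ℕ.^ k
  ¬2∣3^ zero    = toWitnessFalse {a? = 2 ∣? 1} _
  ¬2∣3^ (suc k) 2∣ with euclidsLemma 3 (3 ℕ.^ k) prime[2] 2∣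
  ... | inj₁ 2∣3 = toWitnessFalse {a? = 2 ∣? 3} _ 2∣3
  ... | inj₂ 2∣′ = ¬2∣3^ k 2∣′

  prime-to-3 : ∀ k {n} → ¬ 3 ∣ n → n ∣ 3 ℕ.^ k → n ≡ 1
  prime-to-3 zero    _   n∣1 = ∣1⇒≡1 n∣1
  prime-to-3 (suc k) {n} ¬3∣n n∣ = prime-to-3 k ¬3∣n (coprime-divisor coprime n∣)
    where
    coprime : ∀ {d} → (d ∣ n) × (d ∣ 3) → d ≡ 1
    coprime (d∣n , d∣3) with prime⇒irreducible prime[3] d∣3
    ... | inj₁ d≡1 = d≡1
    ... | inj₂ refl = ⊥-elim (¬3∣n d∣n)

  not-9-divisor : ∀ k {n} → n ∣ 3 ℕ.^ k → ¬ 9 ∣ n → n ≡ 1 ⊎ n ≡ 3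
  not-9-divisor k {n} n∣ ¬9∣n with 3 ∣? n
  ... | no ¬3∣n = inj₁ (prime-to-3 k ¬3∣n n∣)
  ... | yes (divides m refl) = inj₂ (cong (ℕ._* 3) (prime-to-3 k ¬3∣m (∣-trans (divides 3 (ℕ.*-comm m 3)) n∣)))
    where
    ¬3∣m : ¬ 3 ∣ m
    ¬3∣m (divides j refl) = ¬9∣n (divides j (ℕ.*-assoc j 3 3))

  3∣square : ∀ x y → x ℤ.* x ≡ + 3 ℤ.* y → ∃[ z ] x ≡ + 3 ℤ.* z
  3∣square x y eq with Signed.∣ᵤ⇒∣ {+ 3} {x} (collapse (euclidsLemma ∣ x ∣ ∣ x ∣ prime[3] (divides ∣ y ∣
      (trans (sym (ℤ.abs-* x x)) (trans (cong ∣_∣ eq) (trans (ℤ.abs-* (+ 3) y) (ℕ.*-comm 3 ∣ y ∣)))))))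
    where
    collapse : ∀ {A : Set} → A ⊎ A → A
    collapse = [ (λ a → a) , (λ a → a) ]′
  ... | Signed.divides z x≡ = z , trans x≡ (ℤ.*-comm z (+ 3))

  -- Descent on n: 3 divides x², hence x, and replacing x and P by their thirds divides the equation
  -- by 9. The coefficient c covers both shapes of the norm equation: ∓1 for x² - xg + g², ±2 for (x
  -- + g)².
  power-divides : ∀ n c x t → let P = + (3 ℕ.^ n) in x ℤ.* (x ℤ.+ c ℤ.* P) ≡ P ℤ.* P ℤ.* t → ∃[ m ] x ≡ m ℤ.* P
  power-divides zero    c x t eq = x , sym (ℤ.*-identityʳ x)
  power-divides (suc n) c x t eq = conclude (3∣square x _ x²≡)
    where
    P : ℤ
    P = + (3 ℕ.^ n)
    3P : + (3 ℕ.^ suc n) ≡ + 3 ℤ.* P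
    3P = ℤ.pos-* 3 (3 ℕ.^ n)
    eq′ : x ℤ.* (x ℤ.+ c ℤ.* (+ 3 ℤ.* P)) ≡ (+ 3 ℤ.* P) ℤ.* (+ 3 ℤ.* P) ℤ.* t
    eq′ = trans (cong (λ u → x ℤ.* (x ℤ.+ c ℤ.* u)) (sym 3P)) (trans eq (cong (λ u → u ℤ.* u ℤ.* t) 3P))
    expand : ∀ x c P → x ℤ.* x ≡ x ℤ.* (x ℤ.+ c ℤ.* (+ 3 ℤ.* P)) ℤ.- + 3 ℤ.* (c ℤ.* P ℤ.* x)
    expand = solve-∀
    collect : ∀ x c P t → (+ 3 ℤ.* P) ℤ.* (+ 3 ℤ.* P) ℤ.* t ℤ.- + 3 ℤ.* (c ℤ.* P ℤ.* x) ≡ + 3 ℤ.* (+ 3 ℤ.* P ℤ.* P ℤ.* t ℤ.- c ℤ.* P ℤ.* x)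
    collect = solve-∀
    x²≡ : x ℤ.* x ≡ + 3 ℤ.* (+ 3 ℤ.* P ℤ.* P ℤ.* t ℤ.- c ℤ.* P ℤ.* x)
    x²≡ = trans (expand x c P) (trans (cong (ℤ._- + 3 ℤ.* (c ℤ.* P ℤ.* x)) eq′) (collect x c P t))
    conclude : (∃[ z ] x ≡ + 3 ℤ.* z) → ∃[ m ] x ≡ m ℤ.* + (3 ℕ.^ suc n)
    conclude (z , x≡3z) = proj₁ ih , trans x≡3z (trans (cong (+ 3 ℤ.*_) (proj₂ ih)) (trans (swap (proj₁ ih) P) (cong (proj₁ ih ℤ.*_) (sym 3P))))
      where
      swap : ∀ m P → + 3 ℤ.* (m ℤ.* P) ≡ m ℤ.* (+ 3 ℤ.* P)
      swap = solve-∀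
      left : ∀ z c P → + 9 ℤ.* (z ℤ.* (z ℤ.+ c ℤ.* P)) ≡ (+ 3 ℤ.* z) ℤ.* (+ 3 ℤ.* z ℤ.+ c ℤ.* (+ 3 ℤ.* P))
      left = solve-∀
      right : ∀ P t → (+ 3 ℤ.* P) ℤ.* (+ 3 ℤ.* P) ℤ.* t ≡ + 9 ℤ.* (P ℤ.* P ℤ.* t)
      right = solve-∀
      ih : ∃[ m ] z ≡ m ℤ.* P
      ih = power-divides n c z t (ℤ.*-cancelˡ-≡ (+ 9) _ _ (trans (left z c P) (trans (cong (λ u → u ℤ.* (u ℤ.+ c ℤ.* (+ 3 ℤ.* P))) (sym x≡3z)) (trans eq′ (right P t)))))

  -- 4(m² − m + 1) = (2m − 1)² + 3.
  ¬9∣m²-m+1 : ∀ m {ρ} → m ℤ.* m ℤ.- m ℤ.+ 1ℤ ≡ + ρ → ¬ 9 ∣ ρ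
  ¬9∣m²-m+1 m {ρ} eq (divides j ρ≡) = contradict (3∣square (+ 2 ℤ.* m ℤ.- 1ℤ) (+ 12 ℤ.* + j ℤ.- 1ℤ) square≡)
    where
    N≡9j : m ℤ.* m ℤ.- m ℤ.+ 1ℤ ≡ + 9 ℤ.* + j
    N≡9j = trans eq (trans (cong +_ (trans ρ≡ (ℕ.*-comm j 9))) (ℤ.pos-* 9 j))
    complete : ∀ m → (+ 2 ℤ.* m ℤ.- 1ℤ) ℤ.* (+ 2 ℤ.* m ℤ.- 1ℤ) ≡ + 4 ℤ.* (m ℤ.* m ℤ.- m ℤ.+ 1ℤ) ℤ.- + 3
    complete = solve-∀
    collect : ∀ j → + 4 ℤ.* (+ 9 ℤ.* j) ℤ.- + 3 ≡ + 3 ℤ.* (+ 12 ℤ.* j ℤ.- 1ℤ)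
    collect = solve-∀
    square≡ : (+ 2 ℤ.* m ℤ.- 1ℤ) ℤ.* (+ 2 ℤ.* m ℤ.- 1ℤ) ≡ + 3 ℤ.* (+ 12 ℤ.* + j ℤ.- 1ℤ)
    square≡ = trans (complete m) (trans (cong (λ u → + 4 ℤ.* u ℤ.- + 3) N≡9j) (collect (+ j)))
    contradict : ¬ (∃[ z ] + 2 ℤ.* m ℤ.- 1ℤ ≡ + 3 ℤ.* z)
    contradict (z , 2m-1≡3z) = toWitnessFalse {a? = 3 ∣? 1} _ (Signed.∣⇒∣ᵤ {+ 3} {1ℤ} (Signed.divides (+ 4 ℤ.* + j ℤ.- z ℤ.* z) 1≡))
      where
      regroup : ∀ z → (+ 3 ℤ.* z) ℤ.* (+ 3 ℤ.* z) ≡ + 3 ℤ.* (+ 3 ℤ.* (z ℤ.* z))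
      regroup = solve-∀
      3z²≡ : + 3 ℤ.* (z ℤ.* z) ≡ + 12 ℤ.* + j ℤ.- 1ℤ
      3z²≡ = ℤ.*-cancelˡ-≡ (+ 3) _ _ (trans (sym (regroup z)) (trans (cong (λ u → u ℤ.* u) (sym 2m-1≡3z)) square≡))
      expand : ∀ j → 1ℤ ≡ + 12 ℤ.* j ℤ.- (+ 12 ℤ.* j ℤ.- 1ℤ)
      expand = solve-∀
      factor : ∀ j y → + 12 ℤ.* j ℤ.- + 3 ℤ.* y ≡ (+ 4 ℤ.* j ℤ.- y) ℤ.* + 3
      factor = solve-∀
      1≡ : 1ℤ ≡ (+ 4 ℤ.* + j ℤ.- z ℤ.* z) ℤ.* + 3
      1≡ = trans (expand (+ j)) (trans (cong (λ u → + 12 ℤ.* + j ℤ.- u) (sym 3z²≡)) (factor (+ j) (z ℤ.* z)))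

  Odd : ℤ → Set
  Odd x = ¬ (∃[ j ] x ≡ + 2 ℤ.* j)

  parity : ∀ m → (∃[ j ] m ≡ + 2 ℤ.* j) ⊎ (∃[ j ] m ≡ + 2 ℤ.* j ℤ.+ 1ℤ)
  parity (+ n) = nat n
    where
    step : ∀ j → 1ℤ ℤ.+ (+ 2 ℤ.* j ℤ.+ 1ℤ) ≡ + 2 ℤ.* (j ℤ.+ 1ℤ)
    step = solve-∀
    nat : ∀ n → (∃[ j ] + n ≡ + 2 ℤ.* j) ⊎ (∃[ j ] + n ≡ + 2 ℤ.* j ℤ.+ 1ℤ)
    nat zero = inj₁ (0ℤ , refl)
    nat (suc n) with nat n
    ... | inj₁ (j , eq) = inj₂ (j , trans (cong (λ u → 1ℤ ℤ.+ u) eq) (ℤ.+-comm 1ℤ (+ 2 ℤ.* j)))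
    ... | inj₂ (j , eq) = inj₁ (j ℤ.+ 1ℤ , trans (cong (λ u → 1ℤ ℤ.+ u) eq) (step j))
  parity ℤ.-[1+ n ] with parity (+ suc n)
  ... | inj₁ (j , eq) = inj₁ (ℤ.- j , trans (cong ℤ.-_ eq) (ℤ.neg-distribʳ-* (+ 2) j))
  ... | inj₂ (j , eq) = inj₂ (ℤ.- j ℤ.- 1ℤ , trans (cong ℤ.-_ eq) (flip j))
    where
    flip : ∀ j → ℤ.- (+ 2 ℤ.* j ℤ.+ 1ℤ) ≡ + 2 ℤ.* (ℤ.- j ℤ.- 1ℤ) ℤ.+ 1ℤ
    flip = solve-∀

  -- Excludes the case ψ(b) = 1, where ρ = (m + 1)² would be even although it divides a power of 3.
  even-square⇒2∣ : ∀ m {ρ} → Odd m → (m ℤ.+ 1ℤ) ℤ.* (m ℤ.+ 1ℤ) ≡ + ρ → 2 ∣ ρ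
  even-square⇒2∣ m {ρ} odd eq with parity m
  ... | inj₁ even = ⊥-elim (odd even)
  ... | inj₂ (j , refl) = Signed.∣⇒∣ᵤ {+ 2} {+ ρ} (Signed.divides (+ 2 ℤ.* (j ℤ.+ 1ℤ) ℤ.* (j ℤ.+ 1ℤ)) (trans (sym eq) (factor j)))
    where
    factor : ∀ j → (+ 2 ℤ.* j ℤ.+ 1ℤ ℤ.+ 1ℤ) ℤ.* (+ 2 ℤ.* j ℤ.+ 1ℤ ℤ.+ 1ℤ) ≡ + 2 ℤ.* (j ℤ.+ 1ℤ) ℤ.* (j ℤ.+ 1ℤ) ℤ.* + 2
    factor = solve-∀

  -- The roots are 0 and 1 here, 2 and -1 for the value 3. Parity keeps one root of each pair, and
  -- it is a unit, which is exactly x = ±g.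
  m²-m+1≡1 : ∀ m → Odd m → m ℤ.* m ℤ.- m ℤ.+ 1ℤ ≡ 1ℤ → m ≡ 1ℤ
  m²-m+1≡1 m odd eq with ℤ.i*j≡0⇒i≡0∨j≡0 m {m ℤ.- 1ℤ} (trans (factor m) (cong (ℤ._- 1ℤ) eq))
    where
    factor : ∀ m → m ℤ.* (m ℤ.- 1ℤ) ≡ (m ℤ.* m ℤ.- m ℤ.+ 1ℤ) ℤ.- 1ℤ
    factor = solve-∀
  ... | inj₁ m≡0 = ⊥-elim (odd (0ℤ , m≡0))
  ... | inj₂ m≡1 = ℤ.i-j≡0⇒i≡j m 1ℤ m≡1

  m²-m+1≡3 : ∀ m → Odd m → m ℤ.* m ℤ.- m ℤ.+ 1ℤ ≡ + 3 → m ≡ -1ℤ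
  m²-m+1≡3 m odd eq with ℤ.i*j≡0⇒i≡0∨j≡0 (m ℤ.- + 2) {m ℤ.- -1ℤ} (trans (factor m) (cong (ℤ._- + 3) eq))
    where
    factor : ∀ m → (m ℤ.- + 2) ℤ.* (m ℤ.- -1ℤ) ≡ (m ℤ.* m ℤ.- m ℤ.+ 1ℤ) ℤ.- + 3
    factor = solve-∀
  ... | inj₁ m≡2  = ⊥-elim (odd (1ℤ , ℤ.i-j≡0⇒i≡j m (+ 2) m≡2))
  ... | inj₂ m≡-1 = ℤ.i-j≡0⇒i≡j m -1ℤ m≡-1

  ±-square : ∀ {g P} → g ≡ P ⊎ g ≡ ℤ.- P → P ℤ.* P ≡ g ℤ.* g
  ±-square (inj₁ refl) = refl
  ±-square {P = P} (inj₂ refl) = sq P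
    where
    sq : ∀ P → P ℤ.* P ≡ ℤ.- P ℤ.* ℤ.- P
    sq = solve-∀

  -- m with m² − m + 1 (or (m + 1)²) a divisor of a power of 3 and m odd must be ±1.
  norm-equation : ∀ n k g x ρ → g ≡ + (3 ℕ.^ n) ⊎ g ≡ ℤ.- + (3 ℕ.^ n) → ρ ∣ 3 ℕ.^ k → Odd x →
    x ℤ.* x ℤ.- x ℤ.* g ℤ.+ g ℤ.* g ≡ g ℤ.* g ℤ.* + ρ ⊎ (x ℤ.+ g) ℤ.* (x ℤ.+ g) ≡ g ℤ.* g ℤ.* + ρ →
    x ≡ g ⊎ x ≡ ℤ.- g
  norm-equation n k g x ρ g≡ ρ∣ odd eqs = solve-for-m (multiple eqs)
    where
    P : ℤ
    P = + (3 ℕ.^ n)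
    P≢0 : ¬ P ≡ 0ℤ
    P≢0 eq = ℕ.<⇒≢ (ℕ.m^n>0 3 n) (sym (ℤ.+-injective eq))
    g²≡P² : g ℤ.* g ≡ P ℤ.* P
    g²≡P² = sym (±-square g≡)
    g²≢0 : ¬ g ℤ.* g ≡ 0ℤ
    g²≢0 eq = [ P≢0 , P≢0 ]′ (ℤ.i*j≡0⇒i≡0∨j≡0 P (trans (sym g²≡P²) eq))
    as-multiple : (∃[ m ] x ≡ m ℤ.* P) → ∃[ m ] x ≡ m ℤ.* g
    as-multiple (m , x≡) = [ (λ g≡P → m , trans x≡ (cong (m ℤ.*_) (sym g≡P)))
                           , (λ g≡-P → ℤ.- m , trans x≡ (trans (double-neg m P) (cong (ℤ.- m ℤ.*_) (sym g≡-P)))) ]′ g≡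
      where
      double-neg : ∀ m P → m ℤ.* P ≡ ℤ.- m ℤ.* ℤ.- P
      double-neg = solve-∀
    c : ℤ
    c = [ (λ _ → 1ℤ) , (λ _ → -1ℤ) ]′ g≡
    g≡cP : g ≡ c ℤ.* P
    g≡cP = lemma g≡
      where
      lemma : (p : g ≡ P ⊎ g ≡ ℤ.- P) → g ≡ [ (λ _ → 1ℤ) , (λ _ → -1ℤ) ]′ p ℤ.* P
      lemma (inj₁ p) = trans p (sym (ℤ.*-identityˡ P))
      lemma (inj₂ p) = trans p (sym (ℤ.-1*i≡-i P))
    multiple : x ℤ.* x ℤ.- x ℤ.* g ℤ.+ g ℤ.* g ≡ g ℤ.* g ℤ.* + ρ ⊎ (x ℤ.+ g) ℤ.* (x ℤ.+ g) ≡ g ℤ.* g ℤ.* + ρ → ∃[ m ] x ≡ m ℤ.* g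
    multiple (inj₁ eq) = as-multiple (power-divides n (ℤ.- c) x (+ ρ ℤ.- 1ℤ)
      (trans (expand x c P) (trans (cong (λ g → x ℤ.* x ℤ.- x ℤ.* g) (sym g≡cP)) (trans (add x g) (trans (cong (ℤ._- g ℤ.* g) eq) (trans (cong (λ u → u ℤ.* + ρ ℤ.- u) g²≡P²) (collect (P ℤ.* P) (+ ρ))))))))
      where
      expand : ∀ x c P → x ℤ.* (x ℤ.+ ℤ.- c ℤ.* P) ≡ x ℤ.* x ℤ.- x ℤ.* (c ℤ.* P)
      expand = solve-∀
      add : ∀ x g → x ℤ.* x ℤ.- x ℤ.* g ≡ (x ℤ.* x ℤ.- x ℤ.* g ℤ.+ g ℤ.* g) ℤ.- g ℤ.* g
      add = solve-∀
      collect : ∀ u t → u ℤ.* t ℤ.- u ≡ u ℤ.* (t ℤ.- 1ℤ)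
      collect = solve-∀
    multiple (inj₂ eq) = as-multiple (power-divides n (+ 2 ℤ.* c) x (+ ρ ℤ.- 1ℤ)
      (trans (expand x c P) (trans (cong (λ g → x ℤ.* x ℤ.+ + 2 ℤ.* x ℤ.* g) (sym g≡cP)) (trans (add x g) (trans (cong (ℤ._- g ℤ.* g) eq) (trans (cong (λ u → u ℤ.* + ρ ℤ.- u) g²≡P²) (collect (P ℤ.* P) (+ ρ))))))))
      where
      expand : ∀ x c P → x ℤ.* (x ℤ.+ + 2 ℤ.* c ℤ.* P) ≡ x ℤ.* x ℤ.+ + 2 ℤ.* x ℤ.* (c ℤ.* P)
      expand = solve-∀
      add : ∀ x g → x ℤ.* x ℤ.+ + 2 ℤ.* x ℤ.* g ≡ (x ℤ.+ g) ℤ.* (x ℤ.+ g) ℤ.- g ℤ.* g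
      add = solve-∀
      collect : ∀ u t → u ℤ.* t ℤ.- u ≡ u ℤ.* (t ℤ.- 1ℤ)
      collect = solve-∀
    solve-for-m : (∃[ m ] x ≡ m ℤ.* g) → x ≡ g ⊎ x ≡ ℤ.- g
    solve-for-m (m , x≡mg) = [ (λ eq → irreducible-case (cancel (trans (square₁ m g) (trans (cong (λ x → x ℤ.* x ℤ.- x ℤ.* g ℤ.+ g ℤ.* g) (sym x≡mg)) eq))))
                             , (λ eq → ⊥-elim (¬2∣3^ k (∣-trans (even-square⇒2∣ m m-odd (cancel (trans (square₂ m g) (trans (cong (λ x → (x ℤ.+ g) ℤ.* (x ℤ.+ g)) (sym x≡mg)) eq)))) ρ∣))) ]′ eqs
      where
      square₁ : ∀ m g → g ℤ.* g ℤ.* (m ℤ.* m ℤ.- m ℤ.+ 1ℤ) ≡ (m ℤ.* g) ℤ.* (m ℤ.* g) ℤ.- (m ℤ.* g) ℤ.* g ℤ.+ g ℤ.* g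
      square₁ = solve-∀
      square₂ : ∀ m g → g ℤ.* g ℤ.* ((m ℤ.+ 1ℤ) ℤ.* (m ℤ.+ 1ℤ)) ≡ (m ℤ.* g ℤ.+ g) ℤ.* (m ℤ.* g ℤ.+ g)
      square₂ = solve-∀
      cancel : ∀ {a b} → g ℤ.* g ℤ.* a ≡ g ℤ.* g ℤ.* b → a ≡ b
      cancel {a} {b} = ℤ.*-cancelˡ-≡ (g ℤ.* g) a b {{ℤ.≢-nonZero g²≢0}}
      m-odd : Odd m
      m-odd (j , refl) = odd (j ℤ.* g , trans x≡mg (ℤ.*-assoc (+ 2) j g))
      irreducible-case : m ℤ.* m ℤ.- m ℤ.+ 1ℤ ≡ + ρ → x ≡ g ⊎ x ≡ ℤ.- g
      irreducible-case eq = [ (λ { refl → inj₁ (trans x≡mg (trans (cong (ℤ._* g) (m²-m+1≡1 m m-odd eq)) (ℤ.*-identityˡ g))) })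
                            , (λ { refl → inj₂ (trans x≡mg (trans (cong (ℤ._* g) (m²-m+1≡3 m m-odd eq)) (ℤ.-1*i≡-i g))) }) ]′
                            (not-9-divisor k ρ∣ (¬9∣m²-m+1 m eq))

-- Fourth roots of unity as pairs of real and imaginary parts.

module QuarticValues where
  open ≡ using (refl; cong; cong₂; sym; trans)

  open Eisenstein
  open FiniteSums

  -- The real and imaginary parts of i to the power k, that is, cosine and sine of k right angles.
  cos sin : ℕ → ℤ[ζ]
  cos zero    = 𝟙
  cos (suc k) = ⊖ sin k
  sin zero    = 𝟘
  sin (suc k) = cos k

  cos-+ : ∀ k l → cos (k ℕ.+ l) ≡ cos k ⊗ cos l ⊕ ⊖ (sin k ⊗ sin l)
  sin-+ : ∀ k l → sin (k ℕ.+ l) ≡ cos k ⊗ sin l ⊕ sin k ⊗ cos l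
  cos-+ zero    l = solveᶻ 2 (λ c s → c :≡ conᶻ 𝟙 :⊗ c :⊕ :⊖ (conᶻ 𝟘 :⊗ s)) refl (cos l) (sin l)
    where open ℤ[ζ]-Solver
  cos-+ (suc k) l = trans (cong ⊖_ (sin-+ k l))
    (solveᶻ 4 (λ a b c d → :⊖ (a :⊗ b :⊕ c :⊗ d) :≡ (:⊖ c) :⊗ d :⊕ :⊖ (a :⊗ b)) refl (cos k) (sin l) (sin k) (cos l))
    where open ℤ[ζ]-Solver
  sin-+ zero    l = solveᶻ 2 (λ c s → s :≡ conᶻ 𝟙 :⊗ s :⊕ conᶻ 𝟘 :⊗ c) refl (cos l) (sin l)
    where open ℤ[ζ]-Solver
  sin-+ (suc k) l = trans (cos-+ k l)
    (solveᶻ 4 (λ a b c d → a :⊗ b :⊕ :⊖ (c :⊗ d) :≡ (:⊖ c) :⊗ d :⊕ a :⊗ b) refl (cos k) (cos l) (sin k) (sin l))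
    where open ℤ[ζ]-Solver

  ⊖-involutive : ∀ x → ⊖ (⊖ x) ≡ x
  ⊖-involutive = solveᶻ 1 (λ x → :⊖ (:⊖ x) :≡ x) refl
    where open ℤ[ζ]-Solver

  cos-period : ∀ m k → cos (m ℕ.* 4 ℕ.+ k) ≡ cos k
  cos-period zero    k = refl
  cos-period (suc m) k = trans (⊖-involutive _) (cos-period m k)

  sin-period : ∀ m k → sin (m ℕ.* 4 ℕ.+ k) ≡ sin k
  sin-period zero    k = refl
  sin-period (suc m) k = trans (⊖-involutive _) (sin-period m k)

  -- Identities that use χ⁴ = 1, and so fail for arbitrary pairs, become finite checks on these four
  -- cases; `Quartic₀` adds the value of χ at 0.
  data Quartic : ℤ[ζ] → ℤ[ζ] → Set where
    at-1  : Quartic 𝟙 𝟘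
    at-i  : Quartic 𝟘 𝟙
    at--1 : Quartic (⊖ 𝟙) 𝟘
    at--i : Quartic 𝟘 (⊖ 𝟙)

  data Quartic₀ : ℤ[ζ] → ℤ[ζ] → Set where
    at-0 : Quartic₀ 𝟘 𝟘
    unit : ∀ {a b} → Quartic a b → Quartic₀ a b

  cos-sin-quartic : ∀ k → Quartic (cos k) (sin k)
  cos-sin-quartic zero = at-1
  cos-sin-quartic (suc k) with sin k | cos k | cos-sin-quartic k
  ... | _ | _ | at-1  = at-i
  ... | _ | _ | at-i  = at--1
  ... | _ | _ | at--1 = at--i
  ... | _ | _ | at--i = at-1

  double-value : ∀ {a b} → Quartic₀ a b → a ⊗ b ⊕ b ⊗ a ≡ 𝟘
  double-value at-0         = refl
  double-value (unit at-1)  = refl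
  double-value (unit at-i)  = refl
  double-value (unit at--1) = refl
  double-value (unit at--i) = refl

  -- Together with `cube-im`: χ³ is the conjugate of χ. The `𝟘` stands for the imaginary part 2ab of
  -- χ², already evaluated by `double-value`.
  cube-re : ∀ {a b} → Quartic₀ a b → (a ⊗ a ⊕ ⊖ (b ⊗ b)) ⊗ a ⊕ ⊖ (𝟘 ⊗ b) ≡ a
  cube-re at-0         = refl
  cube-re (unit at-1)  = refl
  cube-re (unit at-i)  = refl
  cube-re (unit at--1) = refl
  cube-re (unit at--i) = refl

  cube-im : ∀ {a b} → Quartic₀ a b → (a ⊗ a ⊕ ⊖ (b ⊗ b)) ⊗ b ⊕ 𝟘 ⊗ a ≡ ⊖ b
  cube-im at-0         = refl
  cube-im (unit at-1)  = refl
  cube-im (unit at-i)  = refl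
  cube-im (unit at--1) = refl
  cube-im (unit at--i) = refl

  inverse-value : ∀ {a b c d} → Quartic a b → Quartic c d → a ⊗ c ⊕ ⊖ (b ⊗ d) ≡ 𝟙 → c ≡ a × d ≡ ⊖ b
  inverse-value at-1  at-1  _ = refl , refl
  inverse-value at-i  at--i _ = refl , refl
  inverse-value at--1 at--1 _ = refl , refl
  inverse-value at--i at-i  _ = refl , refl
  inverse-value at-1  at-i  ()
  inverse-value at-1  at--1 ()
  inverse-value at-1  at--i ()
  inverse-value at-i  at-1  ()
  inverse-value at-i  at-i  ()
  inverse-value at-i  at--1 ()
  inverse-value at--1 at-1  ()
  inverse-value at--1 at-i  ()
  inverse-value at--1 at--i ()
  inverse-value at--i at-1  ()
  inverse-value at--i at--1 ()
  inverse-value at--i at--i ()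

  re-norm : ∀ {a b} → Quartic₀ a b → a ⊗ (a ⊗ a ⊕ ⊖ (b ⊗ b)) ≡ a
  re-norm at-0         = refl
  re-norm (unit at-1)  = refl
  re-norm (unit at-i)  = refl
  re-norm (unit at--1) = refl
  re-norm (unit at--i) = refl

  -- The second factor is the real number χ², and conj(χ)·χ² = χ; both sides are Re + Im of this.
  difference-norm : ∀ {a b} → Quartic₀ a b → (a ⊕ ⊖ b) ⊗ (a ⊗ a ⊕ ⊖ (b ⊗ b)) ≡ a ⊕ b
  difference-norm at-0         = refl
  difference-norm (unit at-1)  = refl
  difference-norm (unit at-i)  = refl
  difference-norm (unit at--1) = refl
  difference-norm (unit at--i) = refl

  data Sign : ℤ[ζ] → Set where
    plus  : Sign 𝟙
    minus : Sign (⊖ 𝟙)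

  Sign-square : ∀ {x} → Sign x → x ⊗ x ≡ 𝟙
  Sign-square plus  = refl
  Sign-square minus = refl

  Sign-⊗ : ∀ {x y} → Sign x → Sign y → Sign (x ⊗ y)
  Sign-⊗ plus  plus  = plus
  Sign-⊗ plus  minus = minus
  Sign-⊗ minus plus  = minus
  Sign-⊗ minus minus = plus

  norm-sign : ∀ {a b} → Quartic a b → Sign (a ⊗ a ⊕ ⊖ (b ⊗ b))
  norm-sign at-1  = plus
  norm-sign at-i  = minus
  norm-sign at--1 = plus
  norm-sign at--i = minus

  sum-sign : ∀ {a b} → Quartic a b → Sign (a ⊕ b)
  sum-sign at-1  = plus
  sum-sign at-i  = plus
  sum-sign at--1 = minus
  sum-sign at--i = minus

module Arithmetic where
  open ≡ using (refl; cong; cong₂; sym; trans)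

  halve : ∀ k → (∃[ j ] k ≡ j ℕ.+ j) ⊎ (∃[ j ] k ≡ suc (j ℕ.+ j))
  halve zero = inj₁ (0 , refl)
  halve (suc k) with halve k
  ... | inj₁ (j , refl) = inj₂ (j , refl)
  ... | inj₂ (j , refl) = inj₁ (suc j , cong suc (sym (ℕ.+-suc j j)))

  4h+4h : ∀ h → h ℕ.* 4 ℕ.+ h ℕ.* 4 ≡ 8 ℕ.* h
  4h+4h = ℕ-solve-∀

-- Sums of signs as counts.

module SignSums where
  open ≡ using (refl; cong; cong₂; sym; trans)

  open Eisenstein
  open FiniteSums
  open QuarticValues

  -- The index map `g` is there for the induction, since `tabulate` recurses along `g` composed with
  -- `suc` while `f` stays fixed. The formula serves twice: for the parity of T, and for reading an
  -- intersection number off T.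
  ∑-signs : ∀ {m n} (f : Fin m → ℤ[ζ]) → (∀ x → Sign (f x)) → (g : Fin n → Fin m) →
    sum (λ i → f (g i)) ≡ ι (+ 2 ℤ.* + length (filter (λ x → f x ≟ 𝟙) (tabulate g)) ℤ.- + n)
  ∑-signs {n = zero}  f sign g = refl
  ∑-signs {n = suc n} f sign g = step (f (g zero)) refl (sign (g zero))
    where
    P? : ∀ x → Dec (f x ≡ 𝟙)
    P? x = f x ≟ 𝟙
    rest : List _
    rest = filter P? (tabulate (λ i → g (suc i)))
    c : ℤ
    c = + length rest
    ih : sum (λ i → f (g (suc i))) ≡ ι (+ 2 ℤ.* c ℤ.- + n)
    ih = ∑-signs f sign (λ i → g (suc i))
    plus-eq : ∀ c n → 1ℤ ℤ.+ (+ 2 ℤ.* c ℤ.- n) ≡ + 2 ℤ.* (1ℤ ℤ.+ c) ℤ.- (1ℤ ℤ.+ n)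
    plus-eq = solve-∀
    minus-eq : ∀ c n → -1ℤ ℤ.+ (+ 2 ℤ.* c ℤ.- n) ≡ + 2 ℤ.* c ℤ.- (1ℤ ℤ.+ n)
    minus-eq = solve-∀
    Goal : Set
    Goal = sum (λ i → f (g i)) ≡ ι (+ 2 ℤ.* + length (filter P? (tabulate g)) ℤ.- + suc n)
    𝟙≢⊖𝟙 : ¬ ⊖ 𝟙 ≡ 𝟙
    𝟙≢⊖𝟙 ()
    step : ∀ s → f (g zero) ≡ s → Sign s → Goal
    step _ fg≡ plus = trans (cong₂ _⊕_ fg≡ ih) (trans (cong ι (plus-eq c (+ n)))
      (cong (λ l → ι (+ 2 ℤ.* + length l ℤ.- + suc n)) (sym (filter-accept P? {xs = tabulate (λ i → g (suc i))} fg≡))))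
    step _ fg≡ minus = trans (cong₂ _⊕_ fg≡ ih) (trans (cong ι (minus-eq c (+ n)))
      (cong (λ l → ι (+ 2 ℤ.* + length l ℤ.- + suc n)) (sym (filter-reject P? {xs = tabulate (λ i → g (suc i))} (λ p → 𝟙≢⊖𝟙 (trans (sym fg≡) p))))))

  open IntegerLemmas

  2c-q-odd : ∀ c h → Odd (+ 2 ℤ.* c ℤ.- + suc (8 ℕ.* h))
  2c-q-odd c h (j , eq) = 1-odd (c ℤ.- j ℤ.- + 4 ℤ.* + h , trans (isolate c (+ h)) (trans (cong (λ u → + 2 ℤ.* c ℤ.- + 8 ℤ.* + h ℤ.- u) eq′) (factor c j (+ h))))
    where
    eq′ : + 2 ℤ.* c ℤ.- (1ℤ ℤ.+ + 8 ℤ.* + h) ≡ + 2 ℤ.* j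
    eq′ = trans (cong (λ u → + 2 ℤ.* c ℤ.- (1ℤ ℤ.+ u)) (sym (ℤ.pos-* 8 h))) eq
    isolate : ∀ c h → 1ℤ ≡ + 2 ℤ.* c ℤ.- + 8 ℤ.* h ℤ.- (+ 2 ℤ.* c ℤ.- (1ℤ ℤ.+ + 8 ℤ.* h))
    isolate = solve-∀
    factor : ∀ c j h → + 2 ℤ.* c ℤ.- + 8 ℤ.* h ℤ.- + 2 ℤ.* j ≡ + 2 ℤ.* (c ℤ.- j ℤ.- + 4 ℤ.* h)
    factor = solve-∀
    1-odd : Odd 1ℤ
    1-odd (+ zero , ())
    1-odd (+ suc (suc n) , ())
    1-odd (ℤ.-[1+ n ] , ())

bundle : ∀ {q} {_+_ _*_ : Op₂ (Fin q)} { -_ : Op₁ (Fin q)} {0# 1# : Fin q} →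
  IsCommutativeRing _≡_ _+_ _*_ -_ 0# 1# → CommutativeRing 0ℓ 0ℓ
bundle isCommutativeRing = record { isCommutativeRing = isCommutativeRing }

-- Character sums over a field with q = 9^(e+1) elements.

module FiniteFieldCharThree
  {q : ℕ} {_+′_ _*′_ : Op₂ (Fin q)} { -′_ : Op₁ (Fin q)} {0′ 1′ : Fin q}
  (isCommutativeRing : IsCommutativeRing _≡_ _+′_ _*′_ -′_ 0′ 1′)
  (isField : IsField (bundle isCommutativeRing))
  (char3 : CharThree (bundle isCommutativeRing))
  (e h : ℕ) (q≡3^2e : q ≡ 3 ℕ.^ (2 ℕ.* suc e)) (q≡1+8h : q ≡ suc (8 ℕ.* h))
  (w : Fin q) (w-order : FieldNotation.HasOrder (bundle isCommutativeRing) w (8 ℕ.* h))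
  (generates : ∀ x → ¬ x ≡ 0′ → ∃[ k ] (x ≡ FieldNotation._^_ (bundle isCommutativeRing) w k))
  where

  F : CommutativeRing 0ℓ 0ℓ
  F = bundle isCommutativeRing

  -- The field lives on `Fin q` itself, so that a sum over the field is a `sum` over indices and
  -- equality is decidable.
  K : Set
  K = Fin q

  open CommutativeRing F using (_+_; _*_; -_; _-_; 0#; 1#; +-comm; +-identityˡ; +-identityʳ; *-comm; *-assoc;
    *-identityˡ; *-identityʳ; distribˡ; distribʳ; -‿inverseʳ; -‿inverseˡ) renaming (zeroˡ to *-zeroˡ; zeroʳ to *-zeroʳ)
  open FieldNotation F using (_^_)
  open PowerLaws F
  open FieldProperties F isField Fin._≟_
  module S = CharThreeSolver F char3
  open S
  open Eisenstein
  open FiniteSums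
  open QuarticValues
  open Arithmetic
  open IntegerLemmas
  open SignSums
  open ≡ using (refl; cong; cong₂; sym; trans)
  open ≡.≡-Reasoning

  -- Polynomial functions

  -- Horner schemes for degree below n, and for monic of degree n in `Monic`. They serve to bound
  -- the number of roots of the trace, and so to show that ψ is not trivial.
  data Below : ℕ → (K → K) → Set where
    zeroᵇ : ∀ {f} → (∀ x → f x ≡ 0#) → Below 0 f
    stepᵇ : ∀ {n f g} a → Below n g → (∀ x → f x ≡ a + x * g x) → Below (suc n) f

  data Monic : ℕ → (K → K) → Set where
    oneᵐ  : ∀ {f} → (∀ x → f x ≡ 1#) → Monic 0 f
    stepᵐ : ∀ {n f g} a → Monic n g → (∀ x → f x ≡ a + x * g x) → Monic (suc n) f

  Below-suc : ∀ {n f} → Below n f → Below (suc n) f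
  Below-suc (zeroᵇ f≡0)   = stepᵇ {g = λ _ → 0#} 0# (zeroᵇ (λ _ → refl)) (λ x → trans (f≡0 x) (solve 1 (λ x → con 0₃ := con 0₃ :+ x :* con 0₃) refl x))
  Below-suc (stepᵇ a g f≡) = stepᵇ a (Below-suc g) f≡

  Below-≤ : ∀ {m n f} → m ℕ.≤′ n → Below m f → Below n f
  Below-≤ ℕ.≤′-refl       p = p
  Below-≤ (ℕ.≤′-step m≤n) p = Below-suc (Below-≤ m≤n p)

  Monic⇒Below : ∀ {n f} → Monic n f → Below (suc n) f
  Monic⇒Below (oneᵐ f≡1)     = stepᵇ {g = λ _ → 0#} 1# (zeroᵇ (λ _ → refl)) (λ x → trans (f≡1 x) (solve 1 (λ x → con 1₃ := con 1₃ :+ x :* con 0₃) refl x))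
  Monic⇒Below (stepᵐ a g f≡) = stepᵇ a (Monic⇒Below g) f≡

  Monic-+ : ∀ {n f g} r → Monic n f → Below n g → Monic n (λ x → f x + r * g x)
  Monic-+ r (oneᵐ f≡1) (zeroᵇ g≡0) = oneᵐ (λ x → trans (cong₂ (λ a b → a + r * b) (f≡1 x) (g≡0 x)) (solve 1 (λ r → con 1₃ :+ r :* con 0₃ := con 1₃) refl r))
  Monic-+ r (stepᵐ {g = f′} a f f≡) (stepᵇ {g = g′} b g g≡) = stepᵐ (a + r * b) (Monic-+ r f g)
    (λ x → trans (cong₂ (λ u v → u + r * v) (f≡ x) (g≡ x))
      (solve 6 (λ a b r x f g → (a :+ x :* f) :+ r :* (b :+ x :* g) := (a :+ r :* b) :+ x :* (f :+ r :* g)) refl a b r x (f′ x) (g′ x)))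

  Monic-^ : ∀ n → Monic n (_^ n)
  Monic-^ zero    = oneᵐ (λ _ → refl)
  Monic-^ (suc n) = stepᵐ 0# (Monic-^ n) (λ x → sym (+-identityˡ _))

  divide : ∀ {n f} → Monic (suc n) f → ∀ r → ∃[ g ] (Monic n g × (∀ x → f x ≡ (x - r) * g x + f r))
  divide (stepᵐ {g = g} a (oneᵐ g≡1) f≡) r = (λ _ → 1#) , oneᵐ (λ _ → refl) , λ x →
    trans (trans (f≡ x) (cong (λ u → a + x * u) (g≡1 x)))
      (trans (solve 3 (λ a x r → a :+ x :* con 1₃ := (x :- r) :* con 1₃ :+ (a :+ r :* con 1₃)) refl a x r)
        (cong (λ u → (x - r) * 1# + u) (sym (trans (f≡ r) (cong (λ u → a + r * u) (g≡1 r))))))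
  divide (stepᵐ {g = g} a g-monic@(stepᵐ _ _ _) f≡) r with divide g-monic r
  ... | g′ , g′-monic , g≡ = (λ x → g x + r * g′ x) , Monic-+ r g-monic (Monic⇒Below g′-monic) , λ x → begin
    _  ≡⟨ f≡ x ⟩
    a + x * g x  ≡⟨ solve 4 (λ a x r u → a :+ x :* u := (x :- r) :* u :+ (a :+ r :* u)) refl a x r (g x) ⟩
    (x - r) * g x + (a + r * g x)  ≡⟨ cong (λ u → (x - r) * g x + (a + r * u)) (g≡ x) ⟩
    (x - r) * g x + (a + r * ((x - r) * g′ x + g r))  ≡⟨ solve 6 (λ a x r u v t → (x :- r) :* u :+ (a :+ r :* ((x :- r) :* v :+ t)) := (x :- r) :* (u :+ r :* v) :+ (a :+ r :* t)) refl a x r (g x) (g′ x) (g r) ⟩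
    (x - r) * (g x + r * g′ x) + (a + r * g r)  ≡⟨ cong (λ u → (x - r) * (g x + r * g′ x) + u) (f≡ r) ⟨
    _  ∎

  roots-bound : ∀ {n f} → Monic n f → ∀ xs → Unique xs → All (λ x → f x ≡ 0#) xs → length xs ℕ.≤ n
  roots-bound _          []       _ _ = ℕ.z≤n
  roots-bound (oneᵐ f≡1) (x ∷ _)  _ (fx≡0 ∷ _) = ⊥-elim (0≉1 (trans (sym fx≡0) (f≡1 x)))
  roots-bound f@(stepᵐ _ _ _) (r ∷ xs) (r∉xs ∷ unique) (fr≡0 ∷ roots) with divide f r
  ... | g , g-monic , f≡ = ℕ.s≤s (roots-bound g-monic xs unique (All.zipWith root (r∉xs , roots)))
    where
    root : ∀ {x} → (¬ r ≡ x) × _ → g x ≡ 0#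
    root {x} (r≢x , fx≡0) with zero-product (trans (sym (+-identityʳ _)) (trans (cong (λ u → (x - r) * g x + u) (sym fr≡0)) (trans (sym (f≡ x)) fx≡0)))
    ... | inj₁ x-r≡0 = ⊥-elim (r≢x (sym (x-y≈0⇒x≈y x-r≡0)))
    ... | inj₂ gx≡0  = gx≡0

  -- The additive character

  cube : K → K
  cube x = x * x * x

  frob : ℕ → K → K
  frob zero    x = x
  frob (suc k) x = frob k (cube x)

  cube-+ : ∀ x y → cube (x + y) ≡ cube x + cube y
  cube-+ = solve 2 (λ x y → (x :+ y) :* (x :+ y) :* (x :+ y) := x :* x :* x :+ y :* y :* y) refl

  cube-* : ∀ x y → cube (x * y) ≡ cube x * cube y
  cube-* = solve 2 (λ x y → (x :* y) :* (x :* y) :* (x :* y) := (x :* x :* x) :* (y :* y :* y)) refl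

  frob-+ : ∀ k x y → frob k (x + y) ≡ frob k x + frob k y
  frob-+ zero    x y = refl
  frob-+ (suc k) x y = trans (cong (frob k) (cube-+ x y)) (frob-+ k (cube x) (cube y))

  frob-cube : ∀ k x → frob k (cube x) ≡ cube (frob k x)
  frob-cube zero    x = refl
  frob-cube (suc k) x = frob-cube k (cube x)

  frob-^ : ∀ k x → frob k x ≡ x ^ (3 ℕ.^ k)
  frob-^ zero    x = sym (*-identityʳ x)
  frob-^ (suc k) x = trans (frob-^ k (cube x)) (trans (^-cong (3 ℕ.^ k) (solve 1 (λ x → x :* x :* x := x :* (x :* (x :* con 1₃))) refl x)) (sym (^-* x 3 (3 ℕ.^ k))))

  nonzero-elim : ∀ {p} {P : K → Set p} → (∀ k → P (w ^ k)) → ∀ x → ¬ x ≡ 0# → P x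
  nonzero-elim {P = P} p x x≢0 with generates x x≢0
  ... | k , x≡w^k = ≡.subst P (sym x≡w^k) (p k)

  w^8h≡1 : w ^ (8 ℕ.* h) ≡ 1#
  w^8h≡1 = proj₁ (proj₂ w-order)

  x^8h≡1 : ∀ x → ¬ x ≡ 0# → x ^ (8 ℕ.* h) ≡ 1#
  x^8h≡1 = nonzero-elim (λ k → trans (^-^-comm w k (8 ℕ.* h)) (trans (^-cong k w^8h≡1) (1^ k)))

  x^q≡x : ∀ x → x ^ q ≡ x
  x^q≡x x with x Fin.≟ 0#
  ... | yes refl = trans (cong (0# ^_) q≡1+8h) (0^ (8 ℕ.* h))
  ... | no  x≢0  = trans (cong (x ^_) q≡1+8h) (trans (cong (x *_) (x^8h≡1 x x≢0)) (*-identityʳ x))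

  frob-period : ∀ x → frob (2 ℕ.* suc e) x ≡ x
  frob-period x = trans (frob-^ (2 ℕ.* suc e) x) (trans (cong (x ^_) (sym q≡3^2e)) (x^q≡x x))

  -- The factor `1#` gives the sum the shape that `Monic-+` produces.
  tr : ℕ → K → K
  tr zero    x = 0#
  tr (suc k) x = frob k x + 1# * tr k x

  tr-+ : ∀ k x y → tr k (x + y) ≡ tr k x + tr k y
  tr-+ zero    x y = sym (+-identityˡ _)
  tr-+ (suc k) x y = trans (cong₂ (λ a b → a + 1# * b) (frob-+ k x y) (tr-+ k x y))
    (solve 4 (λ a b c d → (a :+ b) :+ con 1₃ :* (c :+ d) := (a :+ con 1₃ :* c) :+ (b :+ con 1₃ :* d)) refl (frob k x) (frob k y) (tr k x) (tr k y))

  tr-cube : ∀ k x → tr k (cube x) ≡ cube (tr k x)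
  tr-cube zero    x = solve 0 (con 0₃ := con 0₃ :* con 0₃ :* con 0₃) refl
  tr-cube (suc k) x = trans (cong₂ (λ a b → a + 1# * b) (frob-cube k x) (tr-cube k x))
    (solve 2 (λ a b → a :* a :* a :+ con 1₃ :* (b :* b :* b) := (a :+ con 1₃ :* b) :* (a :+ con 1₃ :* b) :* (a :+ con 1₃ :* b)) refl (frob k x) (tr k x))

  -- Cubing moves each conjugate of x to the next one, so only the two ends of the sum differ. At
  -- the full period `frob` is the identity and the trace becomes a fixed point of cubing, that is,
  -- an element of the prime field.
  tr-telescope : ∀ k x → cube (tr k x) + x ≡ tr k x + frob k x
  tr-telescope zero    x = solve 1 (λ x → con 0₃ :* con 0₃ :* con 0₃ :+ x := con 0₃ :+ x) refl x
  tr-telescope (suc k) x = begin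
    cube (frob k x + 1# * tr k x) + x  ≡⟨ solve 3 (λ a b x → (a :+ con 1₃ :* b) :* (a :+ con 1₃ :* b) :* (a :+ con 1₃ :* b) :+ x := (b :* b :* b :+ x) :+ a :* a :* a) refl (frob k x) (tr k x) x ⟩
    (cube (tr k x) + x) + cube (frob k x)  ≡⟨ cong₂ _+_ (tr-telescope k x) (sym (frob-cube k x)) ⟩
    (tr k x + frob k x) + frob (suc k) x  ≡⟨ solve 3 (λ a b c → (b :+ a) :+ c := (a :+ con 1₃ :* b) :+ c) refl (frob k x) (tr k x) (frob (suc k) x) ⟩
    (frob k x + 1# * tr k x) + frob (suc k) x  ∎

  tr-Monic : ∀ k → Monic (3 ℕ.^ k) (tr (suc k))
  tr-Below : ∀ k → Below (3 ℕ.^ k) (tr k)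
  Monic-cong : ∀ {n f g} → (∀ x → f x ≡ g x) → Monic n f → Monic n g
  Monic-cong f≡g (oneᵐ f≡1)     = oneᵐ (λ x → trans (sym (f≡g x)) (f≡1 x))
  Monic-cong f≡g (stepᵐ a g f≡) = stepᵐ a g (λ x → trans (sym (f≡g x)) (f≡ x))
  tr-Monic k = Monic-cong (λ x → cong (_+ 1# * tr k x) (sym (frob-^ k x))) (Monic-+ 1# (Monic-^ (3 ℕ.^ k)) (tr-Below k))
  tr-Below zero    = Below-suc (zeroᵇ (λ _ → refl))
  tr-Below (suc k) = Below-≤ (ℕ.≤⇒≤′ (ℕ.^-monoʳ-< 3 (ℕ.s≤s (ℕ.s≤s ℕ.z≤n)) (ℕ.n<1+n k))) (Monic⇒Below (tr-Monic k))

  opaque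
    trace : K → K
    trace = tr (2 ℕ.* suc e)

    trace-+ : ∀ x y → trace (x + y) ≡ trace x + trace y
    trace-+ = tr-+ (2 ℕ.* suc e)

    trace-cube : ∀ x → trace (cube x) ≡ cube (trace x)
    trace-cube = tr-cube (2 ℕ.* suc e)

    cube-trace : ∀ x → cube (trace x) ≡ trace x
    cube-trace x = x-y≈0⇒x≈y (trans (solve 3 (λ a b x → a :- b := (a :+ x) :- (b :+ x)) refl (cube (trace x)) (trace x) x)
      (x≈y⇒x-y≈0 (trans (tr-telescope (2 ℕ.* suc e) x) (cong (λ u → trace x + u) (frob-period x)))))

    -- As a polynomial the trace is monic of degree q/3, so it cannot vanish at all q elements. The
    -- exponent `e ℕ.+ suc (e ℕ.+ 0)` is the predecessor of `2 ℕ.* suc e` in the form in which it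
    -- computes.
    trace-nontrivial : ∃[ x ] ¬ trace x ≡ 0#
    trace-nontrivial = Fin.¬∀⟶∃¬ q _ (λ x → trace x Fin.≟ 0#) λ vanishes →
      ℕ.<⇒≱ (≡.subst (3 ℕ.^ (e ℕ.+ suc (e ℕ.+ 0)) ℕ.<_) (sym q≡3^2e) (ℕ.^-monoʳ-< 3 (ℕ.s≤s (ℕ.s≤s ℕ.z≤n)) (ℕ.n<1+n (e ℕ.+ suc (e ℕ.+ 0)))))
        (≡.subst (ℕ._≤ 3 ℕ.^ (e ℕ.+ suc (e ℕ.+ 0))) (length-tabulate (λ i → i))
          (roots-bound (tr-Monic (e ℕ.+ suc (e ℕ.+ 0))) (allFin q) (allFin⁺ q) (All.universal vanishes (allFin q))))

  data Prime₃ : K → Set where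
    is0  : Prime₃ 0#
    is1  : Prime₃ 1#
    is-1 : Prime₃ (- 1#)

  prime₃ : ∀ {x} → cube x ≡ x → Prime₃ x
  prime₃ {x} x³≡x with zero-product {x} {(x - 1#) * (x + 1#)} (trans (solve 1 (λ x → x :* ((x :- con 1₃) :* (x :+ con 1₃)) := x :* x :* x :- x) refl x) (x≈y⇒x-y≈0 x³≡x))
  ... | inj₁ refl = is0
  ... | inj₂ p with zero-product p
  ...   | inj₁ p′ with x-y≈0⇒x≈y p′
  ...     | refl = is1
  prime₃ {x} x³≡x | inj₂ p | inj₂ p′ with x-y≈0⇒x≈y {x} { - 1# } (trans (solve 1 (λ x → x :- (:- con 1₃) := x :+ con 1₃) refl x) p′)
  ...     | refl = is-1

  1≢0 : ¬ 1# ≡ 0#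
  1≢0 eq = 0≉1 (sym eq)

  -1≢0 : ¬ - 1# ≡ 0#
  -1≢0 = -‿≉0 1≢0

  -1≢1 : ¬ - 1# ≡ 1#
  -1≢1 eq = 1≢0 (trans (solve 0 (con 1₃ := (:- con 1₃) :- con 1₃) refl) (x≈y⇒x-y≈0 eq))

  -- The last branch is meant for -1 but also catches everything outside the prime field; this is
  -- why `exp₃-+` asks for `Prime₃`.
  exp₃ : K → ℤ[ζ]
  exp₃ x with x Fin.≟ 0# | x Fin.≟ 1#
  ... | yes _ | _     = 𝟙
  ... | no  _ | yes _ = ζ
  ... | no  _ | no  _ = ζ²

  exp₃-0 : exp₃ 0# ≡ 𝟙
  exp₃-0 with 0# Fin.≟ 0#
  ... | yes _ = refl
  ... | no  p = ⊥-elim (p refl)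

  exp₃-1 : exp₃ 1# ≡ ζ
  exp₃-1 with 1# Fin.≟ 0# | 1# Fin.≟ 1#
  ... | yes p | _     = ⊥-elim (1≢0 p)
  ... | no  _ | yes _ = refl
  ... | no  _ | no  p = ⊥-elim (p refl)

  exp₃--1 : exp₃ (- 1#) ≡ ζ²
  exp₃--1 with (- 1#) Fin.≟ 0# | (- 1#) Fin.≟ 1#
  ... | yes p | _     = ⊥-elim (-1≢0 p)
  ... | no  _ | yes p = ⊥-elim (-1≢1 p)
  ... | no  _ | no  _ = refl

  exp₃-+ : ∀ {x y} → Prime₃ x → Prime₃ y → exp₃ (x + y) ≡ exp₃ x ⊗ exp₃ y
  exp₃-+ {y = y} is0 _ = trans (cong exp₃ (+-identityˡ y)) (sym (trans (cong (_⊗ exp₃ y) exp₃-0) (⊗-identityˡ (exp₃ y))))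
  exp₃-+ {x = x} is1 is0 = trans (cong exp₃ (+-identityʳ x)) (sym (trans (cong (exp₃ x ⊗_) exp₃-0) (⊗-identityʳ (exp₃ x))))
  exp₃-+ {x = x} is-1 is0 = trans (cong exp₃ (+-identityʳ x)) (sym (trans (cong (exp₃ x ⊗_) exp₃-0) (⊗-identityʳ (exp₃ x))))
  exp₃-+ is1 is1 = trans (trans (cong exp₃ (solve 0 (con 1₃ :+ con 1₃ := :- con 1₃) refl)) exp₃--1) (sym (cong₂ _⊗_ exp₃-1 exp₃-1))
  exp₃-+ is1 is-1 = trans (trans (cong exp₃ (-‿inverseʳ 1#)) exp₃-0) (sym (cong₂ _⊗_ exp₃-1 exp₃--1))
  exp₃-+ is-1 is1 = trans (trans (cong exp₃ (-‿inverseˡ 1#)) exp₃-0) (sym (cong₂ _⊗_ exp₃--1 exp₃-1))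
  exp₃-+ is-1 is-1 = trans (trans (cong exp₃ (solve 0 ((:- con 1₃) :+ (:- con 1₃) := con 1₃) refl)) exp₃-1) (sym (cong₂ _⊗_ exp₃--1 exp₃--1))

  data CubeRoot : ℤ[ζ] → Set where
    is𝟙  : CubeRoot 𝟙
    isζ  : CubeRoot ζ
    isζ² : CubeRoot ζ²

  exp₃-root : ∀ x → CubeRoot (exp₃ x)
  exp₃-root x with x Fin.≟ 0# | x Fin.≟ 1#
  ... | yes _ | _     = is𝟙
  ... | no  _ | yes _ = isζ
  ... | no  _ | no  _ = isζ²

  exp₃≡𝟙 : ∀ x → exp₃ x ≡ 𝟙 → x ≡ 0#
  exp₃≡𝟙 x eq with x Fin.≟ 0# | x Fin.≟ 1#
  exp₃≡𝟙 x eq | yes p | _     = p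
  exp₃≡𝟙 x () | no  _ | yes _
  exp₃≡𝟙 x () | no  _ | no  _

  opaque
    ψ : K → ℤ[ζ]
    ψ x = exp₃ (trace x)

    ψ-+ : ∀ x y → ψ (x + y) ≡ ψ x ⊗ ψ y
    ψ-+ x y = trans (cong exp₃ (trace-+ x y)) (exp₃-+ (prime₃ (cube-trace x)) (prime₃ (cube-trace y)))

    -- The trace lies in the prime field, so cubing does not change it. Everything special to
    -- characteristic 3 rests on this: it makes ψ((vs)³) linear in s, and it makes the quartic Gauss
    -- sum real.
    ψ-cube : ∀ x → ψ (cube x) ≡ ψ x
    ψ-cube x = cong exp₃ (trans (trace-cube x) (cube-trace x))

    ψ-root : ∀ x → CubeRoot (ψ x)
    ψ-root x = exp₃-root (trace x)

    ψ-nontrivial : ∃[ x ] ¬ ψ x ≡ 𝟙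
    ψ-nontrivial = proj₁ trace-nontrivial , λ eq → proj₂ trace-nontrivial (exp₃≡𝟙 _ eq)

  ψ-0 : ψ 0# ≡ 𝟙
  ψ-0 with ψ 0# | ψ-root 0# | trans (cong ψ (sym (+-identityˡ 0#))) (ψ-+ 0# 0#)
  ... | _ | is𝟙  | _  = refl
  ... | _ | isζ  | ()
  ... | _ | isζ² | ()

  conj-ψ : ∀ x → conj (ψ x) ≡ ψ (- x)
  conj-ψ x with ψ x | ψ-root x | ψ (- x) | ψ-root (- x) | trans (sym (ψ-+ x (- x))) (trans (cong ψ (-‿inverseʳ x)) ψ-0)
  ... | _ | is𝟙  | _ | is𝟙  | _ = refl
  ... | _ | isζ  | _ | isζ² | _ = refl
  ... | _ | isζ² | _ | isζ  | _ = refl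
  ... | _ | is𝟙  | _ | isζ  | ()
  ... | _ | is𝟙  | _ | isζ² | ()
  ... | _ | isζ  | _ | is𝟙  | ()
  ... | _ | isζ  | _ | isζ  | ()
  ... | _ | isζ² | _ | is𝟙  | ()
  ... | _ | isζ² | _ | isζ² | ()

  -- Averaging over the powers of u: 3s = (1 + u + u²)s, and the bracket vanishes for a nontrivial
  -- cube root of unity. Only the integer 3 has to be cancelled in ℤ[ζ].
  fixed⇒𝟘 : ∀ {u s} → CubeRoot u → ¬ u ≡ 𝟙 → u ⊗ s ≡ s → s ≡ 𝟘
  fixed⇒𝟘 {u} {s} root u≢𝟙 us≡s = ι-cancel (+ 3) (λ ()) (begin
    ι (+ 3) ⊗ s  ≡⟨ solveᶻ 1 (λ s → conᶻ (ι (+ 3)) :⊗ s :≡ s :⊕ s :⊕ s) refl s ⟩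
    s ⊕ s ⊕ s  ≡⟨ cong₂ (λ a b → s ⊕ a ⊕ b) (sym us≡s) (sym (trans (cong (u ⊗_) us≡s) us≡s)) ⟩
    s ⊕ u ⊗ s ⊕ u ⊗ (u ⊗ s)  ≡⟨ solveᶻ 2 (λ u s → s :⊕ u :⊗ s :⊕ u :⊗ (u :⊗ s) :≡ (conᶻ 𝟙 :⊕ u :⊕ u :⊗ u) :⊗ s) refl u s ⟩
    (𝟙 ⊕ u ⊕ u ⊗ u) ⊗ s  ≡⟨ cong (_⊗ s) (vanish root u≢𝟙) ⟩
    𝟘 ⊗ s  ≡⟨ solveᶻ 1 (λ s → conᶻ 𝟘 :⊗ s :≡ conᶻ (ι (+ 3)) :⊗ conᶻ 𝟘) refl s ⟩
    ι (+ 3) ⊗ 𝟘  ∎)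
    where
    open ℤ[ζ]-Solver
    vanish : ∀ {u} → CubeRoot u → ¬ u ≡ 𝟙 → 𝟙 ⊕ u ⊕ u ⊗ u ≡ 𝟘
    vanish is𝟙  u≢𝟙 = ⊥-elim (u≢𝟙 refl)
    vanish isζ  _   = refl
    vanish isζ² _   = refl

  ∑ : (K → ℤ[ζ]) → ℤ[ζ]
  ∑ f = sum {q} f

  ∑-shift : ∀ (f : K → ℤ[ζ]) a → ∑ f ≡ ∑ (λ x → f (x + a))
  ∑-shift f a = ∑-reindex f (_+ a) (_- a) (λ x → solve 2 (λ x a → (x :- a) :+ a := x) refl x a) (λ x → solve 2 (λ x a → (x :+ a) :- a := x) refl x a)

  ∑-negate : ∀ (f : K → ℤ[ζ]) → ∑ f ≡ ∑ (λ x → f (- x))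
  ∑-negate f = ∑-reindex f -_ -_ neg-neg neg-neg
    where
    neg-neg : ∀ x → - (- x) ≡ x
    neg-neg = solve 1 (λ x → :- (:- x) := x) refl

  ∑-scale : ∀ (f : K → ℤ[ζ]) {a} → ¬ a ≡ 0# → ∑ f ≡ ∑ (λ x → f (x * a))
  ∑-scale f {a} a≢0 = ∑-reindex f (_* a) (_* a ⁻¹)
    (λ x → trans (*-assoc x (a ⁻¹) a) (trans (cong (x *_) (inverseˡ a≢0)) (*-identityʳ x)))
    (λ x → trans (*-assoc x a (a ⁻¹)) (trans (cong (x *_) (inverseʳ a≢0)) (*-identityʳ x)))

  ∑ψ≡𝟘 : ∑ ψ ≡ 𝟘
  ∑ψ≡𝟘 with ψ-nontrivial
  ... | a , ψa≢𝟙 = fixed⇒𝟘 (ψ-root a) ψa≢𝟙 (begin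
    ψ a ⊗ ∑ ψ  ≡⟨ *-distribˡ-sum (ψ a) ψ ⟩
    ∑ (λ x → ψ a ⊗ ψ x)  ≡⟨ sum-cong-≗ (λ x → trans (⊗-comm (ψ a) (ψ x)) (sym (ψ-+ x a))) ⟩
    ∑ (λ x → ψ (x + a))  ≡⟨ ∑-shift ψ a ⟨
    ∑ ψ  ∎)

  orthogonality : ∀ a → ∑ (λ x → ψ (x * a)) ≡ ι (+ q) ⊗ δ a 0#
  orthogonality a with a Fin.≟ 0#
  ... | yes refl = begin
    ∑ (λ x → ψ (x * 0#))  ≡⟨ sum-cong-≗ (λ x → trans (cong ψ (*-zeroʳ x)) ψ-0) ⟩
    ∑ (λ _ → 𝟙)  ≡⟨ ∑-𝟙 {q} ⟩
    ι (+ q)  ≡⟨ ⊗-identityʳ _ ⟨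
    ι (+ q) ⊗ 𝟙  ≡⟨ cong (ι (+ q) ⊗_) (δ-refl 0#) ⟨
    ι (+ q) ⊗ δ 0# 0#  ∎
  ... | no a≢0 = trans (sym (∑-scale ψ a≢0)) (trans ∑ψ≡𝟘 (sym (trans (cong (ι (+ q) ⊗_) (δ-≢ a≢0)) (zeroʳ (ι (+ q))))))

  -- The quartic character χ = α + iβ with χ(w) = i

  w≢0 : ¬ w ≡ 0#
  w≢0 w≡0 with 8 ℕ.* h | proj₁ w-order | w^8h≡1
  ... | suc n | _ | w^≡1 = 1≢0 (trans (sym w^≡1) (trans (cong (_^ suc n) w≡0) (0^ n)))

  exponent-4∣ : ∀ {n} → w ^ n ≡ 1# → ∃[ m ] n ≡ m ℕ.* 4
  exponent-4∣ w^n≡1 with order-∣ w-order w^n≡1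
  ... | divides j n≡ = j ℕ.* (2 ℕ.* h) , trans n≡ (rearrange j h)
    where
    rearrange : ∀ j h → j ℕ.* (8 ℕ.* h) ≡ j ℕ.* (2 ℕ.* h) ℕ.* 4
    rearrange = ℕ-solve-∀

  -- `α` and `β` are evaluated at whichever logarithm `generates` returns; the order 8h of w is a
  -- multiple of 4, so the value does not depend on it.
  same-power : ∀ {k l} → w ^ k ≡ w ^ l → cos k ≡ cos l × sin k ≡ sin l
  same-power {k} {l} eq = trans (sym (periodic cos cos-period l+l′≡)) (periodic′ cos cos-period)
                        , trans (sym (periodic sin sin-period l+l′≡)) (periodic′ sin sin-period)
    where
    m : ℕ
    m = 8 ℕ.* h
    -- `w ^ l′` is the inverse of `w ^ l`, which avoids subtracting exponents whose order is
    -- unknown.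
    l′ : ℕ
    l′ = (m ℕ.∸ 1) ℕ.* l
    m≡ : suc (m ℕ.∸ 1) ≡ m
    m≡ = ℕ.m+[n∸m]≡n (proj₁ w-order)
    l+l′≡ : ∃[ j ] l ℕ.+ l′ ≡ j ℕ.* 4
    l+l′≡ = 2 ℕ.* h ℕ.* l , trans (cong (ℕ._* l) m≡) (rearrange h l)
      where
      rearrange : ∀ h l → 8 ℕ.* h ℕ.* l ≡ 2 ℕ.* h ℕ.* l ℕ.* 4
      rearrange = ℕ-solve-∀
    w^l+l′ : w ^ (l ℕ.+ l′) ≡ 1#
    w^l+l′ = trans (cong (λ n → w ^ (n ℕ.* l)) m≡) (trans (^-* w m l) (trans (^-cong l w^8h≡1) (1^ l)))
    k+l′≡ : ∃[ j ] k ℕ.+ l′ ≡ j ℕ.* 4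
    k+l′≡ = exponent-4∣ (trans (^-+ w k l′) (trans (cong (_* w ^ l′) eq) (trans (sym (^-+ w l l′)) w^l+l′)))
    periodic : (f : ℕ → ℤ[ζ]) → (∀ m k → f (m ℕ.* 4 ℕ.+ k) ≡ f k) → (∃[ j ] l ℕ.+ l′ ≡ j ℕ.* 4) → f (l ℕ.+ l′ ℕ.+ k) ≡ f k
    periodic f period (j , eq) = trans (cong (λ n → f (n ℕ.+ k)) eq) (period j k)
    periodic′ : (f : ℕ → ℤ[ζ]) → (∀ m k → f (m ℕ.* 4 ℕ.+ k) ≡ f k) → f (l ℕ.+ l′ ℕ.+ k) ≡ f l
    periodic′ f period = trans (cong f (trans (rearrange l l′ k) (cong (ℕ._+ l) (proj₂ k+l′≡)))) (period (proj₁ k+l′≡) l)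
      where
      rearrange : ∀ l l′ k → l ℕ.+ l′ ℕ.+ k ≡ k ℕ.+ l′ ℕ.+ l
      rearrange = ℕ-solve-∀

  opaque
    character : (ℕ → ℤ[ζ]) → K → ℤ[ζ]
    character f x with x Fin.≟ 0#
    ... | yes _   = 𝟘
    ... | no  x≢0 = f (proj₁ (generates x x≢0))

    character-0 : ∀ f → character f 0# ≡ 𝟘
    character-0 f with 0# Fin.≟ 0#
    ... | yes _ = refl
    ... | no  p = ⊥-elim (p refl)

    character-w : ∀ f k → (∀ l → w ^ l ≡ w ^ k → f l ≡ f k) → character f (w ^ k) ≡ f k
    character-w f k respects with (w ^ k) Fin.≟ 0#
    ... | yes p = ⊥-elim (^-≉0 k w≢0 p)
    ... | no  p = respects _ (sym (proj₂ (generates (w ^ k) p)))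

  α β : K → ℤ[ζ]
  α = character cos
  β = character sin

  α-0 : α 0# ≡ 𝟘
  α-0 = character-0 cos

  β-0 : β 0# ≡ 𝟘
  β-0 = character-0 sin

  α-w : ∀ k → α (w ^ k) ≡ cos k
  α-w k = character-w cos k (λ l eq → proj₁ (same-power {l} {k} eq))

  β-w : ∀ k → β (w ^ k) ≡ sin k
  β-w k = character-w sin k (λ l eq → proj₂ (same-power {l} {k} eq))

  unit-value : ∀ x → ¬ x ≡ 0# → Quartic (α x) (β x)
  unit-value = nonzero-elim (λ k → ≡.subst₂ Quartic (sym (α-w k)) (sym (β-w k)) (cos-sin-quartic k))

  value : ∀ x → Quartic₀ (α x) (β x)
  value x with x Fin.≟ 0#
  ... | yes refl = ≡.subst₂ Quartic₀ (sym α-0) (sym β-0) at-0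
  ... | no  x≢0  = unit (unit-value x x≢0)

  χ-* : ∀ x y → α (x * y) ≡ α x ⊗ α y ⊕ ⊖ (β x ⊗ β y) × β (x * y) ≡ α x ⊗ β y ⊕ β x ⊗ α y
  χ-* x y with x Fin.≟ 0# | y Fin.≟ 0#
  ... | yes refl | _ = (begin
      α (0# * y)  ≡⟨ trans (cong α (*-zeroˡ y)) α-0 ⟩
      𝟘  ≡⟨ solveᶻ 2 (λ a b → conᶻ 𝟘 :≡ conᶻ 𝟘 :⊗ a :⊕ :⊖ (conᶻ 𝟘 :⊗ b)) refl (α y) (β y) ⟩
      𝟘 ⊗ α y ⊕ ⊖ (𝟘 ⊗ β y)  ≡⟨ cong₂ (λ a b → a ⊗ α y ⊕ ⊖ (b ⊗ β y)) α-0 β-0 ⟨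
      α 0# ⊗ α y ⊕ ⊖ (β 0# ⊗ β y)  ∎) , (begin
      β (0# * y)  ≡⟨ trans (cong β (*-zeroˡ y)) β-0 ⟩
      𝟘  ≡⟨ solveᶻ 2 (λ a b → conᶻ 𝟘 :≡ conᶻ 𝟘 :⊗ b :⊕ conᶻ 𝟘 :⊗ a) refl (α y) (β y) ⟩
      𝟘 ⊗ β y ⊕ 𝟘 ⊗ α y  ≡⟨ cong₂ (λ a b → a ⊗ β y ⊕ b ⊗ α y) α-0 β-0 ⟨
      α 0# ⊗ β y ⊕ β 0# ⊗ α y  ∎)
    where open ℤ[ζ]-Solver
  ... | no _ | yes refl = (begin
      α (x * 0#)  ≡⟨ trans (cong α (*-zeroʳ x)) α-0 ⟩
      𝟘  ≡⟨ solveᶻ 2 (λ a b → conᶻ 𝟘 :≡ a :⊗ conᶻ 𝟘 :⊕ :⊖ (b :⊗ conᶻ 𝟘)) refl (α x) (β x) ⟩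
      α x ⊗ 𝟘 ⊕ ⊖ (β x ⊗ 𝟘)  ≡⟨ cong₂ (λ a b → α x ⊗ a ⊕ ⊖ (β x ⊗ b)) α-0 β-0 ⟨
      α x ⊗ α 0# ⊕ ⊖ (β x ⊗ β 0#)  ∎) , (begin
      β (x * 0#)  ≡⟨ trans (cong β (*-zeroʳ x)) β-0 ⟩
      𝟘  ≡⟨ solveᶻ 2 (λ a b → conᶻ 𝟘 :≡ a :⊗ conᶻ 𝟘 :⊕ b :⊗ conᶻ 𝟘) refl (α x) (β x) ⟩
      α x ⊗ 𝟘 ⊕ β x ⊗ 𝟘  ≡⟨ cong₂ (λ a b → α x ⊗ b ⊕ β x ⊗ a) α-0 β-0 ⟨
      α x ⊗ β 0# ⊕ β x ⊗ α 0#  ∎)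
    where open ℤ[ζ]-Solver
  ... | no x≢0 | no y≢0 with generates x x≢0 | generates y y≢0
  ...   | k , refl | l , refl = (begin
      α (w ^ k * w ^ l)  ≡⟨ cong α (^-+ w k l) ⟨
      α (w ^ (k ℕ.+ l))  ≡⟨ α-w (k ℕ.+ l) ⟩
      cos (k ℕ.+ l)  ≡⟨ cos-+ k l ⟩
      cos k ⊗ cos l ⊕ ⊖ (sin k ⊗ sin l)  ≡⟨ cong₂ (λ a b → a ⊕ ⊖ b) (cong₂ _⊗_ (α-w k) (α-w l)) (cong₂ _⊗_ (β-w k) (β-w l)) ⟨
      α (w ^ k) ⊗ α (w ^ l) ⊕ ⊖ (β (w ^ k) ⊗ β (w ^ l))  ∎) , (begin
      β (w ^ k * w ^ l)  ≡⟨ cong β (^-+ w k l) ⟨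
      β (w ^ (k ℕ.+ l))  ≡⟨ β-w (k ℕ.+ l) ⟩
      sin (k ℕ.+ l)  ≡⟨ sin-+ k l ⟩
      cos k ⊗ sin l ⊕ sin k ⊗ cos l  ≡⟨ cong₂ _⊕_ (cong₂ _⊗_ (α-w k) (β-w l)) (cong₂ _⊗_ (β-w k) (α-w l)) ⟨
      α (w ^ k) ⊗ β (w ^ l) ⊕ β (w ^ k) ⊗ α (w ^ l)  ∎)

  α-* : ∀ x y → α (x * y) ≡ α x ⊗ α y ⊕ ⊖ (β x ⊗ β y)
  α-* x y = proj₁ (χ-* x y)

  β-* : ∀ x y → β (x * y) ≡ α x ⊗ β y ⊕ β x ⊗ α y
  β-* x y = proj₂ (χ-* x y)

  α-1 : α 1# ≡ 𝟙
  α-1 = α-w 0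

  β-1 : β 1# ≡ 𝟘
  β-1 = β-w 0

  w^4h²≡1 : w ^ (h ℕ.* 4) * w ^ (h ℕ.* 4) ≡ 1# * 1#
  w^4h²≡1 = begin
    w ^ (h ℕ.* 4) * w ^ (h ℕ.* 4)  ≡⟨ ^-+ w (h ℕ.* 4) (h ℕ.* 4) ⟨
    w ^ (h ℕ.* 4 ℕ.+ h ℕ.* 4)  ≡⟨ cong (w ^_) (4h+4h h) ⟩
    w ^ (8 ℕ.* h)  ≡⟨ w^8h≡1 ⟩
    1#  ≡⟨ *-identityˡ 1# ⟨
    1# * 1#  ∎

  w^4h≢1 : ¬ w ^ (h ℕ.* 4) ≡ 1#
  w^4h≢1 = proj₂ (proj₂ w-order) (h ℕ.* 4) 0<4h (≡.subst (h ℕ.* 4 ℕ.<_) (4h+4h h) (ℕ.m<m+n (h ℕ.* 4) 0<4h))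
    where
    positive : ∀ h → 0 ℕ.< 8 ℕ.* h → 0 ℕ.< h ℕ.* 4
    positive (suc h) _ = ℕ.s≤s ℕ.z≤n
    0<4h : 0 ℕ.< h ℕ.* 4
    0<4h = positive h (proj₁ w-order)

  -- Here q ≡ 1 mod 8 enters: -1 is a fourth power, so χ, η and κ are even functions.
  -1≡w^4h : - 1# ≡ w ^ (h ℕ.* 4)
  -1≡w^4h = sym ([ (λ eq → ⊥-elim (w^4h≢1 eq)) , (λ eq → eq) ]′ (square-roots w^4h²≡1))

  α--1 : α (- 1#) ≡ 𝟙
  α--1 = trans (cong α -1≡w^4h) (trans (α-w (h ℕ.* 4)) (trans (cong cos (sym (ℕ.+-identityʳ (h ℕ.* 4)))) (cos-period h 0)))

  β--1 : β (- 1#) ≡ 𝟘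
  β--1 = trans (cong β -1≡w^4h) (trans (β-w (h ℕ.* 4)) (trans (cong sin (sym (ℕ.+-identityʳ (h ℕ.* 4)))) (sin-period h 0)))

  private
    neg-as-* : ∀ x → - x ≡ - 1# * x
    neg-as-* = solve 1 (λ x → :- x := (:- con 1₃) :* x) refl

  α-neg : ∀ x → α (- x) ≡ α x
  α-neg x = trans (cong α (neg-as-* x)) (trans (α-* (- 1#) x) (trans (cong₂ (λ a b → a ⊗ α x ⊕ ⊖ (b ⊗ β x)) α--1 β--1)
    (solveᶻ 2 (λ a b → conᶻ 𝟙 :⊗ a :⊕ :⊖ (conᶻ 𝟘 :⊗ b) :≡ a) refl (α x) (β x))))
    where open ℤ[ζ]-Solver

  β-neg : ∀ x → β (- x) ≡ β x
  β-neg x = trans (cong β (neg-as-* x)) (trans (β-* (- 1#) x) (trans (cong₂ (λ a b → a ⊗ β x ⊕ b ⊗ α x) α--1 β--1)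
    (solveᶻ 2 (λ a b → conᶻ 𝟙 :⊗ b :⊕ conᶻ 𝟘 :⊗ a :≡ b) refl (α x) (β x))))
    where open ℤ[ζ]-Solver

  α-square : ∀ x → α (x * x) ≡ α x ⊗ α x ⊕ ⊖ (β x ⊗ β x)
  α-square x = α-* x x

  β-square : ∀ x → β (x * x) ≡ 𝟘
  β-square x = trans (β-* x x) (double-value (value x))

  α-cube : ∀ x → α (cube x) ≡ α x
  α-cube x = trans (α-* (x * x) x) (trans (cong₂ (λ a b → a ⊗ α x ⊕ ⊖ (b ⊗ β x)) (α-square x) (β-square x)) (cube-re (value x)))

  β-cube : ∀ x → β (cube x) ≡ ⊖ β x
  β-cube x = trans (β-* (x * x) x) (trans (cong₂ (λ a b → a ⊗ β x ⊕ b ⊗ α x) (α-square x) (β-square x)) (cube-im (value x)))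

  χ-⁻¹ : ∀ x → α (x ⁻¹) ≡ α x × β (x ⁻¹) ≡ ⊖ β x
  χ-⁻¹ x = cases (x Fin.≟ 0#)
    where
    cases : Dec (x ≡ 0#) → α (x ⁻¹) ≡ α x × β (x ⁻¹) ≡ ⊖ β x
    cases (yes refl) = cong α 0⁻¹≈0 , trans (cong β 0⁻¹≈0) (trans β-0 (cong ⊖_ (sym β-0)))
    cases (no  x≢0)  = inverse-value (unit-value x x≢0) (unit-value (x ⁻¹) (⁻¹-≉0 x≢0)) (trans (sym (α-* x (x ⁻¹))) (trans (cong α (inverseʳ x≢0)) α-1))

  -- `η` = χ² is the quadratic character. `κ` = Re χ + Im χ is 1 where χ is 1 or i, and -1 where χ
  -- is -1 or -i; `κ′` is the same expression for the conjugate of χ.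
  η κ κ′ : K → ℤ[ζ]
  η x  = α x ⊗ α x ⊕ ⊖ (β x ⊗ β x)
  κ x  = α x ⊕ β x
  κ′ x = α x ⊕ ⊖ β x

  η-0 : η 0# ≡ 𝟘
  η-0 = cong₂ (λ a b → a ⊗ a ⊕ ⊖ (b ⊗ b)) α-0 β-0

  η-1 : η 1# ≡ 𝟙
  η-1 = cong₂ (λ a b → a ⊗ a ⊕ ⊖ (b ⊗ b)) α-1 β-1

  η-neg : ∀ x → η (- x) ≡ η x
  η-neg x = cong₂ (λ a b → a ⊗ a ⊕ ⊖ (b ⊗ b)) (α-neg x) (β-neg x)

  η-⁻¹ : ∀ x → η (x ⁻¹) ≡ η x
  η-⁻¹ x = trans (cong₂ (λ a b → a ⊗ a ⊕ ⊖ (b ⊗ b)) (proj₁ (χ-⁻¹ x)) (proj₂ (χ-⁻¹ x))) (solveᶻ 2 (λ a b → a :⊗ a :⊕ :⊖ ((:⊖ b) :⊗ (:⊖ b)) :≡ a :⊗ a :⊕ :⊖ (b :⊗ b)) refl (α x) (β x))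
    where open ℤ[ζ]-Solver

  κ-neg : ∀ x → κ (- x) ≡ κ x
  κ-neg x = cong₂ _⊕_ (α-neg x) (β-neg x)

  κ-cube : ∀ x → κ (cube x) ≡ κ′ x
  κ-cube x = cong₂ _⊕_ (α-cube x) (β-cube x)

  κ-⁻¹ : ∀ x → κ (x ⁻¹) ≡ κ′ x
  κ-⁻¹ x = cong₂ _⊕_ (proj₁ (χ-⁻¹ x)) (proj₂ (χ-⁻¹ x))

  η-sign : ∀ x → ¬ x ≡ 0# → Sign (η x)
  η-sign x x≢0 = norm-sign (unit-value x x≢0)

  κ-sign : ∀ x → ¬ x ≡ 0# → Sign (κ x)
  κ-sign x x≢0 = sum-sign (unit-value x x≢0)

  αη≡α : ∀ x → α x ⊗ η x ≡ α x
  αη≡α x = re-norm (value x)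

  κ′η≡κ : ∀ x → κ′ x ⊗ η x ≡ κ x
  κ′η≡κ x = difference-norm (value x)

  η-* : ∀ x y → η (x * y) ≡ η x ⊗ η y
  η-* x y = begin
    η (x * y)  ≡⟨ cong₂ (λ a b → a ⊗ a ⊕ ⊖ (b ⊗ b)) (α-* x y) (β-* x y) ⟩
    _  ≡⟨ solveᶻ 4 (λ a b c d → (a :⊗ c :⊕ :⊖ (b :⊗ d)) :⊗ (a :⊗ c :⊕ :⊖ (b :⊗ d)) :⊕ :⊖ ((a :⊗ d :⊕ b :⊗ c) :⊗ (a :⊗ d :⊕ b :⊗ c))
                                                        :≡ (a :⊗ a :⊕ :⊖ (b :⊗ b)) :⊗ (c :⊗ c :⊕ :⊖ (d :⊗ d)) :⊕ :⊖ ((a :⊗ b :⊕ a :⊗ b) :⊗ (c :⊗ d :⊕ c :⊗ d))) refl (α x) (β x) (α y) (β y) ⟩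
    η x ⊗ η y ⊕ ⊖ ((α x ⊗ β x ⊕ α x ⊗ β x) ⊗ (α y ⊗ β y ⊕ α y ⊗ β y))  ≡⟨ cong (λ u → η x ⊗ η y ⊕ ⊖ (u ⊗ (α y ⊗ β y ⊕ α y ⊗ β y))) (trans (cong (α x ⊗ β x ⊕_) (⊗-comm (α x) (β x))) (trans (sym (β-* x x)) (β-square x))) ⟩
    η x ⊗ η y ⊕ ⊖ (𝟘 ⊗ (α y ⊗ β y ⊕ α y ⊗ β y))  ≡⟨ solveᶻ 2 (λ a b → a :⊕ :⊖ (conᶻ 𝟘 :⊗ b) :≡ a) refl (η x ⊗ η y) (α y ⊗ β y ⊕ α y ⊗ β y) ⟩
    η x ⊗ η y  ∎
    where open ℤ[ζ]-Solver

  κ-/ : ∀ x y → κ (x * y ⁻¹) ≡ α x ⊗ κ′ y ⊕ β x ⊗ κ y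
  κ-/ x y = trans (cong₂ _⊕_ (α-* x (y ⁻¹)) (β-* x (y ⁻¹))) (trans (cong₂ (λ c d → (α x ⊗ c ⊕ ⊖ (β x ⊗ d)) ⊕ (α x ⊗ d ⊕ β x ⊗ c)) (proj₁ (χ-⁻¹ y)) (proj₂ (χ-⁻¹ y)))
    (solveᶻ 4 (λ a b c d → (a :⊗ c :⊕ :⊖ (b :⊗ (:⊖ d))) :⊕ (a :⊗ (:⊖ d) :⊕ b :⊗ c) :≡ a :⊗ (c :⊕ :⊖ d) :⊕ b :⊗ (c :⊕ d)) refl (α x) (β x) (α y) (β y)))
    where open ℤ[ζ]-Solver

  κ′-/ : ∀ x y → κ′ (x * y ⁻¹) ≡ α x ⊗ κ y ⊕ ⊖ (β x ⊗ κ′ y)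
  κ′-/ x y = trans (cong₂ (λ a b → a ⊕ ⊖ b) (α-* x (y ⁻¹)) (β-* x (y ⁻¹))) (trans (cong₂ (λ c d → (α x ⊗ c ⊕ ⊖ (β x ⊗ d)) ⊕ ⊖ (α x ⊗ d ⊕ β x ⊗ c)) (proj₁ (χ-⁻¹ y)) (proj₂ (χ-⁻¹ y)))
    (solveᶻ 4 (λ a b c d → (a :⊗ c :⊕ :⊖ (b :⊗ (:⊖ d))) :⊕ :⊖ (a :⊗ (:⊖ d) :⊕ b :⊗ c) :≡ a :⊗ (c :⊕ d) :⊕ :⊖ (b :⊗ (c :⊕ :⊖ d))) refl (α x) (β x) (α y) (β y)))
    where open ℤ[ζ]-Solver

  -- Counting square roots

  square-root-count-0 : ∑ (λ x → δ (x * x) 0#) ≡ 𝟙 ⊕ η 0#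
  square-root-count-0 = begin
    ∑ (λ x → δ (x * x) 0#)  ≡⟨ sum-cong-≗ (λ x → trans (δ-⇔ {x = x * x} {0#} {x} {0#} square≡0 (λ { refl → *-zeroˡ 0# })) (sym (⊗-identityʳ (δ x 0#)))) ⟩
    ∑ (λ x → δ x 0# ⊗ 𝟙)  ≡⟨ ∑-δ 0# (λ _ → 𝟙) ⟩
    𝟙  ≡⟨ cong (𝟙 ⊕_) η-0 ⟨
    𝟙 ⊕ η 0#  ∎
    where
    square≡0 : ∀ {x} → x * x ≡ 0# → x ≡ 0#
    square≡0 p with zero-product p
    ... | inj₁ x≡0 = x≡0
    ... | inj₂ x≡0 = x≡0

  δ-square : ∀ {r} → ¬ r ≡ 0# → ∀ x → δ (x * x) (r * r) ≡ δ x r ⊗ 𝟙 ⊕ δ x (- r) ⊗ 𝟙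
  δ-square {r} r≢0 x = cases (x Fin.≟ r) (x Fin.≟ - r)
    where
    r≢-r : ¬ r ≡ - r
    r≢-r eq = r≢0 (trans (solve 1 (λ r → r := (:- r) :- r) refl r) (x≈y⇒x-y≈0 (sym eq)))
    neg-square : - r * - r ≡ r * r
    neg-square = solve 1 (λ r → (:- r) :* (:- r) := r :* r) refl r
    values : ∀ {a b c} → δ (x * x) (r * r) ≡ c → δ x r ≡ a → δ x (- r) ≡ b → c ≡ a ⊗ 𝟙 ⊕ b ⊗ 𝟙 → δ (x * x) (r * r) ≡ δ x r ⊗ 𝟙 ⊕ δ x (- r) ⊗ 𝟙
    values c≡ a≡ b≡ eq = trans c≡ (trans eq (sym (cong₂ (λ a b → a ⊗ 𝟙 ⊕ b ⊗ 𝟙) a≡ b≡)))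
    cases : Dec (x ≡ r) → Dec (x ≡ - r) → δ (x * x) (r * r) ≡ δ x r ⊗ 𝟙 ⊕ δ x (- r) ⊗ 𝟙
    cases (yes p) (yes p′) = ⊥-elim (r≢-r (trans (sym p) p′))
    cases (yes p) (no  p′) = values (trans (cong (λ y → δ (y * y) (r * r)) p) (δ-refl (r * r))) (trans (cong (λ y → δ y r) p) (δ-refl r)) (δ-≢ p′) refl
    cases (no  p) (yes p′) = values (trans (cong (λ y → δ y (r * r)) (trans (cong₂ _*_ p′ p′) neg-square)) (δ-refl (r * r))) (δ-≢ p) (trans (cong (λ y → δ y (- r)) p′) (δ-refl (- r))) refl
    cases (no  p) (no  p′) = values (δ-≢ λ eq → no-root (square-roots eq)) (δ-≢ p) (δ-≢ p′) refl
      where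
      no-root : ¬ (x ≡ r ⊎ x ≡ - r)
      no-root (inj₁ eq) = p eq
      no-root (inj₂ eq) = p′ eq

  square-root-count-square : ∀ {r} → ¬ r ≡ 0# → ∑ (λ x → δ (x * x) (r * r)) ≡ 𝟙 ⊕ η (r * r)
  square-root-count-square {r} r≢0 = begin
    ∑ (λ x → δ (x * x) (r * r))  ≡⟨ sum-cong-≗ (δ-square r≢0) ⟩
    ∑ (λ x → δ x r ⊗ 𝟙 ⊕ δ x (- r) ⊗ 𝟙)  ≡⟨ ∑-distrib-+ (λ x → δ x r ⊗ 𝟙) (λ x → δ x (- r) ⊗ 𝟙) ⟩
    ∑ (λ x → δ x r ⊗ 𝟙) ⊕ ∑ (λ x → δ x (- r) ⊗ 𝟙)  ≡⟨ cong₂ _⊕_ (∑-δ r (λ _ → 𝟙)) (∑-δ (- r) (λ _ → 𝟙)) ⟩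
    𝟙 ⊕ 𝟙  ≡⟨ cong (𝟙 ⊕_) (trans (η-* r r) (Sign-square (η-sign r r≢0))) ⟨
    𝟙 ⊕ η (r * r)  ∎

  square-root-count-nonsquare : ∀ {u} → ¬ u ≡ 0# → η u ≡ ⊖ 𝟙 → ∑ (λ x → δ (x * x) u) ≡ 𝟙 ⊕ η u
  square-root-count-nonsquare {u} u≢0 η-u = begin
    ∑ (λ x → δ (x * x) u)  ≡⟨ sum-cong-≗ (λ x → δ-≢ (no-root x)) ⟩
    ∑ (λ _ → 𝟘)  ≡⟨ ∑-𝟘 {q} ⟩
    𝟙 ⊕ ⊖ 𝟙  ≡⟨ cong (𝟙 ⊕_) η-u ⟨
    𝟙 ⊕ η u  ∎
    where
    𝟙≢⊖𝟙 : ¬ ⊖ 𝟙 ≡ 𝟙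
    𝟙≢⊖𝟙 ()
    no-root : ∀ x → ¬ x * x ≡ u
    no-root x eq = 𝟙≢⊖𝟙 (trans (sym η-u) (trans (cong η (sym eq)) (trans (η-* x x) (Sign-square (η-sign x λ { refl → u≢0 (trans (sym eq) (*-zeroˡ 0#)) })))))

  η-odd-power : ∀ j → η (w ^ suc (j ℕ.+ j)) ≡ ⊖ 𝟙
  η-odd-power j = begin
    η (w ^ suc (j ℕ.+ j))  ≡⟨ cong (λ x → η (w * x)) (^-+ w j j) ⟩
    η (w * (w ^ j * w ^ j))  ≡⟨ trans (η-* w (w ^ j * w ^ j)) (cong (η w ⊗_) (η-* (w ^ j) (w ^ j))) ⟩
    η w ⊗ (η (w ^ j) ⊗ η (w ^ j))  ≡⟨ cong₂ _⊗_ (trans (cong η (sym (*-identityʳ w))) (cong₂ (λ a b → a ⊗ a ⊕ ⊖ (b ⊗ b)) (α-w 1) (β-w 1))) (Sign-square (η-sign (w ^ j) (^-≉0 j w≢0))) ⟩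
    ⊖ 𝟙  ∎

  square-root-count : ∀ u → ∑ (λ x → δ (x * x) u) ≡ 𝟙 ⊕ η u
  square-root-count u = cases (u Fin.≟ 0#)
    where
    count : K → Set
    count u = ∑ (λ x → δ (x * x) u) ≡ 𝟙 ⊕ η u
    power : ∀ k → (∃[ j ] k ≡ j ℕ.+ j) ⊎ (∃[ j ] k ≡ suc (j ℕ.+ j)) → count (w ^ k)
    power _ (inj₁ (j , refl)) = ≡.subst count (sym (^-+ w j j)) (square-root-count-square (^-≉0 j w≢0))
    power _ (inj₂ (j , refl)) = square-root-count-nonsquare (^-≉0 (suc (j ℕ.+ j)) w≢0) (η-odd-power j)
    cases : Dec (u ≡ 0#) → count u
    cases (yes u≡0) = ≡.subst count (sym u≡0) square-root-count-0
    cases (no  u≢0) = nonzero-elim {P = count} (λ k → power k (halve k)) u u≢0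

  ∑-squares : ∀ (f : K → ℤ[ζ]) → ∑ (λ x → f (x * x)) ≡ ∑ (λ u → (𝟙 ⊕ η u) ⊗ f u)
  ∑-squares f = trans (∑-fibres (λ x → x * x) f) (sum-cong-≗ (λ u → cong (_⊗ f u) (square-root-count u)))

  -- Gauss sums

  ∑-⊖ : ∀ (f : K → ℤ[ζ]) → ∑ (λ x → ⊖ f x) ≡ ⊖ ∑ f
  ∑-⊖ f = trans (sum-cong-≗ (λ x → solveᶻ 1 (λ a → :⊖ a :≡ conᶻ (⊖ 𝟙) :⊗ a) refl (f x))) (trans (sym (*-distribˡ-sum (⊖ 𝟙) f)) (solveᶻ 1 (λ a → conᶻ (⊖ 𝟙) :⊗ a :≡ :⊖ a) refl (∑ f)))
    where open ℤ[ζ]-Solver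

  α-w₁ : α w ≡ 𝟘
  α-w₁ = trans (cong α (sym (*-identityʳ w))) (α-w 1)

  β-w₁ : β w ≡ 𝟙
  β-w₁ = trans (cong β (sym (*-identityʳ w))) (β-w 1)

  -- The substitution x ↦ xw multiplies χ by i: β becomes α, and α becomes -β. The two together give
  -- ∑α = -∑α.
  ∑β≡∑α : ∑ β ≡ ∑ α
  ∑β≡∑α = trans (∑-scale β w≢0) (sum-cong-≗ (λ x → trans (β-* x w) (trans (cong₂ (λ a b → α x ⊗ b ⊕ β x ⊗ a) α-w₁ β-w₁)
    (solveᶻ 2 (λ a b → a :⊗ conᶻ 𝟙 :⊕ b :⊗ conᶻ 𝟘 :≡ a) refl (α x) (β x)))))
    where open ℤ[ζ]-Solver

  ∑α≡𝟘 : ∑ α ≡ 𝟘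
  ∑α≡𝟘 = double≡𝟘 (trans (trans (∑-scale α w≢0) (trans (sum-cong-≗ (λ x → trans (α-* x w) (trans (cong₂ (λ a b → α x ⊗ a ⊕ ⊖ (β x ⊗ b)) α-w₁ β-w₁)
    (solveᶻ 2 (λ a b → a :⊗ conᶻ 𝟘 :⊕ :⊖ (b :⊗ conᶻ 𝟙) :≡ :⊖ b) refl (α x) (β x))))) (∑-⊖ β))) (cong ⊖_ ∑β≡∑α))
    where open ℤ[ζ]-Solver

  ∑β≡𝟘 : ∑ β ≡ 𝟘
  ∑β≡𝟘 = trans ∑β≡∑α ∑α≡𝟘

  -- One step short of the period 2(e + 1) of Frobenius, hence the inverse of cubing.
  cbrt : K → K
  cbrt = frob (suc (2 ℕ.* e))

  cbrt-cube : ∀ x → cbrt (cube x) ≡ x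
  cbrt-cube x = trans (cong (λ n → frob n x) (rearrange e)) (frob-period x)
    where
    rearrange : ∀ e → suc (suc (2 ℕ.* e)) ≡ 2 ℕ.* suc e
    rearrange = ℕ-solve-∀

  cube-cbrt : ∀ x → cube (cbrt x) ≡ x
  cube-cbrt x = trans (sym (frob-cube (suc (2 ℕ.* e)) x)) (cbrt-cube x)

  ∑-cube : ∀ (f : K → ℤ[ζ]) → ∑ f ≡ ∑ (λ x → f (cube x))
  ∑-cube f = ∑-reindex f cube cbrt cube-cbrt cbrt-cube

  -- The quartic and the quadratic Gauss sum. For the quartic one only the real part is written,
  -- because the imaginary part is 0 by `∑βψ≡𝟘`.
  γ G : ℤ[ζ]
  γ = ∑ (λ u → α u ⊗ ψ u)
  G = ∑ (λ u → η u ⊗ ψ u)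

  -- Cubing fixes ψ and conjugates χ, so the imaginary part of the quartic Gauss sum cancels.
  ∑βψ≡𝟘 : ∑ (λ u → β u ⊗ ψ u) ≡ 𝟘
  ∑βψ≡𝟘 = double≡𝟘 (trans (∑-cube (λ u → β u ⊗ ψ u)) (trans (sum-cong-≗ (λ u → trans (cong₂ _⊗_ (β-cube u) (ψ-cube u)) (solveᶻ 2 (λ a b → (:⊖ a) :⊗ b :≡ :⊖ (a :⊗ b)) refl (β u) (ψ u)))) (∑-⊖ (λ u → β u ⊗ ψ u))))
    where open ℤ[ζ]-Solver

  ∑-unscale : ∀ (f : K → ℤ[ζ]) {z} → ¬ z ≡ 0# → ∑ (λ u → f u ⊗ ψ (u * z)) ≡ ∑ (λ u → f (u * z ⁻¹) ⊗ ψ u)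
  ∑-unscale f {z} z≢0 = trans (∑-scale (λ u → f u ⊗ ψ (u * z)) (⁻¹-≉0 z≢0))
    (sum-cong-≗ (λ u → cong (λ v → f (u * z ⁻¹) ⊗ ψ v) (trans (*-assoc u (z ⁻¹) z) (trans (cong (u *_) (inverseˡ z≢0)) (*-identityʳ u)))))

  -- After u ↦ u/z the coefficient is κ′(u/z) = α(u)κ(z) - β(u)κ′(z), and the β part sums to 0. This
  -- is the expansion of κ in additive characters; the factor γ is carried along and cancelled at
  -- the end as an integer.
  κ′-transform : ∀ z → ∑ (λ u → κ′ u ⊗ ψ (u * z)) ≡ γ ⊗ κ z
  κ′-transform z with z Fin.≟ 0#
  ... | yes refl = begin
    ∑ (λ u → κ′ u ⊗ ψ (u * 0#))  ≡⟨ sum-cong-≗ (λ u → trans (cong (κ′ u ⊗_) (trans (cong ψ (*-zeroʳ u)) ψ-0)) (solveᶻ 2 (λ a b → (a :⊕ :⊖ b) :⊗ conᶻ 𝟙 :≡ conᶻ 𝟙 :⊗ a :⊕ conᶻ (⊖ 𝟙) :⊗ b) refl (α u) (β u))) ⟩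
    ∑ (λ u → 𝟙 ⊗ α u ⊕ ⊖ 𝟙 ⊗ β u)  ≡⟨ ∑-linear 𝟙 (⊖ 𝟙) α β ⟩
    𝟙 ⊗ ∑ α ⊕ ⊖ 𝟙 ⊗ ∑ β  ≡⟨ cong₂ (λ a b → 𝟙 ⊗ a ⊕ ⊖ 𝟙 ⊗ b) ∑α≡𝟘 ∑β≡𝟘 ⟩
    𝟘  ≡⟨ zeroʳ γ ⟨
    γ ⊗ 𝟘  ≡⟨ cong (γ ⊗_) (cong₂ _⊕_ α-0 β-0) ⟨
    γ ⊗ κ 0#  ∎
    where open ℤ[ζ]-Solver
  ... | no z≢0 = begin
    ∑ (λ u → κ′ u ⊗ ψ (u * z))  ≡⟨ ∑-unscale κ′ z≢0 ⟩
    ∑ (λ u → κ′ (u * z ⁻¹) ⊗ ψ u)  ≡⟨ sum-cong-≗ (λ u → trans (cong (_⊗ ψ u) (κ′-/ u z))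
         (solveᶻ 5 (λ a b k k′ p → (a :⊗ k :⊕ :⊖ (b :⊗ k′)) :⊗ p :≡ k :⊗ (a :⊗ p) :⊕ (:⊖ k′) :⊗ (b :⊗ p)) refl (α u) (β u) (κ z) (κ′ z) (ψ u))) ⟩
    ∑ (λ u → κ z ⊗ (α u ⊗ ψ u) ⊕ ⊖ κ′ z ⊗ (β u ⊗ ψ u))  ≡⟨ ∑-linear (κ z) (⊖ κ′ z) (λ u → α u ⊗ ψ u) (λ u → β u ⊗ ψ u) ⟩
    κ z ⊗ γ ⊕ ⊖ κ′ z ⊗ ∑ (λ u → β u ⊗ ψ u)  ≡⟨ cong (λ s → κ z ⊗ γ ⊕ ⊖ κ′ z ⊗ s) ∑βψ≡𝟘 ⟩
    κ z ⊗ γ ⊕ ⊖ κ′ z ⊗ 𝟘  ≡⟨ solveᶻ 3 (λ k k′ g → k :⊗ g :⊕ (:⊖ k′) :⊗ conᶻ 𝟘 :≡ g :⊗ k) refl (κ z) (κ′ z) γ ⟩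
    γ ⊗ κ z  ∎
    where open ℤ[ζ]-Solver

  ∑κψ≡γ : ∑ (λ u → κ u ⊗ ψ u) ≡ γ
  ∑κψ≡γ = trans (sum-cong-≗ (λ u → ⊗-distribʳ-⊕ (ψ u) (α u) (β u))) (trans (∑-distrib-+ (λ u → α u ⊗ ψ u) (λ u → β u ⊗ ψ u)) (trans (cong (γ ⊕_) ∑βψ≡𝟘) (⊕-identityʳ γ)))

  ∑η≡𝟘 : ∑ η ≡ 𝟘
  ∑η≡𝟘 = begin
    ∑ η  ≡⟨ solveᶻ 2 (λ n s → s :≡ (n :⊕ s) :⊕ :⊖ n) refl (∑ (λ _ → 𝟙)) (∑ η) ⟩
    (∑ (λ _ → 𝟙) ⊕ ∑ η) ⊕ ⊖ ∑ (λ _ → 𝟙)  ≡⟨ cong (_⊕ ⊖ ∑ (λ _ → 𝟙)) (trans (sym (∑-distrib-+ {q} (λ _ → 𝟙) η)) (trans (sum-cong-≗ (λ u → sym (⊗-identityʳ (𝟙 ⊕ η u)))) (sym (∑-squares (λ _ → 𝟙))))) ⟩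
    ∑ (λ _ → 𝟙) ⊕ ⊖ ∑ (λ _ → 𝟙)  ≡⟨ ⊖-inverseʳ (∑ (λ _ → 𝟙)) ⟩
    𝟘  ∎
    where open ℤ[ζ]-Solver

  η-transform : ∀ z → ∑ (λ u → η u ⊗ ψ (u * z)) ≡ G ⊗ η z
  η-transform z with z Fin.≟ 0#
  ... | yes refl = begin
    ∑ (λ u → η u ⊗ ψ (u * 0#))  ≡⟨ sum-cong-≗ (λ u → trans (cong (η u ⊗_) (trans (cong ψ (*-zeroʳ u)) ψ-0)) (⊗-identityʳ (η u))) ⟩
    ∑ η  ≡⟨ ∑η≡𝟘 ⟩
    𝟘  ≡⟨ zeroʳ G ⟨
    G ⊗ 𝟘  ≡⟨ cong (G ⊗_) η-0 ⟨
    G ⊗ η 0#  ∎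
  ... | no z≢0 = begin
    ∑ (λ u → η u ⊗ ψ (u * z))  ≡⟨ ∑-unscale η z≢0 ⟩
    ∑ (λ u → η (u * z ⁻¹) ⊗ ψ u)  ≡⟨ sum-cong-≗ (λ u → trans (cong (_⊗ ψ u) (trans (η-* u (z ⁻¹)) (cong (η u ⊗_) (η-⁻¹ z)))) (solveᶻ 3 (λ a b c → (a :⊗ b) :⊗ c :≡ b :⊗ (a :⊗ c)) refl (η u) (η z) (ψ u))) ⟩
    ∑ (λ u → η z ⊗ (η u ⊗ ψ u))  ≡⟨ *-distribˡ-sum (η z) (λ u → η u ⊗ ψ u) ⟨
    η z ⊗ G  ≡⟨ ⊗-comm (η z) G ⟩
    G ⊗ η z  ∎
    where open ℤ[ζ]-Solver

  quadratic-sum : ∀ {a} → ¬ a ≡ 0# → ∑ (λ s → ψ ((s * s) * a)) ≡ G ⊗ η a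
  quadratic-sum {a} a≢0 = begin
    ∑ (λ s → ψ ((s * s) * a))  ≡⟨ ∑-squares (λ u → ψ (u * a)) ⟩
    ∑ (λ u → (𝟙 ⊕ η u) ⊗ ψ (u * a))  ≡⟨ sum-cong-≗ (λ u → solveᶻ 2 (λ b p → (conᶻ 𝟙 :⊕ b) :⊗ p :≡ p :⊕ b :⊗ p) refl (η u) (ψ (u * a))) ⟩
    ∑ (λ u → ψ (u * a) ⊕ η u ⊗ ψ (u * a))  ≡⟨ ∑-distrib-+ (λ u → ψ (u * a)) (λ u → η u ⊗ ψ (u * a)) ⟩
    ∑ (λ u → ψ (u * a)) ⊕ ∑ (λ u → η u ⊗ ψ (u * a))  ≡⟨ cong₂ _⊕_ (trans (sym (∑-scale ψ a≢0)) ∑ψ≡𝟘) (η-transform a) ⟩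
    𝟘 ⊕ G ⊗ η a  ≡⟨ ⊕-identityˡ _ ⟩
    G ⊗ η a  ∎
    where open ℤ[ζ]-Solver

  -- Applying the transform twice and evaluating at 1.
  gauss-square : ∀ (f f′ : K → ℤ[ζ]) g → (∀ z → ∑ (λ u → f u ⊗ ψ (u * z)) ≡ g ⊗ f′ z) → (∀ z → f′ (- z) ≡ f′ z) →
    ∑ (λ u → f′ u ⊗ ψ u) ≡ g → f 1# ≡ 𝟙 → g ⊗ g ≡ ι (+ q)
  gauss-square f f′ g transform even total f1≡𝟙 = begin
    g ⊗ g  ≡⟨ cong (g ⊗_) (trans (sym total) (∑-negate (λ u → f′ u ⊗ ψ u))) ⟩
    g ⊗ ∑ (λ z → f′ (- z) ⊗ ψ (- z))  ≡⟨ *-distribˡ-sum g (λ z → f′ (- z) ⊗ ψ (- z)) ⟩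
    ∑ (λ z → g ⊗ (f′ (- z) ⊗ ψ (- z)))  ≡⟨ sum-cong-≗ (λ z → trans (cong (λ a → g ⊗ (a ⊗ ψ (- z))) (even z)) (trans (sym (⊗-assoc g (f′ z) (ψ (- z)))) (cong (_⊗ ψ (- z)) (sym (transform z))))) ⟩
    ∑ (λ z → ∑ (λ u → f u ⊗ ψ (u * z)) ⊗ ψ (- z))  ≡⟨ sum-cong-≗ (λ z → *-distribʳ-sum (ψ (- z)) (λ u → f u ⊗ ψ (u * z))) ⟩
    ∑ (λ z → ∑ (λ u → f u ⊗ ψ (u * z) ⊗ ψ (- z)))  ≡⟨ ∑-comm {q} {q} (λ z u → f u ⊗ ψ (u * z) ⊗ ψ (- z)) ⟩
    ∑ (λ u → ∑ (λ z → f u ⊗ ψ (u * z) ⊗ ψ (- z)))  ≡⟨ sum-cong-≗ (λ u → trans (sum-cong-≗ (λ z → trans (⊗-assoc (f u) (ψ (u * z)) (ψ (- z)))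
         (cong (f u ⊗_) (trans (sym (ψ-+ (u * z) (- z))) (cong ψ (solve 2 (λ u z → u :* z :+ (:- z) := z :* (u :- con 1₃)) refl u z)))))) (sym (*-distribˡ-sum (f u) (λ z → ψ (z * (u - 1#)))))) ⟩
    ∑ (λ u → f u ⊗ ∑ (λ z → ψ (z * (u - 1#))))  ≡⟨ sum-cong-≗ (λ u → trans (cong (f u ⊗_) (trans (orthogonality (u - 1#)) (cong (ι (+ q) ⊗_) (δ-⇔ {x = u - 1#} {0#} {u} {1#} x-y≈0⇒x≈y x≈y⇒x-y≈0))))
         (solveᶻ 3 (λ a n d → a :⊗ (n :⊗ d) :≡ d :⊗ (n :⊗ a)) refl (f u) (ι (+ q)) (δ u 1#))) ⟩
    ∑ (λ u → δ u 1# ⊗ (ι (+ q) ⊗ f u))  ≡⟨ ∑-δ 1# (λ u → ι (+ q) ⊗ f u) ⟩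
    ι (+ q) ⊗ f 1#  ≡⟨ trans (cong (ι (+ q) ⊗_) f1≡𝟙) (⊗-identityʳ (ι (+ q))) ⟩
    ι (+ q)  ∎
    where open ℤ[ζ]-Solver

  r : ℕ
  r = 3 ℕ.^ suc e

  r*r≡q : r ℕ.* r ≡ q
  r*r≡q = trans (sym (ℕ.^-distribˡ-+-* 3 (suc e) (suc e))) (trans (cong (3 ℕ.^_) (cong (suc e ℕ.+_) (sym (ℕ.+-identityʳ (suc e))))) (sym q≡3^2e))

  r≢0 : ¬ + r ≡ 0ℤ
  r≢0 eq = ℕ.<⇒≢ (ℕ.m^n>0 3 (suc e)) (sym (ℤ.+-injective eq))

  ±r : ∀ {g} → g ⊗ g ≡ ι (+ q) → g ≡ ι (+ r) ⊎ g ≡ ι (ℤ.- + r)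
  ±r eq = square≡ι r≢0 (trans eq (cong ι (trans (cong +_ (sym r*r≡q)) (ℤ.pos-* r r))))

  γ-value : γ ≡ ι (+ r) ⊎ γ ≡ ι (ℤ.- + r)
  γ-value = ±r (gauss-square κ′ κ γ κ′-transform κ-neg ∑κψ≡γ (cong₂ (λ a b → a ⊕ ⊖ b) α-1 β-1))

  G-value : G ≡ ι (+ r) ⊎ G ≡ ι (ℤ.- + r)
  G-value = ±r (gauss-square η η G η-transform η-neg refl η-1)

  -- The sum X(b) and the quadratic form b(y⁴ − y²)

  -- Only the real part of χ appears in `X`: the map t ↦ 1/t preserves the phase and conjugates χ,
  -- so the imaginary part of the full sum is 0. The term at t = 0 vanishes because `α` does.
  X W : K → ℤ[ζ]
  X b = ∑ (λ t → α t ⊗ ψ (b * (t + t ⁻¹)))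
  W b = ∑ (λ y → ψ (b * (y * y * (y * y) - y * y)))

  x*y≡1⇒x≢0 : ∀ {x y} → x * y ≡ 1# → ¬ x ≡ 0#
  x*y≡1⇒x≢0 {y = y} xy≡1 x≡0 = 1≢0 (trans (sym xy≡1) (trans (cong (_* y) x≡0) (*-zeroˡ y)))

  ⁻¹-unique : ∀ {x y} → x * y ≡ 1# → x ⁻¹ ≡ y
  ⁻¹-unique {x} xy≡1 = *-cancelˡ (x*y≡1⇒x≢0 xy≡1) (trans (inverseʳ (x*y≡1⇒x≢0 xy≡1)) (sym xy≡1))

  ⁻¹-involutive : ∀ x → (x ⁻¹) ⁻¹ ≡ x
  ⁻¹-involutive x = cases (x Fin.≟ 0#)
    where
    cases : Dec (x ≡ 0#) → (x ⁻¹) ⁻¹ ≡ x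
    cases (yes x≡0) = trans (cong (λ y → (y ⁻¹) ⁻¹) x≡0) (trans (cong _⁻¹ 0⁻¹≈0) (trans 0⁻¹≈0 (sym x≡0)))
    cases (no  x≢0) = ⁻¹-unique (inverseˡ x≢0)

  ∑-invert : ∀ (f : K → ℤ[ζ]) → ∑ f ≡ ∑ (λ x → f (x ⁻¹))
  ∑-invert f = ∑-reindex f _⁻¹ _⁻¹ ⁻¹-involutive ⁻¹-involutive

  -- The substitution u = x²: α(x²) = η(x), and the weight 1 + η(u) acts on α(u) as 2 because αη =
  -- α.
  ∑-α-double : ∀ (f : K → ℤ[ζ]) → ∑ (λ x → η x ⊗ f (x * x)) ≡ ∑ (λ u → α u ⊗ f u) ⊕ ∑ (λ u → α u ⊗ f u)
  ∑-α-double f = begin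
    ∑ (λ x → η x ⊗ f (x * x))  ≡⟨ sum-cong-≗ (λ x → cong (_⊗ f (x * x)) (sym (α-square x))) ⟩
    ∑ (λ x → α (x * x) ⊗ f (x * x))  ≡⟨ ∑-squares (λ u → α u ⊗ f u) ⟩
    ∑ (λ u → (𝟙 ⊕ η u) ⊗ (α u ⊗ f u))  ≡⟨ sum-cong-≗ (λ u → trans (solveᶻ 3 (λ n a p → (conᶻ 𝟙 :⊕ n) :⊗ (a :⊗ p) :≡ a :⊗ p :⊕ (a :⊗ n) :⊗ p) refl (η u) (α u) (f u)) (cong (λ a → α u ⊗ f u ⊕ a ⊗ f u) (αη≡α u))) ⟩
    ∑ (λ u → α u ⊗ f u ⊕ α u ⊗ f u)  ≡⟨ ∑-distrib-+ (λ u → α u ⊗ f u) (λ u → α u ⊗ f u) ⟩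
    ∑ (λ u → α u ⊗ f u) ⊕ ∑ (λ u → α u ⊗ f u)  ∎
    where open ℤ[ζ]-Solver

  -- The equation x² - zx + 1 = 0 with the square completed; in characteristic 3, -1/2 = 1 and 4 =
  -- 1.
  reciprocal-sum : ∀ {x z} → ¬ x ≡ 0# → x + x ⁻¹ ≡ z → (x + z) * (x + z) ≡ z * z - 1#
  reciprocal-sum {x} {z} x≢0 eq = trans (solve 2 (λ x z → (x :+ z) :* (x :+ z) := x :* x :- x :* z :+ z :* z) refl x z)
    (trans (cong (λ u → x * x - u + z * z) (trans (cong (x *_) (sym eq)) (trans (distribˡ x x (x ⁻¹)) (cong (λ u → x * x + u) (inverseʳ x≢0)))))
      (solve 2 (λ x z → x :* x :- (x :* x :+ con 1₃) :+ z :* z := z :* z :- con 1₃) refl x z))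

  reciprocal-sum⁻ : ∀ {x z} → ¬ x ≡ 0# → (x + z) * (x + z) ≡ z * z - 1# → x + x ⁻¹ ≡ z
  reciprocal-sum⁻ {x} {z} x≢0 eq = *-cancelˡ x≢0 (trans (distribˡ x x (x ⁻¹)) (trans (cong (λ u → x * x + u) (inverseʳ x≢0))
    (x-y≈0⇒x≈y (trans (solve 2 (λ x z → (x :* x :+ con 1₃) :- x :* z := (x :+ z) :* (x :+ z) :- (z :* z :- con 1₃)) refl x z) (x≈y⇒x-y≈0 eq)))))

  -- This is (z + 2)x = (x + 1)² with 2 = -1. It makes η constant on the fibre over z, with value
  -- η(z - 1).
  square-shift : ∀ {x z} → ¬ x ≡ 0# → x + x ⁻¹ ≡ z → (z - 1#) * x ≡ (x + 1#) * (x + 1#)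
  square-shift {x} {z} x≢0 eq = trans (cong (λ z → (z - 1#) * x) (sym eq)) (trans (solve 2 (λ x y → ((x :+ y) :- con 1₃) :* x := (x :* x :- x) :+ x :* y) refl x (x ⁻¹))
    (trans (cong (λ u → (x * x - x) + u) (inverseʳ x≢0)) (solve 1 (λ x → (x :* x :- x) :+ con 1₃ := (x :+ con 1₃) :* (x :+ con 1₃)) refl x)))

  z*z≢z*z-1 : ∀ z → ¬ (0# + z) * (0# + z) ≡ z * z - 1#
  z*z≢z*z-1 z eq = 1≢0 (trans (solve 1 (λ z → con 1₃ := (con 0₃ :+ z) :* (con 0₃ :+ z) :- (z :* z :- con 1₃)) refl z) (x≈y⇒x-y≈0 eq))

  η-unit : ∀ {x} → ¬ x ≡ 0# → η x ⊗ η x ≡ 𝟙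
  η-unit {x} x≢0 = Sign-square (η-sign x x≢0)

  η-reciprocal : ∀ {x z} → ¬ x ≡ 0# → ¬ z ≡ 1# → x + x ⁻¹ ≡ z → η x ≡ η (z - 1#)
  η-reciprocal {x} {z} x≢0 z≢1 eq = begin
    η x  ≡⟨ ⊗-identityˡ (η x) ⟨
    𝟙 ⊗ η x  ≡⟨ cong (_⊗ η x) (η-unit z-1≢0) ⟨
    η (z - 1#) ⊗ η (z - 1#) ⊗ η x  ≡⟨ ⊗-assoc (η (z - 1#)) (η (z - 1#)) (η x) ⟩
    η (z - 1#) ⊗ (η (z - 1#) ⊗ η x)  ≡⟨ cong (η (z - 1#) ⊗_) (trans (sym (η-* (z - 1#) x)) (trans (cong η (square-shift x≢0 eq)) (trans (η-* (x + 1#) (x + 1#)) (η-unit x+1≢0)))) ⟩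
    η (z - 1#) ⊗ 𝟙  ≡⟨ ⊗-identityʳ (η (z - 1#)) ⟩
    η (z - 1#)  ∎
    where
    z-1≢0 : ¬ z - 1# ≡ 0#
    z-1≢0 p = z≢1 (x-y≈0⇒x≈y p)
    x+1≢0 : ¬ x + 1# ≡ 0#
    x+1≢0 p = [ z-1≢0 , x≢0 ]′ (zero-product (trans (square-shift x≢0 eq) (trans (cong (_* (x + 1#)) p) (*-zeroˡ (x + 1#)))))

  fibre-term : ∀ {z} → ¬ z ≡ 1# → ∀ x → δ (x + x ⁻¹) z ⊗ η x ≡ δ ((x + z) * (x + z)) (z * z - 1#) ⊗ η (z - 1#)
  fibre-term {z} z≢1 x = cases (x Fin.≟ 0#)
    where
    Goal : K → Set
    Goal x = δ (x + x ⁻¹) z ⊗ η x ≡ δ ((x + z) * (x + z)) (z * z - 1#) ⊗ η (z - 1#)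
    nonzero : ¬ x ≡ 0# → Dec (x + x ⁻¹ ≡ z) → Goal x
    nonzero x≢0 (yes p) = cong₂ _⊗_ (δ-⇔ (reciprocal-sum x≢0) (reciprocal-sum⁻ x≢0)) (η-reciprocal x≢0 z≢1 p)
    nonzero x≢0 (no  p) = trans (trans (cong (_⊗ η x) (δ-≢ p)) (zeroˡ (η x))) (sym (trans (cong (_⊗ η (z - 1#)) (δ-≢ (λ p′ → p (reciprocal-sum⁻ x≢0 p′)))) (zeroˡ (η (z - 1#)))))
    cases : Dec (x ≡ 0#) → Goal x
    -- At x = 0 the left side vanishes with `η`, and the right side because (0 + z)² is never z² -
    -- 1; so the quadratic equation counts no spurious solution.
    cases (yes x≡0) = ≡.subst Goal (sym x≡0) (trans (trans (cong (δ (0# + 0# ⁻¹) z ⊗_) η-0) (zeroʳ (δ (0# + 0# ⁻¹) z))) (sym (trans (cong (_⊗ η (z - 1#)) (δ-≢ (z*z≢z*z-1 z))) (zeroˡ (η (z - 1#))))))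
    cases (no  x≢0) = nonzero x≢0 (x + x ⁻¹ Fin.≟ z)

  -- Over z = 1 the quadratic has the double root -1, and `square-shift` says nothing about η(x)
  -- since z - 1 = 0; the fibre is evaluated directly.
  fibre-term-1 : ∀ x → δ (x + x ⁻¹) 1# ⊗ η x ≡ δ x (- 1#) ⊗ 𝟙
  fibre-term-1 x = cases (x Fin.≟ - 1#)
    where
    Goal : K → Set
    Goal x = δ (x + x ⁻¹) 1# ⊗ η x ≡ δ x (- 1#) ⊗ 𝟙
    -1⁻¹≡-1 : (- 1#) ⁻¹ ≡ - 1#
    -1⁻¹≡-1 = ⁻¹-unique (solve 0 ((:- con 1₃) :* (:- con 1₃) := con 1₃) refl)
    sum≡1 : - 1# + (- 1#) ⁻¹ ≡ 1#
    sum≡1 = trans (cong (λ u → - 1# + u) -1⁻¹≡-1) (solve 0 ((:- con 1₃) :+ (:- con 1₃) := con 1₃) refl)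
    at--1# : Goal (- 1#)
    at--1# = cong₂ _⊗_ (trans (cong (λ u → δ u 1#) sum≡1) (trans (δ-refl 1#) (sym (δ-refl (- 1#))))) (trans (η-neg 1#) η-1)
    off : ¬ x ≡ - 1# → Dec (x ≡ 0#) → δ (x + x ⁻¹) 1# ⊗ η x ≡ 𝟘
    off x≢-1 (yes x≡0) = trans (cong (λ u → δ (x + x ⁻¹) 1# ⊗ u) (trans (cong η x≡0) η-0)) (zeroʳ (δ (x + x ⁻¹) 1#))
    off x≢-1 (no  x≢0) = trans (cong (_⊗ η x) (δ-≢ no-root)) (zeroˡ (η x))
      where
      no-root : ¬ x + x ⁻¹ ≡ 1#
      no-root p = x≢-1 (x-y≈0⇒x≈y (trans (solve 1 (λ x → x :- (:- con 1₃) := x :+ con 1₃) refl x) ([ (λ a → a) , (λ a → a) ]′ (zero-product (trans (reciprocal-sum x≢0 p) (solve 0 (con 1₃ :* con 1₃ :- con 1₃ := con 0₃) refl))))))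
    cases : Dec (x ≡ - 1#) → Goal x
    cases (yes p) = ≡.subst Goal (sym p) at--1#
    cases (no  p) = trans (off p (x Fin.≟ 0#)) (sym (trans (cong (_⊗ 𝟙) (δ-≢ p)) (zeroˡ 𝟙)))

  -- For z ≠ 1 the fibre has 1 + η(z² - 1) elements, each contributing η(z - 1). Multiplying out
  -- with z² - 1 = (z - 1)(z + 1) gives an expression that is symmetric under z ↦ -z.
  fibre-sum : ∀ z → ∑ (λ x → δ (x + x ⁻¹) z ⊗ η x) ≡ η (z - 1#) ⊕ η (z + 1#)
  fibre-sum z = cases (z Fin.≟ 1#)
    where
    Goal : K → Set
    Goal z = ∑ (λ x → δ (x + x ⁻¹) z ⊗ η x) ≡ η (z - 1#) ⊕ η (z + 1#)
    at-1# : Goal 1#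
    at-1# = begin
      ∑ (λ x → δ (x + x ⁻¹) 1# ⊗ η x)  ≡⟨ sum-cong-≗ fibre-term-1 ⟩
      ∑ (λ x → δ x (- 1#) ⊗ 𝟙)  ≡⟨ ∑-δ (- 1#) (λ _ → 𝟙) ⟩
      𝟙  ≡⟨⟩
      𝟘 ⊕ 𝟙  ≡⟨ cong₂ _⊕_ (trans (cong η (-‿inverseʳ 1#)) η-0) (trans (cong η (solve 0 (con 1₃ :+ con 1₃ := :- con 1₃) refl)) (trans (η-neg 1#) η-1)) ⟨
      η (1# - 1#) ⊕ η (1# + 1#)  ∎
    generic : ¬ z ≡ 1# → Goal z
    generic z≢1 = begin
      ∑ (λ x → δ (x + x ⁻¹) z ⊗ η x)  ≡⟨ sum-cong-≗ (fibre-term z≢1) ⟩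
      ∑ (λ x → δ ((x + z) * (x + z)) (z * z - 1#) ⊗ η (z - 1#))  ≡⟨ *-distribʳ-sum (η (z - 1#)) (λ x → δ ((x + z) * (x + z)) (z * z - 1#)) ⟨
      ∑ (λ x → δ ((x + z) * (x + z)) (z * z - 1#)) ⊗ η (z - 1#)  ≡⟨ cong (_⊗ η (z - 1#)) (trans (sym (∑-shift (λ x → δ (x * x) (z * z - 1#)) z)) (square-root-count (z * z - 1#))) ⟩
      (𝟙 ⊕ η (z * z - 1#)) ⊗ η (z - 1#)  ≡⟨ cong (λ u → (𝟙 ⊕ u) ⊗ η (z - 1#)) (trans (cong η (solve 1 (λ z → z :* z :- con 1₃ := (z :- con 1₃) :* (z :+ con 1₃)) refl z)) (η-* (z - 1#) (z + 1#))) ⟩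
      (𝟙 ⊕ η (z - 1#) ⊗ η (z + 1#)) ⊗ η (z - 1#)  ≡⟨ solveᶻ 2 (λ a b → (conᶻ 𝟙 :⊕ a :⊗ b) :⊗ a :≡ a :⊕ (a :⊗ a) :⊗ b) refl (η (z - 1#)) (η (z + 1#)) ⟩
      η (z - 1#) ⊕ η (z - 1#) ⊗ η (z - 1#) ⊗ η (z + 1#)  ≡⟨ cong (λ u → η (z - 1#) ⊕ u ⊗ η (z + 1#)) (η-unit (λ p → z≢1 (x-y≈0⇒x≈y p))) ⟩
      η (z - 1#) ⊕ 𝟙 ⊗ η (z + 1#)  ≡⟨ cong (η (z - 1#) ⊕_) (⊗-identityˡ (η (z + 1#))) ⟩
      η (z - 1#) ⊕ η (z + 1#)  ∎
      where open ℤ[ζ]-Solver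
    cases : Dec (z ≡ 1#) → Goal z
    cases (yes p) = ≡.subst Goal (sym p) at-1#
    cases (no  p) = generic p

  ∑-reciprocal : ∀ (f : K → ℤ[ζ]) → ∑ (λ x → η x ⊗ f (x + x ⁻¹)) ≡ ∑ (λ z → (η (z - 1#) ⊕ η (z + 1#)) ⊗ f z)
  ∑-reciprocal f = begin
    ∑ (λ x → η x ⊗ f (x + x ⁻¹))  ≡⟨ sum-cong-≗ (λ x → sym (∑-δ′ (x + x ⁻¹) (λ z → η x ⊗ f z))) ⟩
    ∑ (λ x → ∑ (λ z → δ (x + x ⁻¹) z ⊗ (η x ⊗ f z)))  ≡⟨ ∑-comm {q} {q} (λ x z → δ (x + x ⁻¹) z ⊗ (η x ⊗ f z)) ⟩
    ∑ (λ z → ∑ (λ x → δ (x + x ⁻¹) z ⊗ (η x ⊗ f z)))  ≡⟨ sum-cong-≗ (λ z → trans (sum-cong-≗ (λ x → sym (⊗-assoc (δ (x + x ⁻¹) z) (η x) (f z)))) (sym (*-distribʳ-sum (f z) (λ x → δ (x + x ⁻¹) z ⊗ η x)))) ⟩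
    ∑ (λ z → ∑ (λ x → δ (x + x ⁻¹) z ⊗ η x) ⊗ f z)  ≡⟨ sum-cong-≗ (λ z → cong (_⊗ f z) (fibre-sum z)) ⟩
    ∑ (λ z → (η (z - 1#) ⊕ η (z + 1#)) ⊗ f z)  ∎

  half : ∀ {x y} → x ⊕ x ≡ y ⊕ y → x ≡ y
  half {x} {y} eq = ι-cancel (+ 2) (λ ()) (trans (solveᶻ 1 (λ x → conᶻ (ι (+ 2)) :⊗ x :≡ x :⊕ x) refl x) (trans eq (solveᶻ 1 (λ x → x :⊕ x :≡ conᶻ (ι (+ 2)) :⊗ x) refl y)))
    where open ℤ[ζ]-Solver

  -- With t = x² and z = x + 1/x the phase becomes x² + x⁻² = z² - 2 = z² + 1. The two halves of
  -- `fibre-sum` are exchanged by z ↦ -z, which cancels the 2 that came from t = x².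
  X≡∑η : ∀ b → X b ≡ ∑ (λ z → η (z - 1#) ⊗ ψ (b * (z * z + 1#)))
  X≡∑η b = half (begin
    X b ⊕ X b  ≡⟨ ∑-α-double (λ u → ψ (b * (u + u ⁻¹))) ⟨
    ∑ (λ x → η x ⊗ ψ (b * (x * x + (x * x) ⁻¹)))  ≡⟨ sum-cong-≗ (λ x → rewrite-term x (x Fin.≟ 0#)) ⟩
    ∑ (λ x → η x ⊗ f (x + x ⁻¹))  ≡⟨ ∑-reciprocal f ⟩
    ∑ (λ z → (η (z - 1#) ⊕ η (z + 1#)) ⊗ f z)  ≡⟨ sum-cong-≗ (λ z → ⊗-distribʳ-⊕ (f z) (η (z - 1#)) (η (z + 1#))) ⟩
    ∑ (λ z → η (z - 1#) ⊗ f z ⊕ η (z + 1#) ⊗ f z)  ≡⟨ ∑-distrib-+ (λ z → η (z - 1#) ⊗ f z) (λ z → η (z + 1#) ⊗ f z) ⟩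
    Y ⊕ ∑ (λ z → η (z + 1#) ⊗ f z)  ≡⟨ cong (Y ⊕_) (trans (∑-negate (λ z → η (z + 1#) ⊗ f z)) (sum-cong-≗ (λ z → cong₂ _⊗_
         (trans (cong η (solve 1 (λ z → (:- z) :+ con 1₃ := :- (z :- con 1₃)) refl z)) (η-neg (z - 1#)))
         (cong (λ u → ψ (b * (u + 1#))) (solve 1 (λ z → (:- z) :* (:- z) := z :* z) refl z))))) ⟩
    Y ⊕ Y  ∎)
    where
    f : K → ℤ[ζ]
    f z = ψ (b * (z * z + 1#))
    Y : ℤ[ζ]
    Y = ∑ (λ z → η (z - 1#) ⊗ f z)
    rewrite-term : ∀ x → Dec (x ≡ 0#) → η x ⊗ ψ (b * (x * x + (x * x) ⁻¹)) ≡ η x ⊗ f (x + x ⁻¹)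
    rewrite-term x (yes x≡0) = trans (vanish (ψ (b * (x * x + (x * x) ⁻¹)))) (sym (vanish (f (x + x ⁻¹))))
      where
      vanish : ∀ u → η x ⊗ u ≡ 𝟘
      vanish u = trans (cong (_⊗ u) (trans (cong η x≡0) η-0)) (zeroˡ u)
    rewrite-term x (no x≢0) = cong (λ u → η x ⊗ ψ (b * u)) (trans (cong (λ u → x * x + u) (⁻¹-unique inverse-square)) (sym expand))
      where
      y : K
      y = x ⁻¹
      inverse-square : (x * x) * (y * y) ≡ 1#
      inverse-square = trans (solve 2 (λ x y → (x :* x) :* (y :* y) := (x :* y) :* (x :* y)) refl x y) (trans (cong₂ _*_ (inverseʳ x≢0) (inverseʳ x≢0)) (*-identityˡ 1#))
      expand : (x + y) * (x + y) + 1# ≡ x * x + y * y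
      expand = trans (solve 2 (λ x y → (x :+ y) :* (x :+ y) :+ con 1₃ := (x :* x :+ y :* y :+ con 1₃) :- x :* y) refl x y)
        (trans (cong (λ u → (x * x + y * y + 1#) - u) (inverseʳ x≢0)) (solve 2 (λ x y → (x :* x :+ y :* y :+ con 1₃) :- con 1₃ := x :* x :+ y :* y) refl x y))

  -- With z = y² + 1 one has y⁴ - y² = z² - 1 = 1 + (z² + 1). Summing over y weights u = y² = z - 1
  -- by 1 + η(u): the η part is the sum of `X≡∑η`, the constant part a quadratic Gauss sum.
  W≡ : ∀ b → ¬ b ≡ 0# → W b ≡ ψ b ⊗ (X b ⊕ ψ b ⊗ (G ⊗ η b))
  W≡ b b≢0 = begin
    W b  ≡⟨ sum-cong-≗ (λ y → trans (cong ψ (solve 2 (λ b y → b :* (y :* y :* (y :* y) :- y :* y) := b :+ b :* ((y :* y :+ con 1₃) :* (y :* y :+ con 1₃) :+ con 1₃)) refl b y)) (ψ-+ b (b * ((y * y + 1#) * (y * y + 1#) + 1#)))) ⟩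
    ∑ (λ y → ψ b ⊗ f (y * y + 1#))  ≡⟨ *-distribˡ-sum (ψ b) (λ y → f (y * y + 1#)) ⟨
    ψ b ⊗ ∑ (λ y → f (y * y + 1#))  ≡⟨ cong (ψ b ⊗_) (∑-squares (λ u → f (u + 1#))) ⟩
    ψ b ⊗ ∑ (λ u → (𝟙 ⊕ η u) ⊗ f (u + 1#))  ≡⟨ cong (ψ b ⊗_) (trans (sum-cong-≗ (λ u → solveᶻ 2 (λ n p → (conᶻ 𝟙 :⊕ n) :⊗ p :≡ n :⊗ p :⊕ p) refl (η u) (f (u + 1#)))) (∑-distrib-+ (λ u → η u ⊗ f (u + 1#)) (λ u → f (u + 1#)))) ⟩
    ψ b ⊗ (∑ (λ u → η u ⊗ f (u + 1#)) ⊕ ∑ (λ u → f (u + 1#)))  ≡⟨ cong₂ (λ a c → ψ b ⊗ (a ⊕ c)) first second ⟩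
    ψ b ⊗ (X b ⊕ ψ b ⊗ (G ⊗ η b))  ∎
    where
    open ℤ[ζ]-Solver
    f : K → ℤ[ζ]
    f z = ψ (b * (z * z + 1#))
    first : ∑ (λ u → η u ⊗ f (u + 1#)) ≡ X b
    first = trans (sum-cong-≗ (λ u → cong (λ v → η v ⊗ f (u + 1#)) (solve 1 (λ u → u := (u :+ con 1₃) :- con 1₃) refl u))) (trans (sym (∑-shift (λ z → η (z - 1#) ⊗ f z) 1#)) (sym (X≡∑η b)))
    second : ∑ (λ u → f (u + 1#)) ≡ ψ b ⊗ (G ⊗ η b)
    second = begin
      ∑ (λ u → f (u + 1#))  ≡⟨ ∑-shift f 1# ⟨
      ∑ f  ≡⟨ sum-cong-≗ (λ z → trans (cong ψ (solve 2 (λ b z → b :* (z :* z :+ con 1₃) := b :+ (z :* z) :* b) refl b z)) (ψ-+ b ((z * z) * b))) ⟩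
      ∑ (λ z → ψ b ⊗ ψ ((z * z) * b))  ≡⟨ *-distribˡ-sum (ψ b) (λ z → ψ ((z * z) * b)) ⟨
      ψ b ⊗ ∑ (λ z → ψ ((z * z) * b))  ≡⟨ cong (ψ b ⊗_) (quadratic-sum b≢0) ⟩
      ψ b ⊗ (G ⊗ η b)  ∎

  ∑-bits : ∀ {n} (f : Fin n → ℤ[ζ]) → (∀ x → f x ≡ 𝟘 ⊎ f x ≡ 𝟙) → ∃[ m ] sum f ≡ ι (+ m)
  ∑-bits {zero}  f bit = 0 , refl
  ∑-bits {suc n} f bit = add (bit zero) (∑-bits (λ x → f (suc x)) (λ x → bit (suc x)))
    where
    add : f zero ≡ 𝟘 ⊎ f zero ≡ 𝟙 → (∃[ m ] sum (λ x → f (suc x)) ≡ ι (+ m)) → ∃[ m ] sum f ≡ ι (+ m)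
    add (inj₁ p) (m , eq) = m , cong₂ _⊕_ p eq
    add (inj₂ p) (m , eq) = suc m , cong₂ _⊕_ p eq

  δ-bit : ∀ {n} (x y : Fin n) → δ x y ≡ 𝟘 ⊎ δ x y ≡ 𝟙
  δ-bit x y = cases (x Fin.≟ y)
    where
    cases : Dec (x ≡ y) → δ x y ≡ 𝟘 ⊎ δ x y ≡ 𝟙
    cases (yes refl) = inj₂ (δ-refl x)
    cases (no  x≢y)  = inj₁ (δ-≢ x≢y)

  -- The nonempty fibres of an additive map are translates of its kernel.
  kernel-∣q : ∀ (ℓ : K → K) → (∀ x y → ℓ (x + y) ≡ ℓ x + ℓ y) → ∃[ ρ ] (∑ (λ x → δ (ℓ x) 0#) ≡ ι (+ ρ) × ρ ∣ q)
  kernel-∣q ℓ ℓ-+ = ρ , ρ≡ , divides (proj₁ images) (ℤ.+-injective (ι-injective q≡))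
    where
    kernel : ∃[ m ] ∑ (λ x → δ (ℓ x) 0#) ≡ ι (+ m)
    kernel = ∑-bits (λ x → δ (ℓ x) 0#) (λ x → δ-bit (ℓ x) 0#)
    ρ : ℕ
    ρ = proj₁ kernel
    ρ≡ : ∑ (λ x → δ (ℓ x) 0#) ≡ ι (+ ρ)
    ρ≡ = proj₂ kernel
    Fibre : K → Set
    Fibre u = ∃[ b ] ((b ≡ 𝟘 ⊎ b ≡ 𝟙) × ∑ (λ x → δ (ℓ x) u) ≡ b ⊗ ι (+ ρ))
    translate : ∀ {x a} → (ℓ (x + a) ≡ ℓ a → ℓ x ≡ 0#) × (ℓ x ≡ 0# → ℓ (x + a) ≡ ℓ a)
    translate {x} {a} = (λ p → trans (solve 2 (λ x a → x := (x :+ a) :- a) refl (ℓ x) (ℓ a)) (x≈y⇒x-y≈0 (trans (sym (ℓ-+ x a)) p)))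
                      , (λ p → trans (ℓ-+ x a) (trans (cong (_+ ℓ a) p) (+-identityˡ (ℓ a))))
    fibre : ∀ u → Dec (∃[ a ] ℓ a ≡ u) → Fibre u
    fibre u (yes (a , refl)) = 𝟙 , inj₂ refl , (begin
      ∑ (λ x → δ (ℓ x) (ℓ a))  ≡⟨ ∑-shift (λ x → δ (ℓ x) (ℓ a)) a ⟩
      ∑ (λ x → δ (ℓ (x + a)) (ℓ a))  ≡⟨ sum-cong-≗ (λ x → δ-⇔ (proj₁ (translate {x} {a})) (proj₂ (translate {x} {a}))) ⟩
      ∑ (λ x → δ (ℓ x) 0#)  ≡⟨ ρ≡ ⟩
      ι (+ ρ)  ≡⟨ ⊗-identityˡ (ι (+ ρ)) ⟨
      𝟙 ⊗ ι (+ ρ)  ∎)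
    fibre u (no empty) = 𝟘 , inj₁ refl , trans (sum-cong-≗ (λ x → δ-≢ (λ p → empty (x , p)))) (trans (∑-𝟘 {q}) (sym (zeroˡ (ι (+ ρ)))))
    fibres : ∀ u → Fibre u
    fibres u = fibre u (Fin.any? (λ a → ℓ a Fin.≟ u))
    images : ∃[ m ] ∑ (λ u → proj₁ (fibres u)) ≡ ι (+ m)
    images = ∑-bits (λ u → proj₁ (fibres u)) (λ u → proj₁ (proj₂ (fibres u)))
    q≡ : ι (+ q) ≡ ι (+ (proj₁ images ℕ.* ρ))
    q≡ = begin
      ι (+ q)  ≡⟨ ∑-𝟙 {q} ⟨
      ∑ (λ _ → 𝟙)  ≡⟨ sum-cong-≗ (λ x → sym (∑-δ′ (ℓ x) (λ _ → 𝟙))) ⟩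
      ∑ (λ x → ∑ (λ u → δ (ℓ x) u ⊗ 𝟙))  ≡⟨ ∑-comm {q} {q} (λ x u → δ (ℓ x) u ⊗ 𝟙) ⟩
      ∑ (λ u → ∑ (λ x → δ (ℓ x) u ⊗ 𝟙))  ≡⟨ sum-cong-≗ (λ u → trans (sum-cong-≗ (λ x → ⊗-identityʳ (δ (ℓ x) u))) (proj₂ (proj₂ (fibres u)))) ⟩
      ∑ (λ u → proj₁ (fibres u) ⊗ ι (+ ρ))  ≡⟨ *-distribʳ-sum (ι (+ ρ)) (λ u → proj₁ (fibres u)) ⟨
      ∑ (λ u → proj₁ (fibres u)) ⊗ ι (+ ρ)  ≡⟨ cong (_⊗ ι (+ ρ)) (proj₂ images) ⟩
      ι (+ proj₁ images) ⊗ ι (+ ρ)  ≡⟨ ι-* (+ proj₁ images) (+ ρ) ⟨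
      ι (+ proj₁ images ℤ.* + ρ)  ≡⟨ cong ι (ℤ.pos-* (proj₁ images) ρ) ⟨
      ι (+ (proj₁ images ℕ.* ρ))  ∎

  module QuadraticForm (b : K) where

    -- The exponents 4 = 3 + 1 and 2 = 1 + 1 make the trace of Q a quadratic form over the prime
    -- field. Its polar form is b(y³d + yd³ + yd); under the trace y³·bd may be replaced by
    -- y·cbrt(bd), so that y·ℓ(d) represents it and the kernel of `ℓ` is the radical.
    Q ℓ : K → K
    Q y = b * (y * y * (y * y) - y * y)
    ℓ d = cbrt (b * d) + (b * cube d + b * d)

    ℓ-+ : ∀ x y → ℓ (x + y) ≡ ℓ x + ℓ y
    ℓ-+ x y = trans (cong (λ u → u + (b * cube (x + y) + b * (x + y))) (trans (cong cbrt (distribˡ b x y)) (frob-+ (suc (2 ℕ.* e)) (b * x) (b * y))))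
      (solve 5 (λ m n b x y → (m :+ n) :+ (b :* ((x :+ y) :* (x :+ y) :* (x :+ y)) :+ b :* (x :+ y)) :=
        (m :+ (b :* (x :* x :* x) :+ b :* x)) :+ (n :+ (b :* (y :* y :* y) :+ b :* y))) refl (cbrt (b * x)) (cbrt (b * y)) b x y)

    Q-difference : ∀ y d → ψ (Q (y + d)) ⊗ ψ (- Q y) ≡ ψ (Q d) ⊗ ψ (y * ℓ d)
    Q-difference y d = begin
      ψ (Q (y + d)) ⊗ ψ (- Q y)  ≡⟨ ψ-+ (Q (y + d)) (- Q y) ⟨
      ψ (Q (y + d) - Q y)  ≡⟨ cong ψ (solve 3 (λ b y d → b :* ((y :+ d) :* (y :+ d) :* ((y :+ d) :* (y :+ d)) :- (y :+ d) :* (y :+ d)) :- b :* (y :* y :* (y :* y) :- y :* y) :=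
          b :* (d :* d :* (d :* d) :- d :* d) :+ ((y :* y :* y) :* (b :* d) :+ y :* (b :* (d :* d :* d) :+ b :* d))) refl b y d) ⟩
      ψ (Q d + (cube y * (b * d) + y * (b * cube d + b * d)))  ≡⟨ trans (ψ-+ (Q d) _) (cong (ψ (Q d) ⊗_) (ψ-+ (cube y * (b * d)) (y * (b * cube d + b * d)))) ⟩
      ψ (Q d) ⊗ (ψ (cube y * (b * d)) ⊗ ψ (y * (b * cube d + b * d)))  ≡⟨ cong (λ u → ψ (Q d) ⊗ (u ⊗ ψ (y * (b * cube d + b * d)))) root ⟩
      ψ (Q d) ⊗ (ψ (y * cbrt (b * d)) ⊗ ψ (y * (b * cube d + b * d)))  ≡⟨ cong (ψ (Q d) ⊗_) (trans (sym (ψ-+ (y * cbrt (b * d)) (y * (b * cube d + b * d)))) (cong ψ (sym (distribˡ y (cbrt (b * d)) (b * cube d + b * d))))) ⟩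
      ψ (Q d) ⊗ ψ (y * ℓ d)  ∎
      where
      root : ψ (cube y * (b * d)) ≡ ψ (y * cbrt (b * d))
      root = trans (cong (λ u → ψ (cube y * u)) (sym (cube-cbrt (b * d)))) (trans (cong ψ (sym (cube-* y (cbrt (b * d))))) (ψ-cube (y * cbrt (b * d))))

    -- The polar form at (d, d) is 2Q(d) = -Q(d) under the trace, and it vanishes on the radical.
    ψQ-radical : ∀ d → ℓ d ≡ 0# → ψ (Q d) ≡ 𝟙
    ψQ-radical d ℓd≡0 = begin
      ψ (Q d)  ≡⟨ ⊗-identityʳ (ψ (Q d)) ⟨
      ψ (Q d) ⊗ 𝟙  ≡⟨ cong (ψ (Q d) ⊗_) ψ-Q≡𝟙 ⟨
      ψ (Q d) ⊗ ψ (- Q d)  ≡⟨ ψ-+ (Q d) (- Q d) ⟨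
      ψ (Q d - Q d)  ≡⟨ trans (cong ψ (-‿inverseʳ (Q d))) ψ-0 ⟩
      𝟙  ∎
      where
      M : K
      M = cbrt (b * d)
      ψMd : ψ (M * d) ≡ ψ (b * d * cube d)
      ψMd = trans (sym (ψ-cube (M * d))) (cong ψ (trans (cube-* M d) (cong (_* cube d) (cube-cbrt (b * d)))))
      ψ-Q≡𝟙 : ψ (- Q d) ≡ 𝟙
      ψ-Q≡𝟙 = begin
        ψ (- Q d)  ≡⟨ cong ψ (solve 2 (λ b d → :- (b :* (d :* d :* (d :* d) :- d :* d)) := b :* d :* (d :* d :* d) :+ (b :* (d :* d :* d) :+ b :* d) :* d) refl b d) ⟩
        ψ (b * d * cube d + (b * cube d + b * d) * d)  ≡⟨ ψ-+ (b * d * cube d) ((b * cube d + b * d) * d) ⟩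
        ψ (b * d * cube d) ⊗ ψ ((b * cube d + b * d) * d)  ≡⟨ cong (_⊗ ψ ((b * cube d + b * d) * d)) ψMd ⟨
        ψ (M * d) ⊗ ψ ((b * cube d + b * d) * d)  ≡⟨ ψ-+ (M * d) ((b * cube d + b * d) * d) ⟨
        ψ (M * d + (b * cube d + b * d) * d)  ≡⟨ cong ψ (sym (distribʳ d M (b * cube d + b * d))) ⟩
        ψ (ℓ d * d)  ≡⟨ cong ψ (trans (cong (_* d) ℓd≡0) (*-zeroˡ d)) ⟩
        ψ 0#  ≡⟨ ψ-0 ⟩
        𝟙  ∎

    ψQ-δ : ∀ d → ψ (Q d) ⊗ (ι (+ q) ⊗ δ (ℓ d) 0#) ≡ ι (+ q) ⊗ δ (ℓ d) 0#
    ψQ-δ d = cases (ℓ d Fin.≟ 0#)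
      where
      cases : Dec (ℓ d ≡ 0#) → ψ (Q d) ⊗ (ι (+ q) ⊗ δ (ℓ d) 0#) ≡ ι (+ q) ⊗ δ (ℓ d) 0#
      cases (yes p) = trans (cong (_⊗ (ι (+ q) ⊗ δ (ℓ d) 0#)) (ψQ-radical d p)) (⊗-identityˡ _)
      cases (no  p) = trans (cong (ψ (Q d) ⊗_) vanish) (trans (zeroʳ (ψ (Q d))) (sym vanish))
        where
        vanish : ι (+ q) ⊗ δ (ℓ d) 0# ≡ 𝟘
        vanish = trans (cong (ι (+ q) ⊗_) (δ-≢ p)) (zeroʳ (ι (+ q)))

    -- Differencing: the summand for y + d against y is linear in y, so the inner sum is q on the
    -- radical and 0 elsewhere; on the radical the remaining factor ψ(Q d) is 1.
    W⊗conj-W : W b ⊗ conj (W b) ≡ ι (+ q) ⊗ ∑ (λ d → δ (ℓ d) 0#)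
    W⊗conj-W = begin
      W b ⊗ conj (W b)  ≡⟨ cong (W b ⊗_) (trans (conj-sum (λ y → ψ (Q y))) (sum-cong-≗ (λ y → conj-ψ (Q y)))) ⟩
      W b ⊗ ∑ (λ y → ψ (- Q y))  ≡⟨ *-distribˡ-sum (W b) (λ y → ψ (- Q y)) ⟩
      ∑ (λ y → W b ⊗ ψ (- Q y))  ≡⟨ sum-cong-≗ (λ y → cong (_⊗ ψ (- Q y)) (∑-shift (λ d → ψ (Q d)) y)) ⟩
      ∑ (λ y → ∑ (λ d → ψ (Q (d + y))) ⊗ ψ (- Q y))  ≡⟨ sum-cong-≗ (λ y → *-distribʳ-sum (ψ (- Q y)) (λ d → ψ (Q (d + y)))) ⟩
      ∑ (λ y → ∑ (λ d → ψ (Q (d + y)) ⊗ ψ (- Q y)))  ≡⟨ ∑-comm {q} {q} (λ y d → ψ (Q (d + y)) ⊗ ψ (- Q y)) ⟩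
      ∑ (λ d → ∑ (λ y → ψ (Q (d + y)) ⊗ ψ (- Q y)))  ≡⟨ sum-cong-≗ (λ d → sum-cong-≗ (λ y → trans (cong (λ u → ψ (Q u) ⊗ ψ (- Q y)) (+-comm d y)) (Q-difference y d))) ⟩
      ∑ (λ d → ∑ (λ y → ψ (Q d) ⊗ ψ (y * ℓ d)))  ≡⟨ sum-cong-≗ (λ d → sym (*-distribˡ-sum (ψ (Q d)) (λ y → ψ (y * ℓ d)))) ⟩
      ∑ (λ d → ψ (Q d) ⊗ ∑ (λ y → ψ (y * ℓ d)))  ≡⟨ sum-cong-≗ (λ d → trans (cong (ψ (Q d) ⊗_) (orthogonality (ℓ d))) (ψQ-δ d)) ⟩
      ∑ (λ d → ι (+ q) ⊗ δ (ℓ d) 0#)  ≡⟨ *-distribˡ-sum (ι (+ q)) (λ d → δ (ℓ d) 0#) ⟨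
      ι (+ q) ⊗ ∑ (λ d → δ (ℓ d) 0#)  ∎

    norm-W : ∃[ ρ ] (norm (W b) ≡ + q ℤ.* + ρ × ρ ∣ q)
    norm-W = ρ , ι-injective (trans (sym (⊗-conj (W b))) (trans W⊗conj-W (trans (cong (ι (+ q) ⊗_) (proj₁ (proj₂ kernel))) (sym (ι-* (+ q) (+ ρ)))))) , proj₂ (proj₂ kernel)
      where
      kernel : ∃[ ρ ] (∑ (λ x → δ (ℓ x) 0#) ≡ ι (+ ρ) × ρ ∣ q)
      kernel = kernel-∣q ℓ ℓ-+
      ρ : ℕ
      ρ = proj₁ kernel

  -- The outer u has norm 1, so the norm is that of x + ug: a plain square for u = 1, and the same
  -- form x² - xg + g² for both nontrivial cube roots.
  norm-combination : ∀ {u} → CubeRoot u → ∀ x g →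
    norm (u ⊗ (ι x ⊕ u ⊗ ι g)) ≡ x ℤ.* x ℤ.- x ℤ.* g ℤ.+ g ℤ.* g ⊎ norm (u ⊗ (ι x ⊕ u ⊗ ι g)) ≡ (x ℤ.+ g) ℤ.* (x ℤ.+ g)
  norm-combination is𝟙 x g = inj₂ (trans (cong norm (trans (⊗-identityˡ (ι x ⊕ 𝟙 ⊗ ι g)) (cong (ι x ⊕_) (⊗-identityˡ (ι g))))) (eq x g))
    where
    eq : ∀ x g → (x ℤ.+ g) ℤ.* (x ℤ.+ g) ℤ.- (x ℤ.+ g) ℤ.* (0ℤ ℤ.+ 0ℤ) ℤ.+ (0ℤ ℤ.+ 0ℤ) ℤ.* (0ℤ ℤ.+ 0ℤ) ≡ (x ℤ.+ g) ℤ.* (x ℤ.+ g)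
    eq = solve-∀
  norm-combination isζ x g = inj₁ (trans (norm-⊗ ζ (ι x ⊕ ζ ⊗ ι g)) (trans (cong (λ u → 1ℤ ℤ.* norm (ι x ⊕ u)) (trans (⊗-comm ζ (ι g)) (ι-⊗ g ζ))) (eq x g)))
    where
    eq : ∀ x g → 1ℤ ℤ.* ((x ℤ.+ g ℤ.* 0ℤ) ℤ.* (x ℤ.+ g ℤ.* 0ℤ) ℤ.- (x ℤ.+ g ℤ.* 0ℤ) ℤ.* (0ℤ ℤ.+ g ℤ.* 1ℤ) ℤ.+ (0ℤ ℤ.+ g ℤ.* 1ℤ) ℤ.* (0ℤ ℤ.+ g ℤ.* 1ℤ)) ≡ x ℤ.* x ℤ.- x ℤ.* g ℤ.+ g ℤ.* g
    eq = solve-∀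
  norm-combination isζ² x g = inj₁ (trans (norm-⊗ ζ² (ι x ⊕ ζ² ⊗ ι g)) (trans (cong (λ u → 1ℤ ℤ.* norm (ι x ⊕ u)) (trans (⊗-comm ζ² (ι g)) (ι-⊗ g ζ²))) (eq x g)))
    where
    eq : ∀ x g → 1ℤ ℤ.* ((x ℤ.+ g ℤ.* -1ℤ) ℤ.* (x ℤ.+ g ℤ.* -1ℤ) ℤ.- (x ℤ.+ g ℤ.* -1ℤ) ℤ.* (0ℤ ℤ.+ g ℤ.* -1ℤ) ℤ.+ (0ℤ ℤ.+ g ℤ.* -1ℤ) ℤ.* (0ℤ ℤ.+ g ℤ.* -1ℤ)) ≡ x ℤ.* x ℤ.- x ℤ.* g ℤ.+ g ℤ.* g
    eq = solve-∀

  PlusMinus : ℤ → Set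
  PlusMinus g = g ≡ + r ⊎ g ≡ ℤ.- + r

  Gη-value : ∀ {a} → ¬ a ≡ 0# → ∃[ g ] (G ⊗ η a ≡ ι g × PlusMinus g)
  Gη-value {a} a≢0 = combine G-value (η-sign a a≢0)
    where
    combine : ∀ {x y} → x ≡ ι (+ r) ⊎ x ≡ ι (ℤ.- + r) → Sign y → ∃[ g ] (x ⊗ y ≡ ι g × PlusMinus g)
    combine (inj₁ refl) plus  = + r , ⊗-identityʳ _ , inj₁ refl
    combine (inj₂ refl) plus  = ℤ.- + r , ⊗-identityʳ _ , inj₂ refl
    combine (inj₁ refl) minus = ℤ.- + r , trans (⊗-comm (ι (+ r)) (⊖ 𝟙)) (negate (+ r)) , inj₂ refl
      where
      negate : ∀ x → ⊖ 𝟙 ⊗ ι x ≡ ι (ℤ.- x)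
      negate x = trans (sym (ι-* -1ℤ x)) (cong ι (ℤ.-1*i≡-i x))
    combine (inj₂ refl) minus = + r , trans (⊗-comm (ι (ℤ.- + r)) (⊖ 𝟙)) (negate (+ r)) , inj₁ refl
      where
      negate : ∀ x → ⊖ 𝟙 ⊗ ι (ℤ.- x) ≡ ι x
      negate x = trans (sym (ι-* -1ℤ (ℤ.- x))) (cong ι (trans (ℤ.-1*i≡-i (ℤ.- x)) (ℤ.neg-involutive x)))

  X-value : ∀ {b x} → ¬ b ≡ 0# → X b ≡ ι x → Odd x → PlusMinus x
  X-value {b} {x} b≢0 X≡ιx odd = absorb (norm-equation (suc e) (2 ℕ.* suc e) g x ρ g≡±r (≡.subst (ρ ∣_) q≡3^2e ρ∣q) odd equation)
    where
    open QuadraticForm b using (norm-W)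
    g : ℤ
    g = proj₁ (Gη-value b≢0)
    Gη≡ιg : G ⊗ η b ≡ ι g
    Gη≡ιg = proj₁ (proj₂ (Gη-value b≢0))
    g≡±r : PlusMinus g
    g≡±r = proj₂ (proj₂ (Gη-value b≢0))
    ρ : ℕ
    ρ = proj₁ norm-W
    ρ∣q : ρ ∣ q
    ρ∣q = proj₂ (proj₂ norm-W)
    norm≡ : norm (ψ b ⊗ (ι x ⊕ ψ b ⊗ ι g)) ≡ g ℤ.* g ℤ.* + ρ
    norm≡ = trans (cong norm (sym (trans (W≡ b b≢0) (cong₂ (λ u v → ψ b ⊗ (u ⊕ ψ b ⊗ v)) X≡ιx Gη≡ιg))))
      (trans (proj₁ (proj₂ norm-W)) (cong (ℤ._* + ρ) (trans (cong +_ (sym r*r≡q)) (trans (ℤ.pos-* r r) (±-square g≡±r)))))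
    equation : x ℤ.* x ℤ.- x ℤ.* g ℤ.+ g ℤ.* g ≡ g ℤ.* g ℤ.* + ρ ⊎ (x ℤ.+ g) ℤ.* (x ℤ.+ g) ≡ g ℤ.* g ℤ.* + ρ
    equation = [ (λ p → inj₁ (trans (sym p) norm≡)) , (λ p → inj₂ (trans (sym p) norm≡)) ]′ (norm-combination (ψ-root b) x g)
    absorb : x ≡ g ⊎ x ≡ ℤ.- g → PlusMinus x
    absorb (inj₁ p) = [ (λ p′ → inj₁ (trans p p′)) , (λ p′ → inj₂ (trans p p′)) ]′ g≡±r
    absorb (inj₂ p) = [ (λ p′ → inj₂ (trans p (cong ℤ.-_ p′))) , (λ p′ → inj₁ (trans p (trans (cong ℤ.-_ p′) (ℤ.neg-involutive (+ r))))) ]′ g≡±r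

  -- Sums of κ over the values of a cubic

  κ-sum : (K → K) → K → ℤ[ζ]
  κ-sum g k = ∑ (λ s → κ (k * g s))

  -- The dependence on the scalar k is recorded, not only the value ±√q. Lines that share a cubic
  -- differ in k, and this formula compares their signs when both intersection numbers have to be
  -- exhibited.
  Twisted : (K → K) → Set
  Twisted g = ∃[ ε ] ∃[ m ] (PlusMinus ε × ¬ m ≡ 0# × (∀ k → ¬ k ≡ 0# → κ-sum g k ≡ ι ε ⊗ κ (k * m)))

  -- Without roots of g no term vanishes, so this is a sum of q signs with q odd.
  κ-sum-odd : ∀ g k → ¬ k ≡ 0# → (∀ s → ¬ g s ≡ 0#) → ∃[ t ] (κ-sum g k ≡ ι t × Odd t)
  κ-sum-odd g k k≢0 g≢0 = _ , ∑-signs (λ s → κ (k * g s)) (λ s → κ-sign (k * g s) (*-≉0 k≢0 (g≢0 s))) (λ s → s)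
    , ≡.subst (λ n → Odd (+ 2 ℤ.* c ℤ.- + n)) (sym q≡1+8h) (2c-q-odd c h)
    where
    c : ℤ
    c = + length (filter (λ s → κ (k * g s) ≟ 𝟙) (tabulate (λ s → s)))

  κ-0 : ∀ {x} → x ≡ 0# → κ x ≡ 𝟘
  κ-0 x≡0 = trans (cong κ x≡0) (cong₂ _⊕_ α-0 β-0)

  κ′-0 : ∀ {x} → x ≡ 0# → κ′ x ≡ 𝟘
  κ′-0 x≡0 = trans (cong κ′ x≡0) (cong₂ (λ a b → a ⊕ ⊖ b) α-0 β-0)

  κ-sum-transform : ∀ g {k} → ¬ k ≡ 0# → γ ⊗ κ-sum g k ≡ ∑ (λ u → κ′ (u * k ⁻¹) ⊗ ∑ (λ s → ψ (u * g s)))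
  κ-sum-transform g {k} k≢0 = begin
    γ ⊗ κ-sum g k  ≡⟨ *-distribˡ-sum γ (λ s → κ (k * g s)) ⟩
    ∑ (λ s → γ ⊗ κ (k * g s))  ≡⟨ sum-cong-≗ (λ s → sym (κ′-transform (k * g s))) ⟩
    ∑ (λ s → ∑ (λ u → κ′ u ⊗ ψ (u * (k * g s))))  ≡⟨ ∑-comm {q} {q} (λ s u → κ′ u ⊗ ψ (u * (k * g s))) ⟩
    ∑ (λ u → ∑ (λ s → κ′ u ⊗ ψ (u * (k * g s))))  ≡⟨ ∑-scale (λ u → ∑ (λ s → κ′ u ⊗ ψ (u * (k * g s)))) (⁻¹-≉0 k≢0) ⟩
    ∑ (λ u → ∑ (λ s → κ′ (u * k ⁻¹) ⊗ ψ ((u * k ⁻¹) * (k * g s))))  ≡⟨ sum-cong-≗ (λ u → sum-cong-≗ (λ s → cong (λ v → κ′ (u * k ⁻¹) ⊗ ψ v) (cancel u s))) ⟩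
    ∑ (λ u → ∑ (λ s → κ′ (u * k ⁻¹) ⊗ ψ (u * g s)))  ≡⟨ sum-cong-≗ (λ u → sym (*-distribˡ-sum (κ′ (u * k ⁻¹)) (λ s → ψ (u * g s)))) ⟩
    ∑ (λ u → κ′ (u * k ⁻¹) ⊗ ∑ (λ s → ψ (u * g s)))  ∎
    where
    cancel : ∀ u s → (u * k ⁻¹) * (k * g s) ≡ u * g s
    cancel u s = trans (solve 4 (λ u l k t → (u :* l) :* (k :* t) := (l :* k) :* (u :* t)) refl u (k ⁻¹) k (g s)) (trans (cong (_* (u * g s)) (inverseˡ k≢0)) (*-identityˡ (u * g s)))

  ±-ratio : ∀ {g₀ g} → PlusMinus g₀ → PlusMinus g → ∃[ σ ] ((σ ≡ 1ℤ ⊎ σ ≡ -1ℤ) × g ≡ g₀ ℤ.* σ)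
  ±-ratio (inj₁ refl) (inj₁ refl) = 1ℤ , inj₁ refl , sym (ℤ.*-identityʳ (+ r))
  ±-ratio (inj₁ refl) (inj₂ refl) = -1ℤ , inj₂ refl , sym (trans (ℤ.*-comm (+ r) -1ℤ) (ℤ.-1*i≡-i (+ r)))
  ±-ratio (inj₂ refl) (inj₁ refl) = -1ℤ , inj₂ refl , sym (trans (ℤ.*-comm (ℤ.- + r) -1ℤ) (trans (ℤ.-1*i≡-i (ℤ.- + r)) (ℤ.neg-involutive (+ r))))
  ±-ratio (inj₂ refl) (inj₂ refl) = 1ℤ , inj₁ refl , sym (ℤ.*-identityʳ (ℤ.- + r))

  ±≢0 : ∀ {g} → PlusMinus g → ¬ g ≡ 0ℤ
  ±≢0 (inj₁ refl) eq = r≢0 eq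
  ±≢0 (inj₂ refl) eq = r≢0 (trans (sym (ℤ.neg-involutive (+ r))) (cong ℤ.-_ eq))

  ±-negate : ∀ {g} → PlusMinus g → PlusMinus (ℤ.- g)
  ±-negate (inj₁ refl) = inj₂ refl
  ±-negate (inj₂ refl) = inj₁ (ℤ.neg-involutive (+ r))

  opaque
    γ≡ι : ∃[ g ] (γ ≡ ι g × PlusMinus g)
    γ≡ι = [ (λ p → + r , p , inj₁ refl) , (λ p → ℤ.- + r , p , inj₂ refl) ]′ γ-value

  Odd-neg : ∀ {t} → Odd t → Odd (ℤ.- t)
  Odd-neg {t} odd (j , eq) = odd (ℤ.- j , trans (sym (ℤ.neg-involutive t)) (trans (cong ℤ.-_ eq) (ℤ.neg-distribʳ-* (+ 2) j)))

  signed : ∀ {A s t} → Sign s → A ⊗ s ≡ ι t → Odd t → ∃[ x ] (A ≡ ι x × Odd x)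
  signed {A} {t = t} plus  eq odd = t , trans (sym (⊗-identityʳ A)) eq , odd
  signed {A} {t = t} minus eq odd = ℤ.- t , trans (solveᶻ 1 (λ a → a :≡ :⊖ (a :⊗ conᶻ (⊖ 𝟙))) refl A) (cong ⊖_ eq) , Odd-neg odd
    where open ℤ[ζ]-Solver

  -- The cubic s³ + cs² + n with c ≠ 0.

  module NonzeroQuadraticTerm (c n Δ : K) (c≢0 : ¬ c ≡ 0#) (Δ²≡ : Δ * Δ ≡ - (cube c * n)) (g≢0 : ∀ s → ¬ cube s + c * (s * s) + n ≡ 0#) where

    -- The linear term has been shifted away. The discriminant -4c³n - 27n² of this cubic is -c³n in
    -- characteristic 3, which is the hypothesis on Δ.
    g : K → K
    g s = cube s + c * (s * s) + n

    c³≢0 : ¬ cube c ≡ 0#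
    c³≢0 = *-≉0 (*-≉0 c≢0 c≢0) c≢0

    Δ≢0 : ¬ Δ ≡ 0#
    Δ≢0 Δ≡0 = [ c³≢0 , (λ n≡0 → g≢0 0# (trans (cong (λ n → cube 0# + c * (0# * 0#) + n) n≡0) (solve 1 (λ c → con 0₃ :* con 0₃ :* con 0₃ :+ c :* (con 0₃ :* con 0₃) :+ con 0₃ := con 0₃) refl c))) ]′
      (zero-product (trans (solve 1 (λ x → x := :- (:- x)) refl (cube c * n)) (trans (cong -_ (trans (sym Δ²≡) (trans (cong (_* Δ) Δ≡0) (*-zeroˡ Δ)))) (solve 0 (:- con 0₃ := con 0₃) refl))))

    -- For u = v³ the cubic term becomes ψ(vs), and vs + v³cs² remains. The shift p = 1/(v²c)
    -- completes the square (-1/2 = 1) and leaves the constant -vp = -1/(vc); cubing it inside ψ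
    -- expresses the result in u alone.
    exponential-sum-cube : ∀ v → ¬ v ≡ 0# → ∑ (λ s → ψ (cube v * g s)) ≡ G ⊗ (η (cube v) ⊗ η c) ⊗ ψ (cube v * n - (cube v * cube c) ⁻¹)
    exponential-sum-cube v v≢0 = begin
      ∑ (λ s → ψ (cube v * g s))  ≡⟨ sum-cong-≗ split ⟩
      ∑ (λ s → ψ (cube v * n) ⊗ f s)  ≡⟨ *-distribˡ-sum (ψ (cube v * n)) f ⟨
      ψ (cube v * n) ⊗ ∑ f  ≡⟨ cong (ψ (cube v * n) ⊗_) (trans (∑-shift f p) (sum-cong-≗ complete-square)) ⟩
      ψ (cube v * n) ⊗ ∑ (λ s → ψ ((s * s) * (cube v * c)) ⊗ ψ (- (v * p)))  ≡⟨ cong (ψ (cube v * n) ⊗_) (sym (*-distribʳ-sum (ψ (- (v * p))) (λ s → ψ ((s * s) * (cube v * c))))) ⟩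
      ψ (cube v * n) ⊗ (∑ (λ s → ψ ((s * s) * (cube v * c))) ⊗ ψ (- (v * p)))  ≡⟨ cong₂ (λ a b → ψ (cube v * n) ⊗ (a ⊗ b)) (trans (quadratic-sum (*-≉0 v³≢0 c≢0)) (cong (G ⊗_) (η-* (cube v) c))) ψ-vp ⟩
      ψ (cube v * n) ⊗ (G ⊗ (η (cube v) ⊗ η c) ⊗ ψ (- ((cube v * cube c) ⁻¹)))  ≡⟨ solveᶻ 3 (λ a b c → a :⊗ (b :⊗ c) :≡ b :⊗ (a :⊗ c)) refl (ψ (cube v * n)) (G ⊗ (η (cube v) ⊗ η c)) (ψ (- ((cube v * cube c) ⁻¹))) ⟩
      G ⊗ (η (cube v) ⊗ η c) ⊗ (ψ (cube v * n) ⊗ ψ (- ((cube v * cube c) ⁻¹)))  ≡⟨ cong (G ⊗ (η (cube v) ⊗ η c) ⊗_) (sym (ψ-+ (cube v * n) (- ((cube v * cube c) ⁻¹)))) ⟩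
      G ⊗ (η (cube v) ⊗ η c) ⊗ ψ (cube v * n - (cube v * cube c) ⁻¹)  ∎
      where
      open ℤ[ζ]-Solver
      p : K
      p = (v * v * c) ⁻¹
      v³≢0 : ¬ cube v ≡ 0#
      v³≢0 = *-≉0 (*-≉0 v≢0 v≢0) v≢0
      E : K
      E = (v * v * c) * p
      E≡1 : E ≡ 1#
      E≡1 = inverseʳ (*-≉0 (*-≉0 v≢0 v≢0) c≢0)
      f : K → ℤ[ζ]
      f s = ψ (v * s + cube v * c * (s * s))
      split : ∀ s → ψ (cube v * g s) ≡ ψ (cube v * n) ⊗ f s
      split s = begin
        ψ (cube v * g s)  ≡⟨ cong ψ (solve 4 (λ v s c n → (v :* v :* v) :* (s :* s :* s :+ c :* (s :* s) :+ n) := (v :* v :* v) :* n :+ ((v :* s) :* (v :* s) :* (v :* s) :+ (v :* v :* v) :* c :* (s :* s))) refl v s c n) ⟩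
        ψ (cube v * n + (cube (v * s) + cube v * c * (s * s)))  ≡⟨ trans (ψ-+ (cube v * n) _) (cong (ψ (cube v * n) ⊗_) (ψ-+ (cube (v * s)) (cube v * c * (s * s)))) ⟩
        ψ (cube v * n) ⊗ (ψ (cube (v * s)) ⊗ ψ (cube v * c * (s * s)))  ≡⟨ cong (λ u → ψ (cube v * n) ⊗ (u ⊗ ψ (cube v * c * (s * s)))) (ψ-cube (v * s)) ⟩
        ψ (cube v * n) ⊗ (ψ (v * s) ⊗ ψ (cube v * c * (s * s)))  ≡⟨ cong (ψ (cube v * n) ⊗_) (sym (ψ-+ (v * s) (cube v * c * (s * s)))) ⟩
        ψ (cube v * n) ⊗ f s  ∎
      complete-square : ∀ s → f (s + p) ≡ ψ ((s * s) * (cube v * c)) ⊗ ψ (- (v * p))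
      complete-square s = trans (cong ψ (begin
        v * (s + p) + cube v * c * ((s + p) * (s + p))  ≡⟨ solve 4 (λ v s p c → v :* (s :+ p) :+ (v :* v :* v) :* c :* ((s :+ p) :* (s :+ p)) :=
            (v :* s :+ v :* p :+ (s :* s) :* ((v :* v :* v) :* c)) :+ (v :* p :- v :* s) :* ((v :* v :* c) :* p)) refl v s p c ⟩
        (v * s + v * p + (s * s) * (cube v * c)) + (v * p - v * s) * E  ≡⟨ cong (λ u → (v * s + v * p + (s * s) * (cube v * c)) + (v * p - v * s) * u) E≡1 ⟩
        (v * s + v * p + (s * s) * (cube v * c)) + (v * p - v * s) * 1#  ≡⟨ solve 4 (λ v s p t → (v :* s :+ v :* p :+ t) :+ (v :* p :- v :* s) :* con 1₃ := t :- v :* p) refl v s p ((s * s) * (cube v * c)) ⟩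
        (s * s) * (cube v * c) - v * p  ∎)) (ψ-+ ((s * s) * (cube v * c)) (- (v * p)))
      ψ-vp : ψ (- (v * p)) ≡ ψ (- ((cube v * cube c) ⁻¹))
      ψ-vp = trans (sym (ψ-cube (- (v * p)))) (cong ψ (trans (solve 1 (λ x → (:- x) :* (:- x) :* (:- x) := :- (x :* x :* x)) refl (v * p)) (cong -_ (sym (⁻¹-unique inverse-cube)))))
        where
        inverse-cube : (cube v * cube c) * cube (v * p) ≡ 1#
        inverse-cube = trans (solve 3 (λ v c p → ((v :* v :* v) :* (c :* c :* c)) :* ((v :* p) :* (v :* p) :* (v :* p)) := ((v :* v :* c) :* p) :* ((v :* v :* c) :* p) :* ((v :* v :* c) :* p)) refl v c p)
          (trans (cong cube E≡1) (solve 0 (con 1₃ :* con 1₃ :* con 1₃ := con 1₃) refl))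

    phase : K → K
    phase u = u * n - (u * cube c) ⁻¹

    exponential-sum : ∀ u → ¬ u ≡ 0# → ∑ (λ s → ψ (u * g s)) ≡ G ⊗ (η u ⊗ η c) ⊗ ψ (phase u)
    exponential-sum u u≢0 = ≡.subst (λ u → ∑ (λ s → ψ (u * g s)) ≡ G ⊗ (η u ⊗ η c) ⊗ ψ (phase u)) (cube-cbrt u)
      (exponential-sum-cube (cbrt u) (λ v≡0 → u≢0 (trans (sym (cube-cbrt u)) (trans (cong cube v≡0) (solve 0 (con 0₃ :* con 0₃ :* con 0₃ := con 0₃) refl)))))

    b : K
    b = - (Δ * (cube c) ⁻¹)

    b≢0 : ¬ b ≡ 0#
    b≢0 = -‿≉0 (*-≉0 Δ≢0 (⁻¹-≉0 c³≢0))

    -- The square discriminant is used here. Putting u = t/Δ, the first coefficient is n/Δ = -Δ/c³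
    -- because Δ² = -c³n, and the second is -Δ/c³ by inspection; both equal b.
    phase-substitution : ∀ t → ¬ t ≡ 0# → phase (t * Δ ⁻¹) ≡ b * (t + t ⁻¹)
    phase-substitution t t≢0 = trans (cong₂ _-_ linear (⁻¹-unique reciprocal)) (solve 3 (λ t y d → (:- (t :* d)) :- (y :* d) := (:- d) :* (t :+ y)) refl t (t ⁻¹) (Δ * C))
      where
      C D : K
      C = (cube c) ⁻¹
      D = Δ ⁻¹
      n≡ : n ≡ - (Δ * Δ * C)
      n≡ = begin
        n  ≡⟨ *-identityˡ n ⟨
        1# * n  ≡⟨ cong (_* n) (inverseˡ c³≢0) ⟨
        C * cube c * n  ≡⟨ solve 3 (λ C x n → C :* x :* n := :- ((:- (x :* n)) :* C)) refl C (cube c) n ⟩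
        - (- (cube c * n) * C)  ≡⟨ cong (λ u → - (u * C)) Δ²≡ ⟨
        - (Δ * Δ * C)  ∎
      linear : (t * D) * n ≡ - (t * (Δ * C))
      linear = trans (cong ((t * D) *_) n≡) (trans (solve 4 (λ t D d C → (t :* D) :* (:- (d :* d :* C)) := :- ((d :* D) :* (t :* (d :* C)))) refl t D Δ C)
        (cong -_ (trans (cong (_* (t * (Δ * C))) (inverseʳ Δ≢0)) (*-identityˡ (t * (Δ * C))))))
      reciprocal : ((t * D) * cube c) * (t ⁻¹ * (Δ * C)) ≡ 1#
      reciprocal = trans (solve 6 (λ t D x y d C → ((t :* D) :* x) :* (y :* (d :* C)) := (t :* y) :* (d :* D) :* (x :* C)) refl t D (cube c) (t ⁻¹) Δ C)
        (trans (cong₂ _*_ (cong₂ _*_ (inverseʳ t≢0) (inverseʳ Δ≢0)) (inverseʳ c³≢0)) (solve 0 (con 1₃ :* con 1₃ :* con 1₃ := con 1₃) refl))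

    ∑β≡𝟘′ : ∑ (λ t → β t ⊗ ψ (b * (t + t ⁻¹))) ≡ 𝟘
    ∑β≡𝟘′ = double≡𝟘 (trans (∑-invert (λ t → β t ⊗ ψ (b * (t + t ⁻¹)))) (trans (sum-cong-≗ (λ t → trans (cong₂ (λ a x → a ⊗ ψ (b * x)) (proj₂ (χ-⁻¹ t)) (trans (cong (λ x → t ⁻¹ + x) (⁻¹-involutive t)) (+-comm (t ⁻¹) t)))
      (solveᶻ 2 (λ a p → (:⊖ a) :⊗ p :≡ :⊖ (a :⊗ p)) refl (β t) (ψ (b * (t + t ⁻¹)))))) (∑-⊖ (λ t → β t ⊗ ψ (b * (t + t ⁻¹))))))
      where open ℤ[ζ]-Solver

    κ-phase-sum : ∀ {k} → ¬ k ≡ 0# → ∑ (λ u → κ (u * k ⁻¹) ⊗ ψ (phase u)) ≡ X b ⊗ κ′ (k * Δ)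
    κ-phase-sum {k} k≢0 = begin
      ∑ (λ u → κ (u * k ⁻¹) ⊗ ψ (phase u))  ≡⟨ ∑-scale (λ u → κ (u * k ⁻¹) ⊗ ψ (phase u)) (⁻¹-≉0 Δ≢0) ⟩
      ∑ (λ t → κ ((t * Δ ⁻¹) * k ⁻¹) ⊗ ψ (phase (t * Δ ⁻¹)))  ≡⟨ sum-cong-≗ (λ t → term t (t Fin.≟ 0#)) ⟩
      ∑ (λ t → κ (t * (k * Δ) ⁻¹) ⊗ ψ (b * (t + t ⁻¹)))  ≡⟨ sum-cong-≗ (λ t → trans (cong (_⊗ ψ (b * (t + t ⁻¹))) (κ-/ t (k * Δ)))
           (solveᶻ 5 (λ a b k k′ p → (a :⊗ k′ :⊕ b :⊗ k) :⊗ p :≡ k′ :⊗ (a :⊗ p) :⊕ k :⊗ (b :⊗ p)) refl (α t) (β t) (κ (k * Δ)) (κ′ (k * Δ)) (ψ (b * (t + t ⁻¹))))) ⟩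
      ∑ (λ t → κ′ (k * Δ) ⊗ (α t ⊗ ψ (b * (t + t ⁻¹))) ⊕ κ (k * Δ) ⊗ (β t ⊗ ψ (b * (t + t ⁻¹))))  ≡⟨ ∑-linear (κ′ (k * Δ)) (κ (k * Δ)) (λ t → α t ⊗ ψ (b * (t + t ⁻¹))) (λ t → β t ⊗ ψ (b * (t + t ⁻¹))) ⟩
      κ′ (k * Δ) ⊗ X b ⊕ κ (k * Δ) ⊗ ∑ (λ t → β t ⊗ ψ (b * (t + t ⁻¹)))  ≡⟨ cong (λ s → κ′ (k * Δ) ⊗ X b ⊕ κ (k * Δ) ⊗ s) ∑β≡𝟘′ ⟩
      κ′ (k * Δ) ⊗ X b ⊕ κ (k * Δ) ⊗ 𝟘  ≡⟨ solveᶻ 3 (λ a x k → a :⊗ x :⊕ k :⊗ conᶻ 𝟘 :≡ x :⊗ a) refl (κ′ (k * Δ)) (X b) (κ (k * Δ)) ⟩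
      X b ⊗ κ′ (k * Δ)  ∎
      where
      open ℤ[ζ]-Solver
      inverse-product : (k * Δ) ⁻¹ ≡ Δ ⁻¹ * k ⁻¹
      inverse-product = ⁻¹-unique (trans (solve 4 (λ k d D l → (k :* d) :* (D :* l) := (k :* l) :* (d :* D)) refl k Δ (Δ ⁻¹) (k ⁻¹)) (trans (cong₂ _*_ (inverseʳ k≢0) (inverseʳ Δ≢0)) (*-identityˡ 1#)))
      argument : ∀ t → (t * Δ ⁻¹) * k ⁻¹ ≡ t * (k * Δ) ⁻¹
      argument t = trans (*-assoc t (Δ ⁻¹) (k ⁻¹)) (cong (t *_) (sym inverse-product))
      term : ∀ t → Dec (t ≡ 0#) → κ ((t * Δ ⁻¹) * k ⁻¹) ⊗ ψ (phase (t * Δ ⁻¹)) ≡ κ (t * (k * Δ) ⁻¹) ⊗ ψ (b * (t + t ⁻¹))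
      term t (no t≢0) = cong₂ (λ a x → κ a ⊗ ψ x) (argument t) (phase-substitution t t≢0)
      term t (yes t≡0) = trans (cong (λ a → κ a ⊗ ψ (phase (t * Δ ⁻¹))) (argument t)) (trans (vanish (ψ (phase (t * Δ ⁻¹)))) (sym (vanish (ψ (b * (t + t ⁻¹))))))
        where
        vanish : ∀ p → κ (t * (k * Δ) ⁻¹) ⊗ p ≡ 𝟘
        vanish p = trans (cong (_⊗ p) (κ-0 (trans (cong (_* (k * Δ) ⁻¹) t≡0) (*-zeroˡ ((k * Δ) ⁻¹))))) (zeroˡ p)

    -- The quadratic Gauss sum over s contributes η(u), which turns κ′(u/k) into κ(u/k)η(k) by
    -- χ²·conj(χ) = χ. The same identity at kΔ turns κ′ back into κ and collects the signs in η(cΔ).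
    γ-κ-sum : ∀ k → ¬ k ≡ 0# → γ ⊗ κ-sum g k ≡ (G ⊗ η (c * Δ)) ⊗ (X b ⊗ κ (k * Δ))
    γ-κ-sum k k≢0 = begin
      γ ⊗ κ-sum g k  ≡⟨ κ-sum-transform g k≢0 ⟩
      ∑ (λ u → κ′ (u * k ⁻¹) ⊗ ∑ (λ s → ψ (u * g s)))  ≡⟨ sum-cong-≗ (λ u → term u (u Fin.≟ 0#)) ⟩
      ∑ (λ u → (G ⊗ (η c ⊗ η k)) ⊗ (κ (u * k ⁻¹) ⊗ ψ (phase u)))  ≡⟨ *-distribˡ-sum (G ⊗ (η c ⊗ η k)) (λ u → κ (u * k ⁻¹) ⊗ ψ (phase u)) ⟨
      (G ⊗ (η c ⊗ η k)) ⊗ ∑ (λ u → κ (u * k ⁻¹) ⊗ ψ (phase u))  ≡⟨ cong ((G ⊗ (η c ⊗ η k)) ⊗_) (κ-phase-sum k≢0) ⟩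
      (G ⊗ (η c ⊗ η k)) ⊗ (X b ⊗ κ′ (k * Δ))  ≡⟨ solveᶻ 5 (λ G c k x y → (G :⊗ (c :⊗ k)) :⊗ (x :⊗ y) :≡ (G :⊗ c) :⊗ (x :⊗ (y :⊗ k))) refl G (η c) (η k) (X b) (κ′ (k * Δ)) ⟩
      (G ⊗ η c) ⊗ (X b ⊗ (κ′ (k * Δ) ⊗ η k))  ≡⟨ cong (λ u → (G ⊗ η c) ⊗ (X b ⊗ u)) exchange ⟩
      (G ⊗ η c) ⊗ (X b ⊗ (κ (k * Δ) ⊗ η Δ))  ≡⟨ solveᶻ 5 (λ G c d x y → (G :⊗ c) :⊗ (x :⊗ (y :⊗ d)) :≡ (G :⊗ (c :⊗ d)) :⊗ (x :⊗ y)) refl G (η c) (η Δ) (X b) (κ (k * Δ)) ⟩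
      (G ⊗ (η c ⊗ η Δ)) ⊗ (X b ⊗ κ (k * Δ))  ≡⟨ cong (λ u → (G ⊗ u) ⊗ (X b ⊗ κ (k * Δ))) (sym (η-* c Δ)) ⟩
      (G ⊗ η (c * Δ)) ⊗ (X b ⊗ κ (k * Δ))  ∎
      where
      open ℤ[ζ]-Solver
      exchange : κ′ (k * Δ) ⊗ η k ≡ κ (k * Δ) ⊗ η Δ
      exchange = begin
        κ′ (k * Δ) ⊗ η k  ≡⟨ ⊗-identityʳ _ ⟨
        κ′ (k * Δ) ⊗ η k ⊗ 𝟙  ≡⟨ cong (κ′ (k * Δ) ⊗ η k ⊗_) (η-unit Δ≢0) ⟨
        κ′ (k * Δ) ⊗ η k ⊗ (η Δ ⊗ η Δ)  ≡⟨ solveᶻ 3 (λ y k d → y :⊗ k :⊗ (d :⊗ d) :≡ y :⊗ (k :⊗ d) :⊗ d) refl (κ′ (k * Δ)) (η k) (η Δ) ⟩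
        κ′ (k * Δ) ⊗ (η k ⊗ η Δ) ⊗ η Δ  ≡⟨ cong (λ u → κ′ (k * Δ) ⊗ u ⊗ η Δ) (η-* k Δ) ⟨
        κ′ (k * Δ) ⊗ η (k * Δ) ⊗ η Δ  ≡⟨ cong (_⊗ η Δ) (κ′η≡κ (k * Δ)) ⟩
        κ (k * Δ) ⊗ η Δ  ∎
      untwist : ∀ u → κ′ (u * k ⁻¹) ⊗ η u ≡ κ (u * k ⁻¹) ⊗ η k
      untwist u = begin
        κ′ (u * k ⁻¹) ⊗ η u  ≡⟨ cong (λ v → κ′ (u * k ⁻¹) ⊗ η v) (sym (trans (*-assoc u (k ⁻¹) k) (trans (cong (u *_) (inverseˡ k≢0)) (*-identityʳ u)))) ⟩
        κ′ (u * k ⁻¹) ⊗ η (u * k ⁻¹ * k)  ≡⟨ cong (κ′ (u * k ⁻¹) ⊗_) (η-* (u * k ⁻¹) k) ⟩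
        κ′ (u * k ⁻¹) ⊗ (η (u * k ⁻¹) ⊗ η k)  ≡⟨ ⊗-assoc (κ′ (u * k ⁻¹)) (η (u * k ⁻¹)) (η k) ⟨
        κ′ (u * k ⁻¹) ⊗ η (u * k ⁻¹) ⊗ η k  ≡⟨ cong (_⊗ η k) (κ′η≡κ (u * k ⁻¹)) ⟩
        κ (u * k ⁻¹) ⊗ η k  ∎
      term : ∀ u → Dec (u ≡ 0#) → κ′ (u * k ⁻¹) ⊗ ∑ (λ s → ψ (u * g s)) ≡ (G ⊗ (η c ⊗ η k)) ⊗ (κ (u * k ⁻¹) ⊗ ψ (phase u))
      term u (no u≢0) = begin
        κ′ (u * k ⁻¹) ⊗ ∑ (λ s → ψ (u * g s))  ≡⟨ cong (κ′ (u * k ⁻¹) ⊗_) (exponential-sum u u≢0) ⟩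
        κ′ (u * k ⁻¹) ⊗ (G ⊗ (η u ⊗ η c) ⊗ ψ (phase u))  ≡⟨ solveᶻ 5 (λ a G u c p → a :⊗ (G :⊗ (u :⊗ c) :⊗ p) :≡ (G :⊗ c) :⊗ ((a :⊗ u) :⊗ p)) refl (κ′ (u * k ⁻¹)) G (η u) (η c) (ψ (phase u)) ⟩
        (G ⊗ η c) ⊗ ((κ′ (u * k ⁻¹) ⊗ η u) ⊗ ψ (phase u))  ≡⟨ cong (λ v → (G ⊗ η c) ⊗ (v ⊗ ψ (phase u))) (untwist u) ⟩
        (G ⊗ η c) ⊗ ((κ (u * k ⁻¹) ⊗ η k) ⊗ ψ (phase u))  ≡⟨ solveᶻ 5 (λ G c a k p → (G :⊗ c) :⊗ ((a :⊗ k) :⊗ p) :≡ (G :⊗ (c :⊗ k)) :⊗ (a :⊗ p)) refl G (η c) (κ (u * k ⁻¹)) (η k) (ψ (phase u)) ⟩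
        (G ⊗ (η c ⊗ η k)) ⊗ (κ (u * k ⁻¹) ⊗ ψ (phase u))  ∎
      term u (yes u≡0) = trans (trans (cong (_⊗ ∑ (λ s → ψ (u * g s))) (κ′-0 u/k≡0)) (zeroˡ (∑ (λ s → ψ (u * g s)))))
        (sym (trans (cong (λ a → (G ⊗ (η c ⊗ η k)) ⊗ (a ⊗ ψ (phase u))) (κ-0 u/k≡0)) (trans (cong ((G ⊗ (η c ⊗ η k)) ⊗_) (zeroˡ (ψ (phase u)))) (zeroʳ (G ⊗ (η c ⊗ η k))))))
        where
        u/k≡0 : u * k ⁻¹ ≡ 0#
        u/k≡0 = trans (cong (_* k ⁻¹) u≡0) (*-zeroˡ (k ⁻¹))

    twisted : Twisted g
    twisted = σ ℤ.* x , Δ , signed-± σ± x± , Δ≢0 , λ k k≢0 → trans (κ-sum≡ k k≢0) (trans (cong (λ y → ι σ ⊗ (y ⊗ κ (k * Δ))) X≡ιx) (trans (sym (⊗-assoc (ι σ) (ι x) (κ (k * Δ)))) (cong (_⊗ κ (k * Δ)) (sym (ι-* σ x)))))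
      where
      g₀ g₁ : ℤ
      g₀ = proj₁ γ≡ι
      g₁ = proj₁ (Gη-value (*-≉0 c≢0 Δ≢0))
      balance : ∀ k → ¬ k ≡ 0# → ι g₀ ⊗ κ-sum g k ≡ ι g₁ ⊗ (X b ⊗ κ (k * Δ))
      balance k k≢0 = trans (cong (_⊗ κ-sum g k) (sym (proj₁ (proj₂ γ≡ι)))) (trans (γ-κ-sum k k≢0) (cong (_⊗ (X b ⊗ κ (k * Δ))) (proj₁ (proj₂ (Gη-value (*-≉0 c≢0 Δ≢0))))))
      ratio : ∃[ σ ] ((σ ≡ 1ℤ ⊎ σ ≡ -1ℤ) × g₁ ≡ g₀ ℤ.* σ)
      ratio = ±-ratio (proj₂ (proj₂ γ≡ι)) (proj₂ (proj₂ (Gη-value (*-≉0 c≢0 Δ≢0))))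
      σ : ℤ
      σ = proj₁ ratio
      σ± : σ ≡ 1ℤ ⊎ σ ≡ -1ℤ
      σ± = proj₁ (proj₂ ratio)
      κ-sum≡ : ∀ k → ¬ k ≡ 0# → κ-sum g k ≡ ι σ ⊗ (X b ⊗ κ (k * Δ))
      κ-sum≡ k k≢0 = ι-cancel g₀ (±≢0 (proj₂ (proj₂ γ≡ι))) (trans (balance k k≢0) (trans (cong (_⊗ (X b ⊗ κ (k * Δ))) (trans (cong ι (proj₂ (proj₂ ratio))) (ι-* g₀ σ))) (⊗-assoc (ι g₀) (ι σ) (X b ⊗ κ (k * Δ)))))
      -- The case k = 1 identifies X, up to two signs, with a sum of q signs. This is the only
      -- source for X being an odd integer, as `X-value` requires.
      total : ∃[ t ] (κ-sum g 1# ≡ ι t × Odd t)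
      total = κ-sum-odd g 1# 1≢0 g≢0
      σ-sign : ∀ {σ} → σ ≡ 1ℤ ⊎ σ ≡ -1ℤ → Sign (ι σ)
      σ-sign (inj₁ refl) = plus
      σ-sign (inj₂ refl) = minus
      integral : ∃[ x ] (X b ≡ ι x × Odd x)
      integral = signed (Sign-⊗ (κ-sign (1# * Δ) (*-≉0 1≢0 Δ≢0)) (σ-sign σ±)) (trans (solveᶻ 3 (λ x k s → x :⊗ (k :⊗ s) :≡ s :⊗ (x :⊗ k)) refl (X b) (κ (1# * Δ)) (ι σ)) (trans (sym (κ-sum≡ 1# 1≢0)) (proj₁ (proj₂ total)))) (proj₂ (proj₂ total))
        where open ℤ[ζ]-Solver
      x : ℤ
      x = proj₁ integral
      X≡ιx : X b ≡ ι x
      X≡ιx = proj₁ (proj₂ integral)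
      x± : PlusMinus x
      x± = X-value b≢0 X≡ιx (proj₂ (proj₂ integral))
      signed-± : ∀ {σ x} → σ ≡ 1ℤ ⊎ σ ≡ -1ℤ → PlusMinus x → PlusMinus (σ ℤ.* x)
      signed-± {x = x} (inj₁ refl) p = ≡.subst PlusMinus (sym (ℤ.*-identityˡ x)) p
      signed-± {x = x} (inj₂ refl) p = ≡.subst PlusMinus (sym (ℤ.-1*i≡-i x)) (±-negate p)

  -- The cubic s³ + ds + n.

  module NoQuadraticTerm (d n Δ : K) (Δ²≡ : Δ * Δ ≡ - cube d) (g≢0 : ∀ s → ¬ cube s + d * s + n ≡ 0#) where

    g : K → K
    g s = cube s + d * s + n

    d≢0 : ¬ d ≡ 0#
    d≢0 d≡0 = g≢0 (cbrt (- n)) (trans (cong₂ (λ u v → u + v * cbrt (- n) + n) (cube-cbrt (- n)) d≡0) (solve 2 (λ n s → (:- n) :+ con 0₃ :* s :+ n := con 0₃) refl n (cbrt (- n))))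

    Δ≢0 : ¬ Δ ≡ 0#
    Δ≢0 Δ≡0 = *-≉0 (*-≉0 d≢0 d≢0) d≢0 (trans (solve 1 (λ x → x := :- (:- x)) refl (cube d)) (trans (cong -_ (trans (sym Δ²≡) (trans (cong (_* Δ) Δ≡0) (*-zeroˡ Δ)))) (solve 0 (:- con 0₃ := con 0₃) refl)))

    -- Now ψ(v³g(s)) is linear in s up to a constant, so the sum over s vanishes unless v + v³d = 0.
    -- The nonzero solutions are ±d/Δ, because Δ² = -d³ gives (d/Δ)² = -1/d.
    v₀ u₀ : K
    v₀ = d * Δ ⁻¹
    u₀ = cube v₀

    v₀≢0 : ¬ v₀ ≡ 0#
    v₀≢0 = *-≉0 d≢0 (⁻¹-≉0 Δ≢0)

    u₀≢0 : ¬ u₀ ≡ 0#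
    u₀≢0 = *-≉0 (*-≉0 v₀≢0 v₀≢0) v₀≢0

    v₀²d≡-1 : v₀ * v₀ * d ≡ - 1#
    v₀²d≡-1 = begin
      v₀ * v₀ * d  ≡⟨ solve 2 (λ d D → (d :* D) :* (d :* D) :* d := :- ((:- (d :* d :* d)) :* (D :* D))) refl d (Δ ⁻¹) ⟩
      - (- cube d * (Δ ⁻¹ * Δ ⁻¹))  ≡⟨ cong (λ u → - (u * (Δ ⁻¹ * Δ ⁻¹))) Δ²≡ ⟨
      - (Δ * Δ * (Δ ⁻¹ * Δ ⁻¹))  ≡⟨ solve 2 (λ x D → :- (x :* x :* (D :* D)) := :- ((x :* D) :* (x :* D))) refl Δ (Δ ⁻¹) ⟩
      - ((Δ * Δ ⁻¹) * (Δ * Δ ⁻¹))  ≡⟨ cong (λ u → - (u * u)) (inverseʳ Δ≢0) ⟩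
      - (1# * 1#)  ≡⟨ cong -_ (*-identityˡ 1#) ⟩
      - 1#  ∎

    exponential-sum : ∀ v → ∑ (λ s → ψ (cube v * g s)) ≡ ψ (cube v * n) ⊗ (ι (+ q) ⊗ δ (v + cube v * d) 0#)
    exponential-sum v = begin
      ∑ (λ s → ψ (cube v * g s))  ≡⟨ sum-cong-≗ split ⟩
      ∑ (λ s → ψ (cube v * n) ⊗ ψ (s * (v + cube v * d)))  ≡⟨ *-distribˡ-sum (ψ (cube v * n)) (λ s → ψ (s * (v + cube v * d))) ⟨
      ψ (cube v * n) ⊗ ∑ (λ s → ψ (s * (v + cube v * d)))  ≡⟨ cong (ψ (cube v * n) ⊗_) (orthogonality (v + cube v * d)) ⟩
      ψ (cube v * n) ⊗ (ι (+ q) ⊗ δ (v + cube v * d) 0#)  ∎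
      where
      split : ∀ s → ψ (cube v * g s) ≡ ψ (cube v * n) ⊗ ψ (s * (v + cube v * d))
      split s = begin
        ψ (cube v * g s)  ≡⟨ cong ψ (solve 4 (λ v s d n → (v :* v :* v) :* (s :* s :* s :+ d :* s :+ n) := (v :* v :* v) :* n :+ ((v :* s) :* (v :* s) :* (v :* s) :+ s :* ((v :* v :* v) :* d))) refl v s d n) ⟩
        ψ (cube v * n + (cube (v * s) + s * (cube v * d)))  ≡⟨ trans (ψ-+ (cube v * n) _) (cong (ψ (cube v * n) ⊗_) (ψ-+ (cube (v * s)) (s * (cube v * d)))) ⟩
        ψ (cube v * n) ⊗ (ψ (cube (v * s)) ⊗ ψ (s * (cube v * d)))  ≡⟨ cong (λ u → ψ (cube v * n) ⊗ (u ⊗ ψ (s * (cube v * d)))) (trans (ψ-cube (v * s)) (cong ψ (*-comm v s))) ⟩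
        ψ (cube v * n) ⊗ (ψ (s * v) ⊗ ψ (s * (cube v * d)))  ≡⟨ cong (ψ (cube v * n) ⊗_) (trans (sym (ψ-+ (s * v) (s * (cube v * d)))) (cong ψ (sym (distribˡ s v (cube v * d))))) ⟩
        ψ (cube v * n) ⊗ ψ (s * (v + cube v * d))  ∎

    δ-root : ∀ v → ¬ v ≡ 0# → δ (v + cube v * d) 0# ≡ δ (v * v) (v₀ * v₀)
    δ-root v v≢0 = δ-⇔ to from
      where
      factor : v + cube v * d ≡ v * (v * v * d - - 1#)
      factor = solve 2 (λ v d → v :+ (v :* v :* v) :* d := v :* (v :* v :* d :- (:- con 1₃))) refl v d
      to : v + cube v * d ≡ 0# → v * v ≡ v₀ * v₀
      to eq = *-cancelˡ d≢0 (trans (*-comm d (v * v)) (trans (trans (x-y≈0⇒x≈y (*-cancelˡ v≢0 (trans (trans (sym factor) eq) (sym (*-zeroʳ v))))) (sym v₀²d≡-1)) (*-comm (v₀ * v₀) d)))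
      from : v * v ≡ v₀ * v₀ → v + cube v * d ≡ 0#
      from eq = trans factor (trans (cong (v *_) (x≈y⇒x-y≈0 (trans (cong (_* d) eq) v₀²d≡-1))) (*-zeroʳ v))

    γ-κ-sum : ∀ k → ¬ k ≡ 0# → γ ⊗ κ-sum g k ≡ κ (k * u₀ ⁻¹) ⊗ ((ψ (u₀ * n) ⊕ conj (ψ (u₀ * n))) ⊗ ι (+ q))
    γ-κ-sum k k≢0 = begin
      γ ⊗ κ-sum g k  ≡⟨ κ-sum-transform g k≢0 ⟩
      ∑ (λ u → κ′ (u * k ⁻¹) ⊗ ∑ (λ s → ψ (u * g s)))  ≡⟨ ∑-cube (λ u → κ′ (u * k ⁻¹) ⊗ ∑ (λ s → ψ (u * g s))) ⟩
      ∑ (λ v → κ′ (cube v * k ⁻¹) ⊗ ∑ (λ s → ψ (cube v * g s)))  ≡⟨ sum-cong-≗ (λ v → trans (cong (κ′ (cube v * k ⁻¹) ⊗_) (exponential-sum v)) (term v (v Fin.≟ 0#))) ⟩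
      ∑ (λ v → δ v v₀ ⊗ f v ⊕ δ v (- v₀) ⊗ f v)  ≡⟨ ∑-distrib-+ (λ v → δ v v₀ ⊗ f v) (λ v → δ v (- v₀) ⊗ f v) ⟩
      ∑ (λ v → δ v v₀ ⊗ f v) ⊕ ∑ (λ v → δ v (- v₀) ⊗ f v)  ≡⟨ cong₂ _⊕_ (∑-δ v₀ f) (∑-δ (- v₀) f) ⟩
      f v₀ ⊕ f (- v₀)  ≡⟨ cong (f v₀ ⊕_) (cong₂ (λ a p → a ⊗ (p ⊗ ι (+ q))) κ′-negate ψ-negate) ⟩
      κ′ (u₀ * k ⁻¹) ⊗ (ψ (u₀ * n) ⊗ ι (+ q)) ⊕ κ′ (u₀ * k ⁻¹) ⊗ (conj (ψ (u₀ * n)) ⊗ ι (+ q))  ≡⟨ solveᶻ 4 (λ a p p′ n → a :⊗ (p :⊗ n) :⊕ a :⊗ (p′ :⊗ n) :≡ a :⊗ ((p :⊕ p′) :⊗ n)) refl (κ′ (u₀ * k ⁻¹)) (ψ (u₀ * n)) (conj (ψ (u₀ * n))) (ι (+ q)) ⟩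
      κ′ (u₀ * k ⁻¹) ⊗ ((ψ (u₀ * n) ⊕ conj (ψ (u₀ * n))) ⊗ ι (+ q))  ≡⟨ cong (_⊗ ((ψ (u₀ * n) ⊕ conj (ψ (u₀ * n))) ⊗ ι (+ q))) (trans (sym (κ-⁻¹ (u₀ * k ⁻¹))) (cong κ (⁻¹-unique reciprocal))) ⟩
      κ (k * u₀ ⁻¹) ⊗ ((ψ (u₀ * n) ⊕ conj (ψ (u₀ * n))) ⊗ ι (+ q))  ∎
      where
      open ℤ[ζ]-Solver
      f : K → ℤ[ζ]
      f v = κ′ (cube v * k ⁻¹) ⊗ (ψ (cube v * n) ⊗ ι (+ q))
      reciprocal : (u₀ * k ⁻¹) * (k * u₀ ⁻¹) ≡ 1#
      reciprocal = trans (solve 4 (λ u l k m → (u :* l) :* (k :* m) := (u :* m) :* (k :* l)) refl u₀ (k ⁻¹) k (u₀ ⁻¹)) (trans (cong₂ _*_ (inverseʳ u₀≢0) (inverseʳ k≢0)) (*-identityˡ 1#))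
      κ′-negate : κ′ (cube (- v₀) * k ⁻¹) ≡ κ′ (u₀ * k ⁻¹)
      κ′-negate = trans (cong κ′ (solve 2 (λ v l → ((:- v) :* (:- v) :* (:- v)) :* l := :- ((v :* v :* v) :* l)) refl v₀ (k ⁻¹))) (cong₂ (λ a b → a ⊕ ⊖ b) (α-neg (u₀ * k ⁻¹)) (β-neg (u₀ * k ⁻¹)))
      ψ-negate : ψ (cube (- v₀) * n) ≡ conj (ψ (u₀ * n))
      ψ-negate = trans (cong ψ (solve 2 (λ v l → ((:- v) :* (:- v) :* (:- v)) :* l := :- ((v :* v :* v) :* l)) refl v₀ n)) (sym (conj-ψ (u₀ * n)))
      term : ∀ v → Dec (v ≡ 0#) → κ′ (cube v * k ⁻¹) ⊗ (ψ (cube v * n) ⊗ (ι (+ q) ⊗ δ (v + cube v * d) 0#)) ≡ δ v v₀ ⊗ f v ⊕ δ v (- v₀) ⊗ f v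
      term v (no v≢0) = begin
        κ′ (cube v * k ⁻¹) ⊗ (ψ (cube v * n) ⊗ (ι (+ q) ⊗ δ (v + cube v * d) 0#))  ≡⟨ cong (λ t → κ′ (cube v * k ⁻¹) ⊗ (ψ (cube v * n) ⊗ (ι (+ q) ⊗ t))) (trans (δ-root v v≢0) (δ-square v₀≢0 v)) ⟩
        κ′ (cube v * k ⁻¹) ⊗ (ψ (cube v * n) ⊗ (ι (+ q) ⊗ (δ v v₀ ⊗ 𝟙 ⊕ δ v (- v₀) ⊗ 𝟙)))  ≡⟨ solveᶻ 5 (λ a p n x y → a :⊗ (p :⊗ (n :⊗ (x :⊗ conᶻ 𝟙 :⊕ y :⊗ conᶻ 𝟙))) :≡ x :⊗ (a :⊗ (p :⊗ n)) :⊕ y :⊗ (a :⊗ (p :⊗ n))) refl (κ′ (cube v * k ⁻¹)) (ψ (cube v * n)) (ι (+ q)) (δ v v₀) (δ v (- v₀)) ⟩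
        δ v v₀ ⊗ f v ⊕ δ v (- v₀) ⊗ f v  ∎
      term v (yes v≡0) = trans (trans (cong (_⊗ rest) (κ′-0 zero-argument)) (zeroˡ rest))
        (sym (trans (cong (λ t → δ v v₀ ⊗ t ⊕ δ v (- v₀) ⊗ t) (trans (cong (_⊗ (ψ (cube v * n) ⊗ ι (+ q))) (κ′-0 zero-argument)) (zeroˡ (ψ (cube v * n) ⊗ ι (+ q)))))
          (solveᶻ 2 (λ x y → x :⊗ conᶻ 𝟘 :⊕ y :⊗ conᶻ 𝟘 :≡ conᶻ 𝟘) refl (δ v v₀) (δ v (- v₀)))))
        where
        rest : ℤ[ζ]
        rest = ψ (cube v * n) ⊗ (ι (+ q) ⊗ δ (v + cube v * d) 0#)
        zero-argument : cube v * k ⁻¹ ≡ 0#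
        zero-argument = trans (cong (λ x → cube x * k ⁻¹) v≡0) (solve 1 (λ l → (con 0₃ :* con 0₃ :* con 0₃) :* l := con 0₃) refl (k ⁻¹))

    real-part : ∀ {p} → CubeRoot p → p ⊕ conj p ≡ ι (+ 2) ⊎ p ⊕ conj p ≡ ι -1ℤ
    real-part is𝟙  = inj₁ refl
    real-part isζ  = inj₂ refl
    real-part isζ² = inj₂ refl

    g₀ : ℤ
    g₀ = proj₁ γ≡ι

    κ-sum≡ : ∀ {a} → ψ (u₀ * n) ⊕ conj (ψ (u₀ * n)) ≡ ι a → ∀ k → ¬ k ≡ 0# → κ-sum g k ≡ ι (a ℤ.* g₀) ⊗ κ (k * u₀ ⁻¹)
    κ-sum≡ {a} real k k≢0 = ι-cancel g₀ (±≢0 (proj₂ (proj₂ γ≡ι))) (begin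
      ι g₀ ⊗ κ-sum g k  ≡⟨ cong (_⊗ κ-sum g k) (proj₁ (proj₂ γ≡ι)) ⟨
      γ ⊗ κ-sum g k  ≡⟨ γ-κ-sum k k≢0 ⟩
      κ (k * u₀ ⁻¹) ⊗ ((ψ (u₀ * n) ⊕ conj (ψ (u₀ * n))) ⊗ ι (+ q))  ≡⟨ cong₂ (λ a b → κ (k * u₀ ⁻¹) ⊗ (a ⊗ b)) real (trans (cong ι (trans (cong +_ (sym r*r≡q)) (trans (ℤ.pos-* r r) (±-square (proj₂ (proj₂ γ≡ι)))))) (ι-* g₀ g₀)) ⟩
      κ (k * u₀ ⁻¹) ⊗ (ι a ⊗ (ι g₀ ⊗ ι g₀))  ≡⟨ solveᶻ 3 (λ x a g → x :⊗ (a :⊗ (g :⊗ g)) :≡ g :⊗ ((a :⊗ g) :⊗ x)) refl (κ (k * u₀ ⁻¹)) (ι a) (ι g₀) ⟩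
      ι g₀ ⊗ ((ι a ⊗ ι g₀) ⊗ κ (k * u₀ ⁻¹))  ≡⟨ cong (λ t → ι g₀ ⊗ (t ⊗ κ (k * u₀ ⁻¹))) (ι-* a g₀) ⟨
      ι g₀ ⊗ (ι (a ℤ.* g₀) ⊗ κ (k * u₀ ⁻¹))  ∎)
      where open ℤ[ζ]-Solver

    -- A cubic without roots gives an odd sum, which excludes the value 2 of ψ + conj ψ.
    twisted : Twisted g
    twisted = [ (λ real → ⊥-elim (not-even real)) , (λ real → -1ℤ ℤ.* g₀ , u₀ ⁻¹ , ≡.subst PlusMinus (sym (ℤ.-1*i≡-i g₀)) (±-negate (proj₂ (proj₂ γ≡ι))) , ⁻¹-≉0 u₀≢0 , κ-sum≡ real) ]′ (real-part (ψ-root (u₀ * n)))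
      where
      total : ∃[ t ] (κ-sum g u₀ ≡ ι t × Odd t)
      total = κ-sum-odd g u₀ u₀≢0 g≢0
      not-even : ¬ ψ (u₀ * n) ⊕ conj (ψ (u₀ * n)) ≡ ι (+ 2)
      not-even real = proj₂ (proj₂ total) (g₀ , ι-injective (trans (sym (proj₁ (proj₂ total))) (trans (κ-sum≡ real u₀ u₀≢0) (trans (cong (ι (+ 2 ℤ.* g₀) ⊗_) (trans (cong κ (inverseʳ u₀≢0)) (cong₂ _⊕_ α-1 β-1))) (⊗-identityʳ (ι (+ 2 ℤ.* g₀)))))))

  -- The general cubic.

  Twisted-cong : ∀ {g g′} → (∀ s → g s ≡ g′ s) → Twisted g → Twisted g′
  Twisted-cong g≡g′ (ε , m , ε± , m≢0 , eq) = ε , m , ε± , m≢0 , λ k k≢0 → trans (sum-cong-≗ (λ s → cong (λ t → κ (k * t)) (sym (g≡g′ s)))) (eq k k≢0)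

  Twisted-shift : ∀ {g} a → Twisted (λ s → g (s + a)) → Twisted g
  Twisted-shift {g} a (ε , m , ε± , m≢0 , eq) = ε , m , ε± , m≢0 , λ k k≢0 → trans (∑-shift (λ s → κ (k * g s)) a) (eq k k≢0)

  cubic : K → K → K → K → K
  cubic c d n s = cube s + c * (s * s) + d * s + n

  -- The right-hand side is c²d² - 4d³ - 4c³n + 18cdn - 27n², the discriminant, in characteristic 3.
  -- For c ≠ 0 the shift by a = d/c removes the linear coefficient d + 2ca = d - ca.
  cubic-twisted : ∀ c d n Δ → Δ * Δ ≡ c * c * (d * d) - cube d - cube c * n → (∀ s → ¬ cubic c d n s ≡ 0#) → Twisted (cubic c d n)
  cubic-twisted c d n Δ Δ²≡ no-roots = cases (c Fin.≟ 0#)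
    where
    cases : Dec (c ≡ 0#) → Twisted (cubic c d n)
    cases (yes c≡0) = Twisted-cong (λ s → sym (without s)) (NoQuadraticTerm.twisted d n Δ
      (trans Δ²≡ (trans (cong (λ c → c * c * (d * d) - cube d - cube c * n) c≡0) (solve 2 (λ d n → con 0₃ :* con 0₃ :* (d :* d) :- d :* d :* d :- (con 0₃ :* con 0₃ :* con 0₃) :* n := :- (d :* d :* d)) refl d n)))
      (λ s p → no-roots s (trans (without s) p)))
      where
      without : ∀ s → cubic c d n s ≡ cube s + d * s + n
      without s = trans (cong (λ c → cubic c d n s) c≡0) (solve 3 (λ d n s → s :* s :* s :+ con 0₃ :* (s :* s) :+ d :* s :+ n := s :* s :* s :+ d :* s :+ n) refl d n s)
    cases (no c≢0) = Twisted-shift a (Twisted-cong (λ s → sym (shifted s)) (NonzeroQuadraticTerm.twisted c n′ Δ c≢0 (trans Δ²≡ (sym discriminant)) (λ s p → no-roots (s + a) (trans (shifted s) p))))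
      where
      a n′ : K
      a  = d * c ⁻¹
      n′ = cubic c d n a
      ca≡d : c * a ≡ d
      ca≡d = trans (solve 3 (λ c d C → c :* (d :* C) := (c :* C) :* d) refl c d (c ⁻¹)) (trans (cong (_* d) (inverseʳ c≢0)) (*-identityˡ d))
      shifted : ∀ s → cubic c d n (s + a) ≡ cube s + c * (s * s) + n′
      shifted s = trans (solve 5 (λ c d n s a → (s :+ a) :* (s :+ a) :* (s :+ a) :+ c :* ((s :+ a) :* (s :+ a)) :+ d :* (s :+ a) :+ n :=
          (s :* s :* s :+ c :* (s :* s) :+ (a :* a :* a :+ c :* (a :* a) :+ d :* a :+ n)) :+ (d :- c :* a) :* s) refl c d n s a)
        (trans (cong (λ t → (cube s + c * (s * s) + n′) + t * s) (x≈y⇒x-y≈0 (sym ca≡d))) (solve 2 (λ t s → t :+ con 0₃ :* s := t) refl (cube s + c * (s * s) + n′) s))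
      discriminant : - (cube c * n′) ≡ c * c * (d * d) - cube d - cube c * n
      discriminant = trans (solve 4 (λ c d n a → :- ((c :* c :* c) :* (a :* a :* a :+ c :* (a :* a) :+ d :* a :+ n)) :=
          :- ((c :* a) :* (c :* a) :* (c :* a)) :- c :* c :* ((c :* a) :* (c :* a)) :- c :* c :* (d :* (c :* a)) :- (c :* c :* c) :* n) refl c d n a)
        (trans (cong (λ t → - cube t - c * c * (t * t) - c * c * (d * t) - cube c * n) ca≡d) (solve 3 (λ c d n → :- (d :* d :* d) :- c :* c :* (d :* d) :- c :* c :* (d :* d) :- (c :* c :* c) :* n := c :* c :* (d :* d) :- d :* d :* d :- (c :* c :* c) :* n) refl c d n))

injective⇒surjective : ∀ {n} {f : Fin n → Fin n} → Injective _≡_ _≡_ f → ∀ y → ∃[ x ] f x ≡ y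
injective⇒surjective {suc n} {f} injective y with Fin.any? (λ x → f x Fin.≟ y)
... | yes found = found
... | no  missed = ⊥-elim (Fin.<⇒notInjective (ℕ.n<1+n n) punched)
  where
  avoid : ∀ x → ¬ y ≡ f x
  avoid x y≡fx = missed (x , ≡.sym y≡fx)
  punched : Injective _≡_ _≡_ (λ x → Fin.punchOut (avoid x))
  punched {x} {x′} eq = injective (Fin.punchOut-injective (avoid x) (avoid x′) eq)

-- The cubic extension E of F and the affine plane.

module CubicExtension
  {c ℓ : Level} (E : CommutativeRing c ℓ) (isFieldᴱ : IsField E) (e M h : ℕ) (M≡8h : M ≡ 8 ℕ.* h)
  (q≡3^2e : suc M ≡ 3 ℕ.^ (2 ℕ.* suc e)) (card : HasCardinality E (suc M ℕ.^ 3))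
  (ω w1 : CommutativeRing.Carrier E)
  (ω-order : FieldNotation.HasOrder E ω (suc M ℕ.^ 3 ℕ.∸ 1))
  (w1-order : FieldNotation.HasOrder E w1 (AGModel.N E (suc M) w1))
  where

  open CommutativeRing E hiding (zero)
  open FieldNotation E
  open PowerLaws E
  open AGModel E (suc M) w1
  open import Relation.Binary.Reasoning.Setoid setoid
  open import Algebra.Properties.Monoid.Mult +-monoid using () renaming (_×_ to _·_)
  open import Algebra.Properties.Semiring.Mult semiring using (×1-homo-*)
  open import Algebra.Properties.CommutativeMonoid.Sum +-commutativeMonoid using (sum; sum-permute; sum-cong-≋; ∑-distrib-+; sum-replicate)

  q : ℕ
  q = suc M

  -- Counting elements

  private
    module Card = Inverse card

  to-injective : ∀ {x y} → Card.to x ≡ Card.to y → x ≈ y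
  to-injective {x} {y} eq = trans (sym (Card.strictlyInverseʳ x)) (trans (Card.from-cong eq) (Card.strictlyInverseʳ y))

  _≟_ : Decidable _≈_
  x ≟ y = map′ to-injective Card.to-cong (Card.to x Fin.≟ Card.to y)

  module Field = FieldProperties E isFieldᴱ _≟_
  open Field

  three : Carrier
  three = 1# + 1# + 1#

  -- Translation by 1 permutes the field, so its cardinality times 1 vanishes.
  card×1≈0 : (q ℕ.^ 3) · 1# ≈ 0#
  card×1≈0 = begin
    (q ℕ.^ 3) · 1#  ≈⟨ sum-replicate (q ℕ.^ 3) ⟨
    ∑1  ≈⟨ +-identityˡ ∑1 ⟨
    0# + ∑1  ≈⟨ +-congʳ (-‿inverseˡ ∑x) ⟨
    - ∑x + ∑x + ∑1  ≈⟨ +-assoc (- ∑x) ∑x ∑1 ⟩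
    - ∑x + (∑x + ∑1)  ≈⟨ +-congˡ (∑-distrib-+ Card.from (λ _ → 1#)) ⟨
    - ∑x + sum (λ i → Card.from i + 1#)  ≈⟨ +-congˡ (sum-cong-≋ (λ i → Card.strictlyInverseʳ (Card.from i + 1#))) ⟨
    - ∑x + sum (λ i → Card.from (shift i))  ≈⟨ +-congˡ (sum-permute Card.from (permutation shift unshift shift-unshift unshift-shift)) ⟨
    - ∑x + ∑x  ≈⟨ -‿inverseˡ ∑x ⟩
    0#  ∎
    where
    ∑1 ∑x : Carrier
    ∑1 = sum {q ℕ.^ 3} (λ _ → 1#)
    ∑x = sum Card.from
    shift unshift : Fin (q ℕ.^ 3) → Fin (q ℕ.^ 3)
    shift   i = Card.to (Card.from i + 1#)
    unshift i = Card.to (Card.from i - 1#)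
    shift-unshift : ∀ i → shift (unshift i) ≡ i
    shift-unshift i = ≡.trans (Card.to-cong (trans (+-congʳ (Card.strictlyInverseʳ (Card.from i - 1#))) (trans (+-assoc _ _ _) (trans (+-congˡ (-‿inverseˡ 1#)) (+-identityʳ _))))) (Card.strictlyInverseˡ i)
    unshift-shift : ∀ i → unshift (shift i) ≡ i
    unshift-shift i = ≡.trans (Card.to-cong (trans (+-congʳ (Card.strictlyInverseʳ (Card.from i + 1#))) (trans (+-assoc _ _ _) (trans (+-congˡ (-‿inverseʳ 1#)) (+-identityʳ _))))) (Card.strictlyInverseˡ i)

  3^k×1 : ∀ k → (3 ℕ.^ k) · 1# ≈ three ^ k
  3^k×1 zero    = +-identityʳ 1#
  3^k×1 (suc k) = trans (×1-homo-* 3 (3 ℕ.^ k)) (*-cong (trans (+-congˡ (+-congˡ (+-identityʳ 1#))) (sym (+-assoc 1# 1# 1#))) (3^k×1 k))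

  -- The cardinality is a power of 3, so |E|·1 = 0 says that a power of 1 + 1 + 1 vanishes, and a
  -- field has no nilpotents.
  charThreeᴱ : CharThree E
  charThreeᴱ with three ≟ 0#
  ... | yes three≈0 = three≈0
  ... | no  three≉0 = ⊥-elim (^-≉0 ((2 ℕ.* suc e) ℕ.* 3) three≉0 (trans (sym (3^k×1 ((2 ℕ.* suc e) ℕ.* 3)))
    (trans (reflexive (≡.cong (_· 1#) (≡.trans (≡.sym (ℕ.^-*-assoc 3 (2 ℕ.* suc e) 3)) (≡.cong (ℕ._^ 3) (≡.sym q≡3^2e))))) card×1≈0)))

  open CharThreeSolver E charThreeᴱ

  power-distinct : ∀ {x n i j} → HasOrder x n → ¬ x ≈ 0# → i ℕ.< j → j ℕ.< n → ¬ x ^ i ≈ x ^ j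
  power-distinct {x} {n} {i} {j} (_ , _ , minimal) x≉0 i<j j<n eq = minimal (j ℕ.∸ i) (ℕ.m<n⇒0<n∸m i<j) (ℕ.≤-<-trans (ℕ.m∸n≤m j i) j<n)
    (*-cancelˡ (^-≉0 i x≉0) (trans (sym (^-+ x i (j ℕ.∸ i))) (trans (reflexive (≡.cong (x ^_) (ℕ.m+[n∸m]≡n (ℕ.<⇒≤ i<j)))) (trans (sym eq) (sym (*-identityʳ _))))))

  power-injective : ∀ {x n i j} → HasOrder x n → ¬ x ≈ 0# → i ℕ.< n → j ℕ.< n → x ^ i ≈ x ^ j → i ≡ j
  power-injective {x} {n} {i} {j} order x≉0 i<n j<n eq with ℕ.<-cmp i j
  ... | tri≈ _ i≡j _ = i≡j
  ... | tri< i<j _ _ = ⊥-elim (power-distinct order x≉0 i<j j<n eq)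
  ... | tri> _ _ j<i = ⊥-elim (power-distinct order x≉0 j<i i<n (sym eq))

  order⇒≉0 : ∀ {x n} → HasOrder x n → ¬ x ≈ 0#
  order⇒≉0 {x} {suc n} (_ , x^n≈1 , _) x≈0 = 0≉1 (trans (sym (0^ n)) (trans (^-cong (suc n) (sym x≈0)) x^n≈1))

  q³≡1+MN : q ℕ.^ 3 ≡ suc (M ℕ.* N)
  q³≡1+MN = expand M
    where
    expand : ∀ M → suc M ℕ.* (suc M ℕ.* (suc M ℕ.* 1)) ≡ suc (M ℕ.* (suc M ℕ.* suc M ℕ.+ suc M ℕ.+ 1))
    expand = ℕ-solve-∀

  ω-order′ : HasOrder ω (M ℕ.* N)
  ω-order′ = ≡.subst (HasOrder ω) (≡.cong (ℕ._∸ 1) q³≡1+MN) ω-order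

  ω≉0 : ¬ ω ≈ 0#
  ω≉0 = order⇒≉0 ω-order′

  w1≉0 : ¬ w1 ≈ 0#
  w1≉0 = order⇒≉0 w1-order

  powers-of-ω : Fin (suc (M ℕ.* N)) → Carrier
  powers-of-ω zero    = 0#
  powers-of-ω (suc k) = ω ^ toℕ k

  powers-of-ω-injective : ∀ {i j} → powers-of-ω i ≈ powers-of-ω j → i ≡ j
  powers-of-ω-injective {zero}  {zero}  _  = ≡.refl
  powers-of-ω-injective {zero}  {suc j} eq = ⊥-elim (^-≉0 (toℕ j) ω≉0 (sym eq))
  powers-of-ω-injective {suc i} {zero}  eq = ⊥-elim (^-≉0 (toℕ i) ω≉0 eq)
  powers-of-ω-injective {suc i} {suc j} eq = ≡.cong suc (Fin.toℕ-injective (power-injective ω-order′ ω≉0 (Fin.toℕ<n i) (Fin.toℕ<n j) eq))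

  opaque
    -- By counting: 0 and the q³ - 1 distinct powers of ω form an injective family indexed by as
    -- many indices as E has elements.
    discrete-log : ∀ x → ¬ x ≈ 0# → ∃[ k ] ((k ℕ.< M ℕ.* N) × (x ≈ ω ^ k))
    discrete-log x x≉0 = conclude (injective⇒surjective {f = index} index-injective (Card.to x))
      where
      index : Fin (q ℕ.^ 3) → Fin (q ℕ.^ 3)
      index i = Card.to (powers-of-ω (Fin.cast q³≡1+MN i))
      index-injective : Injective _≡_ _≡_ index
      index-injective {i} {j} eq = Fin.toℕ-injective (≡.trans (≡.sym (Fin.toℕ-cast q³≡1+MN i)) (≡.trans (≡.cong toℕ (powers-of-ω-injective (to-injective eq))) (Fin.toℕ-cast q³≡1+MN j)))
      exponent : ∀ i → powers-of-ω i ≈ x → ∃[ k ] ((k ℕ.< M ℕ.* N) × (x ≈ ω ^ k))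
      exponent zero    0≈x  = ⊥-elim (x≉0 (sym 0≈x))
      exponent (suc k) ω^≈x = toℕ k , Fin.toℕ<n k , sym ω^≈x
      conclude : (∃[ i ] index i ≡ Card.to x) → ∃[ k ] ((k ℕ.< M ℕ.* N) × (x ≈ ω ^ k))
      conclude (i , eq) = exponent (Fin.cast q³≡1+MN i) (to-injective eq)

  -- The Frobenius automorphism x ↦ x^q

  cube-additive : ∀ x y → (x + y) ^ 3 ≈ x ^ 3 + y ^ 3
  cube-additive = solve 2 (λ x y → (x :+ y) :* ((x :+ y) :* ((x :+ y) :* con 1₃)) := x :* (x :* (x :* con 1₃)) :+ y :* (y :* (y :* con 1₃))) refl

  ^3^-+ : ∀ k x y → (x + y) ^ (3 ℕ.^ k) ≈ x ^ (3 ℕ.^ k) + y ^ (3 ℕ.^ k)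
  ^3^-+ zero    x y = trans (*-identityʳ _) (+-cong (sym (*-identityʳ x)) (sym (*-identityʳ y)))
  ^3^-+ (suc k) x y = begin
    (x + y) ^ (3 ℕ.* 3 ℕ.^ k)  ≈⟨ ^-* (x + y) 3 (3 ℕ.^ k) ⟩
    ((x + y) ^ 3) ^ (3 ℕ.^ k)  ≈⟨ ^-cong (3 ℕ.^ k) (cube-additive x y) ⟩
    (x ^ 3 + y ^ 3) ^ (3 ℕ.^ k)  ≈⟨ ^3^-+ k (x ^ 3) (y ^ 3) ⟩
    (x ^ 3) ^ (3 ℕ.^ k) + (y ^ 3) ^ (3 ℕ.^ k)  ≈⟨ +-cong (^-* x 3 (3 ℕ.^ k)) (^-* y 3 (3 ℕ.^ k)) ⟨
    x ^ (3 ℕ.* 3 ℕ.^ k) + y ^ (3 ℕ.* 3 ℕ.^ k)  ∎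

  opaque
    σ : Carrier → Carrier
    σ x = x ^ q

    σ-def : ∀ x → σ x ≈ x ^ q
    σ-def x = refl

    σ-cong : ∀ {x y} → x ≈ y → σ x ≈ σ y
    σ-cong = ^-cong q

    σ-+ : ∀ x y → σ (x + y) ≈ σ x + σ y
    σ-+ x y = ≡.subst (λ n → (x + y) ^ n ≈ x ^ n + y ^ n) (≡.sym q≡3^2e) (^3^-+ (2 ℕ.* suc e) x y)

    σ-* : ∀ x y → σ (x * y) ≈ σ x * σ y
    σ-* x y = *-^ x y q

    σ-0 : σ 0# ≈ 0#
    σ-0 = 0^ M

    σ-1 : σ 1# ≈ 1#
    σ-1 = 1^ q

    σ-^ : ∀ x n → σ (x ^ n) ≈ σ x ^ n
    σ-^ x n = ^-^-comm x n q

  ω^MN≈1 : ω ^ (M ℕ.* N) ≈ 1#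
  ω^MN≈1 = proj₁ (proj₂ ω-order′)

  ^-period : ∀ x → x ^ (q ℕ.^ 3) ≈ x
  ^-period x = trans (reflexive (≡.cong (x ^_) q³≡1+MN)) (cases (x ≟ 0#))
    where
    power : (∃[ k ] ((k ℕ.< M ℕ.* N) × (x ≈ ω ^ k))) → x ^ (M ℕ.* N) ≈ 1#
    power (k , _ , x≈ω^k) = trans (^-cong (M ℕ.* N) x≈ω^k) (trans (^-^-comm ω k (M ℕ.* N)) (trans (^-cong k ω^MN≈1) (1^ k)))
    cases : Dec (x ≈ 0#) → x * x ^ (M ℕ.* N) ≈ x
    cases (yes x≈0) = trans (*-congʳ x≈0) (trans (zeroˡ _) (sym x≈0))
    cases (no  x≉0) = trans (*-congˡ (power (discrete-log x x≉0))) (*-identityʳ x)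

  σσσ : ∀ x → σ (σ (σ x)) ≈ x
  σσσ x = begin
    σ (σ (σ x))  ≈⟨ trans (σ-def _) (^-cong q (trans (σ-def _) (^-cong q (σ-def x)))) ⟩
    ((x ^ q) ^ q) ^ q  ≈⟨ ^-cong q (^-* x q q) ⟨
    (x ^ (q ℕ.* q)) ^ q  ≈⟨ ^-* x (q ℕ.* q) q ⟨
    x ^ (q ℕ.* q ℕ.* q)  ≡⟨ ≡.cong (x ^_) (rearrange q) ⟩
    x ^ (q ℕ.^ 3)  ≈⟨ ^-period x ⟩
    x  ∎
    where
    rearrange : ∀ q → q ℕ.* q ℕ.* q ≡ q ℕ.* (q ℕ.* (q ℕ.* 1))
    rearrange = ℕ-solve-∀

  σ-neg : ∀ x → σ (- x) ≈ - σ x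
  σ-neg x = x-y≈0⇒x≈y (begin
    σ (- x) - - σ x  ≈⟨ solve 2 (λ a b → a :- (:- b) := a :+ b) refl (σ (- x)) (σ x) ⟩
    σ (- x) + σ x  ≈⟨ σ-+ (- x) x ⟨
    σ (- x + x)  ≈⟨ trans (σ-cong (-‿inverseˡ x)) σ-0 ⟩
    0#  ∎)

  Fixed : Carrier → Set ℓ
  Fixed x = σ x ≈ x

  -- The subfield with q elements

  w0 : Carrier
  w0 = ω ^ N

  w0≉0 : ¬ w0 ≈ 0#
  w0≉0 = ^-≉0 N ω≉0

  0<N : 0 ℕ.< N
  0<N = ≡.subst (0 ℕ.<_) (ℕ.+-comm 1 (q ℕ.* q ℕ.+ q)) (ℕ.s≤s ℕ.z≤n)

  0<M : 0 ℕ.< M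
  0<M = positive M (proj₁ ω-order′)
    where
    positive : ∀ M → 0 ℕ.< M ℕ.* N → 0 ℕ.< M
    positive (suc M) _ = ℕ.s≤s ℕ.z≤n

  instance
    N-nonZero : ℕ.NonZero N
    N-nonZero = ℕ.>-nonZero 0<N

    M-nonZero : ℕ.NonZero M
    M-nonZero = ℕ.>-nonZero 0<M

  w0-order : HasOrder w0 M
  w0-order = 0<M , trans (sym (^-* ω N M)) (trans (reflexive (≡.cong (ω ^_) (ℕ.*-comm N M))) ω^MN≈1) , λ m 0<m m<M w0^m≈1 →
    ℕ.<⇒≱ m<M (∣⇒≤ {{ℕ.>-nonZero 0<m}} (*-cancelˡ-∣ N (≡.subst (_∣ N ℕ.* m) (ℕ.*-comm M N) (order-∣ ω-order′ (trans (^-* ω N m) w0^m≈1)))))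

  -- F is coded by `Fin q`: index 0 for 0, the others for the q - 1 powers of `w0`. Arithmetic on
  -- codes is pulled back along this injection, and `fixed-index` identifies its image with the
  -- fixed points of σ.
  el : Fin q → Carrier
  el zero    = 0#
  el (suc j) = w0 ^ toℕ j

  el-injective : ∀ {i j} → el i ≈ el j → i ≡ j
  el-injective {zero}  {zero}  _  = ≡.refl
  el-injective {zero}  {suc j} eq = ⊥-elim (^-≉0 (toℕ j) w0≉0 (sym eq))
  el-injective {suc i} {zero}  eq = ⊥-elim (^-≉0 (toℕ i) w0≉0 eq)
  el-injective {suc i} {suc j} eq = ≡.cong suc (Fin.toℕ-injective (power-injective w0-order w0≉0 (Fin.toℕ<n i) (Fin.toℕ<n j) eq))

  w0-fixed : Fixed w0
  w0-fixed = trans (σ-def w0) (trans (*-congˡ (proj₁ (proj₂ w0-order))) (*-identityʳ w0))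

  el-fixed : ∀ i → Fixed (el i)
  el-fixed zero    = σ-0
  el-fixed (suc j) = trans (σ-^ w0 (toℕ j)) (^-cong (toℕ j) w0-fixed)

  fixed⇒^M≈1 : ∀ {x} → ¬ x ≈ 0# → Fixed x → x ^ M ≈ 1#
  fixed⇒^M≈1 {x} x≉0 fixed = *-cancelˡ x≉0 (trans (sym (σ-def x)) (trans fixed (sym (*-identityʳ x))))

  opaque
    -- A nonzero fixed x = ω^k satisfies x^(q-1) = 1, so MN divides kM and hence N divides k; thus x
    -- is a power of w0 = ω^N.
    fixed-index : ∀ x → Fixed x → ∃[ i ] el i ≈ x
    fixed-index x fixed = cases (x ≟ 0#)
      where
      quotient : ∀ {k} → k ℕ.< M ℕ.* N → x ≈ ω ^ k → N ∣ k → ∃[ i ] el i ≈ x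
      quotient {k} k<MN x≈ω^k (divides j k≡jN) = suc (fromℕ< j<M) , (begin
        w0 ^ toℕ (fromℕ< j<M)  ≡⟨ ≡.cong (w0 ^_) (Fin.toℕ-fromℕ< j<M) ⟩
        (ω ^ N) ^ j  ≈⟨ ^-* ω N j ⟨
        ω ^ (N ℕ.* j)  ≡⟨ ≡.cong (ω ^_) (≡.trans (ℕ.*-comm N j) (≡.sym k≡jN)) ⟩
        ω ^ k  ≈⟨ x≈ω^k ⟨
        x  ∎)
        where
        j<M : j ℕ.< M
        j<M = ℕ.*-cancelʳ-< N j M (≡.subst (ℕ._< M ℕ.* N) k≡jN k<MN)
      nonzero : ¬ x ≈ 0# → (∃[ k ] ((k ℕ.< M ℕ.* N) × (x ≈ ω ^ k))) → ∃[ i ] el i ≈ x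
      nonzero x≉0 (k , k<MN , x≈ω^k) = quotient k<MN x≈ω^k
        (*-cancelʳ-∣ M (≡.subst (_∣ k ℕ.* M) (ℕ.*-comm M N) (order-∣ ω-order′ (trans (^-* ω k M) (trans (^-cong M (sym x≈ω^k)) (fixed⇒^M≈1 x≉0 fixed))))))
      cases : Dec (x ≈ 0#) → ∃[ i ] el i ≈ x
      cases (yes x≈0) = zero , sym x≈0
      cases (no  x≉0) = nonzero x≉0 (discrete-log x x≉0)

  idx : ∀ {x} → Fixed x → Fin q
  idx {x} fixed = proj₁ (fixed-index x fixed)

  el-idx : ∀ {x} (fixed : Fixed x) → el (idx fixed) ≈ x
  el-idx {x} fixed = proj₂ (fixed-index x fixed)

  fixed-+ : ∀ {x y} → Fixed x → Fixed y → Fixed (x + y)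
  fixed-+ {x} {y} p p′ = trans (σ-+ x y) (+-cong p p′)

  fixed-* : ∀ {x y} → Fixed x → Fixed y → Fixed (x * y)
  fixed-* {x} {y} p p′ = trans (σ-* x y) (*-cong p p′)

  fixed-neg : ∀ {x} → Fixed x → Fixed (- x)
  fixed-neg {x} p = trans (σ-neg x) (-‿cong p)

  fixed-inverse : ∀ {x y} → Fixed x → x * y ≈ 1# → Fixed y
  fixed-inverse {x} {y} fixed xy≈1 = *-cancelˡ x≉0 (begin
    x * σ y  ≈⟨ *-congʳ fixed ⟨
    σ x * σ y  ≈⟨ σ-* x y ⟨
    σ (x * y)  ≈⟨ trans (σ-cong xy≈1) σ-1 ⟩
    1#  ≈⟨ xy≈1 ⟨
    x * y  ∎)
    where
    x≉0 : ¬ x ≈ 0#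
    x≉0 x≈0 = 0≉1 (trans (sym (zeroˡ y)) (trans (*-congʳ (sym x≈0)) xy≈1))

  infixl 6 _+ᶠ_
  infixl 7 _*ᶠ_

  0ᶠ : Fin q
  0ᶠ = zero

  opaque
    _+ᶠ_ _*ᶠ_ : Op₂ (Fin q)
    i +ᶠ j = idx (fixed-+ (el-fixed i) (el-fixed j))
    i *ᶠ j = idx (fixed-* (el-fixed i) (el-fixed j))

    -ᶠ_ : Op₁ (Fin q)
    -ᶠ i = idx (fixed-neg (el-fixed i))

    1ᶠ : Fin q
    1ᶠ = idx σ-1

    el-+ : ∀ i j → el (i +ᶠ j) ≈ el i + el j
    el-+ i j = el-idx (fixed-+ (el-fixed i) (el-fixed j))

    el-* : ∀ i j → el (i *ᶠ j) ≈ el i * el j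
    el-* i j = el-idx (fixed-* (el-fixed i) (el-fixed j))

    el-neg : ∀ i → el (-ᶠ i) ≈ - el i
    el-neg i = el-idx (fixed-neg (el-fixed i))

    el-1 : el 1ᶠ ≈ 1#
    el-1 = el-idx σ-1

  subfield-raw : RawRing 0ℓ 0ℓ
  subfield-raw = record { Carrier = Fin q ; _≈_ = _≡_ ; _+_ = _+ᶠ_ ; _*_ = _*ᶠ_ ; -_ = -ᶠ_ ; 0# = 0ᶠ ; 1# = 1ᶠ }

  el-isRingMonomorphism : IsRingMonomorphism subfield-raw rawRing el
  el-isRingMonomorphism = record
    { isRingHomomorphism = record
      { isSemiringHomomorphism = record
        { isNearSemiringHomomorphism = record
          { +-isMonoidHomomorphism = record
            { isMagmaHomomorphism = record { isRelHomomorphism = record { cong = λ { ≡.refl → refl } } ; homo = el-+ }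
            ; ε-homo = refl }
          ; *-homo = el-* }
        ; 1#-homo = el-1 }
      ; -‿homo = el-neg }
    ; injective = el-injective }

  opaque
    subfield-isCommutativeRing : IsCommutativeRing _≡_ _+ᶠ_ _*ᶠ_ -ᶠ_ 0ᶠ 1ᶠ
    subfield-isCommutativeRing = RingMonomorphism.isCommutativeRing el-isRingMonomorphism isCommutativeRing

  subfield : CommutativeRing 0ℓ 0ℓ
  subfield = bundle subfield-isCommutativeRing

  opaque
    subfield-isField : IsField subfield
    subfield-isField = record
      { 0≉1 = λ 0≡1 → 0≉1 (trans (reflexive (≡.cong el 0≡1)) el-1)
      ; inverse = λ x x≢0 → invert x (λ el≈0 → x≢0 (el-injective el≈0)) }
      where
      invert : ∀ x → ¬ el x ≈ 0# → ∃[ y ] x *ᶠ y ≡ 1ᶠ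
      invert x el≉0 = idx fixed , el-injective (trans (el-* x (idx fixed)) (trans (*-congˡ (el-idx fixed)) (trans (inverseʳ el≉0) (sym el-1))))
        where
        fixed : Fixed (el x ⁻¹)
        fixed = fixed-inverse (el-fixed x) (inverseʳ el≉0)

    subfield-charThree : CharThree subfield
    subfield-charThree = el-injective (trans (el-+ (1ᶠ +ᶠ 1ᶠ) 1ᶠ) (trans (+-cong (trans (el-+ 1ᶠ 1ᶠ) (+-cong el-1 el-1)) el-1) charThreeᴱ))

  w : Fin q
  w = idx w0-fixed

  el-^ : ∀ x n → el (FieldNotation._^_ subfield x n) ≈ el x ^ n
  el-^ x zero    = el-1
  el-^ x (suc n) = trans (el-* x (FieldNotation._^_ subfield x n)) (*-congˡ (el-^ x n))

  el-w^ : ∀ n → el (FieldNotation._^_ subfield w n) ≈ w0 ^ n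
  el-w^ n = trans (el-^ w n) (^-cong n (el-idx w0-fixed))

  opaque
    w-order : FieldNotation.HasOrder subfield w (8 ℕ.* h)
    w-order = ≡.subst (FieldNotation.HasOrder subfield w) M≡8h (0<M , el-injective (trans (el-w^ M) (trans (proj₁ (proj₂ w0-order)) (sym el-1)))
      , λ m 0<m m<M w^m≡1 → proj₂ (proj₂ w0-order) m 0<m m<M (trans (sym (el-w^ m)) (trans (reflexive (≡.cong el w^m≡1)) el-1)))

    w-generates : ∀ x → ¬ x ≡ 0ᶠ → ∃[ k ] (x ≡ FieldNotation._^_ subfield w k)
    w-generates zero    x≢0 = ⊥-elim (x≢0 ≡.refl)
    w-generates (suc j) _   = toℕ j , el-injective (sym (el-w^ (toℕ j)))

  module FF = FiniteFieldCharThree subfield-isCommutativeRing subfield-isField subfield-charThree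
    e h q≡3^2e (≡.cong suc M≡8h) w w-order w-generates
  module Sub = FieldProperties subfield subfield-isField Fin._≟_
  open Eisenstein using (ℤ[ζ]; 𝟙; 𝟘; ⊖_; _⊕_; _⊗_; ι; ι-injective) renaming (_≟_ to _≟ᶻ_)
  open QuarticValues
  open FiniteSums using (sum-cong-≗)

  -- Norm, trace and the decomposition E* = F* × ⟨w1⟩

  Nm tr : Carrier → Carrier
  Nm x = x * σ x * σ (σ x)
  tr x = x + σ x + σ (σ x)

  Tr≈tr : ∀ x → Tr q x ≈ tr x
  Tr≈tr x = +-cong (+-congˡ (sym (σ-def x))) (trans (^-* x q q) (sym (trans (σ-def (σ x)) (^-cong q (σ-def x)))))

  tr-cong : ∀ {x y} → x ≈ y → tr x ≈ tr y
  tr-cong eq = +-cong (+-cong eq (σ-cong eq)) (σ-cong (σ-cong eq))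

  Nm-cong : ∀ {x y} → x ≈ y → Nm x ≈ Nm y
  Nm-cong eq = *-cong (*-cong eq (σ-cong eq)) (σ-cong (σ-cong eq))

  tr-fixed : ∀ x → Fixed (tr x)
  tr-fixed x = trans (σ-+ (x + σ x) (σ (σ x))) (trans (+-cong (σ-+ x (σ x)) (σσσ x)) (solve 3 (λ a b c → (b :+ c) :+ a := a :+ b :+ c) refl x (σ x) (σ (σ x))))

  Nm-fixed : ∀ x → Fixed (Nm x)
  Nm-fixed x = trans (σ-* (x * σ x) (σ (σ x))) (trans (*-cong (σ-* x (σ x)) (σσσ x)) (solve 3 (λ a b c → (b :* c) :* a := a :* b :* c) refl x (σ x) (σ (σ x))))

  σσ-* : ∀ x y → σ (σ (x * y)) ≈ σ (σ x) * σ (σ y)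
  σσ-* x y = trans (σ-cong (σ-* x y)) (σ-* (σ x) (σ y))

  tr-scale : ∀ {t} x → Fixed t → tr (t * x) ≈ t * tr x
  tr-scale {t} x fixed = trans (+-cong (+-congˡ (trans (σ-* t x) (*-congʳ fixed))) (trans (σσ-* t x) (*-congʳ (trans (σ-cong fixed) fixed))))
    (solve 4 (λ t a b c → t :* a :+ t :* b :+ t :* c := t :* (a :+ b :+ c)) refl t x (σ x) (σ (σ x)))

  Nm-* : ∀ x y → Nm (x * y) ≈ Nm x * Nm y
  Nm-* x y = trans (*-cong (*-congˡ (σ-* x y)) (σσ-* x y)) (solve 6 (λ a b c d e f → (a :* b) :* (c :* d) :* (e :* f) := (a :* c :* e) :* (b :* d :* f)) refl x y (σ x) (σ y) (σ (σ x)) (σ (σ y)))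

  σ-≉0 : ∀ {x} → ¬ x ≈ 0# → ¬ σ x ≈ 0#
  σ-≉0 {x} x≉0 σx≈0 = x≉0 (trans (sym (σσσ x)) (trans (σ-cong (trans (σ-cong σx≈0) σ-0)) σ-0))

  Nm-≉0 : ∀ {x} → ¬ x ≈ 0# → ¬ Nm x ≈ 0#
  Nm-≉0 x≉0 = *-≉0 (*-≉0 x≉0 (σ-≉0 x≉0)) (σ-≉0 (σ-≉0 x≉0))

  Nm≈^N : ∀ x → Nm x ≈ x ^ N
  Nm≈^N x = begin
    x * σ x * σ (σ x)  ≈⟨ solve 3 (λ a b c → a :* b :* c := c :* b :* a) refl x (σ x) (σ (σ x)) ⟩
    σ (σ x) * σ x * x  ≈⟨ *-cong (*-cong (trans (σ-def (σ x)) (trans (^-cong q (σ-def x)) (sym (^-* x q q)))) (σ-def x)) (sym (^-1 x)) ⟩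
    x ^ (q ℕ.* q) * x ^ q * x ^ 1  ≈⟨ *-congʳ (^-+ x (q ℕ.* q) q) ⟨
    x ^ (q ℕ.* q ℕ.+ q) * x ^ 1  ≈⟨ ^-+ x (q ℕ.* q ℕ.+ q) 1 ⟨
    x ^ N  ∎

  Nm-w1 : ∀ k → Nm (w1 ^ k) ≈ 1#
  Nm-w1 k = trans (Nm≈^N (w1 ^ k)) (trans (^-^-comm w1 k N) (trans (^-cong k (proj₁ (proj₂ w1-order))) (1^ k)))

  NmF : Carrier → Fin q
  NmF x = idx (Nm-fixed x)

  el-NmF : ∀ x → el (NmF x) ≈ Nm x
  el-NmF x = el-idx (Nm-fixed x)

  el-cube : ∀ t → el (FF.cube t) ≈ el t * el t * el t
  el-cube t = trans (el-* (t *ᶠ t) t) (*-congʳ (el-* t t))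

  Nm-el : ∀ t → Nm (el t) ≈ el (FF.cube t)
  Nm-el t = trans (*-cong (*-congˡ (el-fixed t)) (trans (σ-cong (el-fixed t)) (el-fixed t))) (sym (el-cube t))

  opaque
    root-of-unity : ∀ z → z ^ N ≈ 1# → ∃[ j ] z ≈ (ω ^ M) ^ toℕ {N} j
    root-of-unity z z^N≈1 = nonzero (discrete-log z z≉0)
      where
      z≉0 : ¬ z ≈ 0#
      z≉0 z≈0 = Nm-≉0-contra (trans (Nm≈^N z) z^N≈1)
        where
        Nm-≉0-contra : ¬ Nm z ≈ 1#
        Nm-≉0-contra eq = 0≉1 (trans (sym (trans (*-congʳ (trans (*-congʳ z≈0) (zeroˡ (σ z)))) (zeroˡ (σ (σ z))))) eq)
      quotient : ∀ {k} → k ℕ.< M ℕ.* N → z ≈ ω ^ k → M ∣ k → ∃[ j ] z ≈ (ω ^ M) ^ toℕ {N} j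
      quotient {k} k<MN z≈ω^k (divides j k≡jM) = fromℕ< j<N , (begin
        z  ≈⟨ z≈ω^k ⟩
        ω ^ k  ≡⟨ ≡.cong (ω ^_) (≡.trans k≡jM (ℕ.*-comm j M)) ⟩
        ω ^ (M ℕ.* j)  ≈⟨ ^-* ω M j ⟩
        (ω ^ M) ^ j  ≡⟨ ≡.cong ((ω ^ M) ^_) (Fin.toℕ-fromℕ< j<N) ⟨
        (ω ^ M) ^ toℕ (fromℕ< j<N)  ∎)
        where
        j<N : j ℕ.< N
        j<N = ℕ.*-cancelˡ-< M j N (≡.subst (ℕ._< M ℕ.* N) (≡.trans k≡jM (ℕ.*-comm j M)) k<MN)
      nonzero : (∃[ k ] ((k ℕ.< M ℕ.* N) × (z ≈ ω ^ k))) → ∃[ j ] z ≈ (ω ^ M) ^ toℕ {N} j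
      nonzero (k , k<MN , z≈ω^k) = quotient k<MN z≈ω^k (*-cancelʳ-∣ N (order-∣ ω-order′ (trans (^-* ω k N) (trans (^-cong N (sym z≈ω^k)) z^N≈1))))

  w1-power-injective : ∀ {i j : Fin N} → w1 ^ toℕ i ≈ w1 ^ toℕ j → i ≡ j
  w1-power-injective {i} {j} eq = Fin.toℕ-injective (power-injective w1-order w1≉0 (Fin.toℕ<n i) (Fin.toℕ<n j) eq)

  opaque
    -- The norm is the N-th power. By `root-of-unity` all N-th roots of unity are powers of ω^M, and
    -- the N distinct powers of w1 are among them; an injection of `Fin N` into itself reaches every
    -- one.
    w1-log : ∀ z → Nm z ≈ 1# → ∃[ j ] z ≈ w1 ^ toℕ {N} j
    w1-log z Nm≈1 = conclude (injective⇒surjective {N} {index} (λ {i} {j} → index-injective {i} {j}) (proj₁ target))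
      where
      root : ∀ j → ∃[ k ] w1 ^ toℕ {N} j ≈ (ω ^ M) ^ toℕ {N} k
      root j = root-of-unity (w1 ^ toℕ j) (trans (sym (Nm≈^N (w1 ^ toℕ j))) (Nm-w1 (toℕ j)))
      index : Fin N → Fin N
      index j = proj₁ (root j)
      index-injective : Injective _≡_ _≡_ index
      index-injective {i} {j} eq = w1-power-injective (trans (proj₂ (root i)) (trans (reflexive (≡.cong (λ k → (ω ^ M) ^ toℕ k) eq)) (sym (proj₂ (root j)))))
      target : ∃[ k ] z ≈ (ω ^ M) ^ toℕ {N} k
      target = root-of-unity z (trans (sym (Nm≈^N z)) Nm≈1)
      conclude : (∃[ j ] index j ≡ proj₁ target) → ∃[ j ] z ≈ w1 ^ toℕ {N} j
      conclude (j , eq) = j , trans (proj₂ target) (trans (reflexive (≡.cong (λ k → (ω ^ M) ^ toℕ k) (≡.sym eq))) (sym (proj₂ (root j))))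

  Decomposition : Carrier → Set ℓ
  Decomposition x = ∃[ t ] ∃[ j ] ((¬ el t ≈ 0#) × (x ≈ el t * w1 ^ toℕ {N} j) × (FF.cube t ≡ NmF x))

  -- Cubing is bijective on F, so the norm determines the F*-component.
  opaque
    decompose : ∀ x → ¬ x ≈ 0# → Decomposition x
    decompose x x≉0 = t , proj₁ log , t≉0 , trans (sym tz≈x) (*-congˡ (proj₂ log)) , FF.cube-cbrt (NmF x)
      where
      t : Fin q
      t = FF.cbrt (NmF x)
      Nm-t : Nm (el t) ≈ Nm x
      Nm-t = trans (Nm-el t) (trans (reflexive (≡.cong el (FF.cube-cbrt (NmF x)))) (el-NmF x))
      t≉0 : ¬ el t ≈ 0#
      t≉0 t≈0 = Nm-≉0 x≉0 (trans (sym Nm-t) (trans (*-congʳ (trans (*-congʳ t≈0) (zeroˡ _))) (zeroˡ _)))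
      z : Carrier
      z = el t ⁻¹ * x
      tz≈x : el t * z ≈ x
      tz≈x = trans (sym (*-assoc _ _ _)) (trans (*-congʳ (inverseʳ t≉0)) (*-identityˡ x))
      Nm-z : Nm z ≈ 1#
      Nm-z = *-cancelˡ (Nm-≉0 t≉0) (trans (sym (Nm-* (el t) z)) (trans (Nm-cong tz≈x) (trans (sym Nm-t) (sym (*-identityʳ _)))))
      log : ∃[ j ] z ≈ w1 ^ toℕ {N} j
      log = w1-log z Nm-z

  -- The norm is 1 on powers of w1 and is cubing on F, which is injective in characteristic 3; so
  -- the norm recovers the F-component.
  decomposition-unique : ∀ {t t′} {i j : Fin N} → ¬ el t ≈ 0# → el t * w1 ^ toℕ i ≈ el t′ * w1 ^ toℕ j → t ≡ t′ × i ≡ j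
  decomposition-unique {t} {t′} {i} {j} t≉0 eq = t≡t′ , w1-power-injective {i} {j} same-power
    where
    norm-of : ∀ t k → Nm (el t * w1 ^ k) ≈ el (FF.cube t)
    norm-of t k = trans (Nm-* (el t) (w1 ^ k)) (trans (*-cong (Nm-el t) (Nm-w1 k)) (*-identityʳ (el (FF.cube t))))
    same-cube : FF.cube t ≡ FF.cube t′
    same-cube = el-injective {FF.cube t} {FF.cube t′} (trans (sym (norm-of t (toℕ i))) (trans (Nm-cong eq) (norm-of t′ (toℕ j))))
    t≡t′ : t ≡ t′
    t≡t′ = ≡.trans (≡.sym (FF.cbrt-cube t)) (≡.trans (≡.cong FF.cbrt same-cube) (FF.cbrt-cube t′))
    same-power : w1 ^ toℕ i ≈ w1 ^ toℕ j
    same-power = *-cancelˡ {el t} {w1 ^ toℕ i} {w1 ^ toℕ j} t≉0 (trans eq (*-congʳ (reflexive (≡.cong el (≡.sym t≡t′)))))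

  -- The cosets C₀ ∪ C₁

  InC₀∪C₁ : Carrier → Set (c Level.⊔ ℓ)
  InC₀∪C₁ x = InCoset w0 0 x ⊎ InCoset w0 1 x

  coset-exponent : ∀ k → cos k ⊕ sin k ≡ 𝟙 → ∃[ j ] (k ≡ j ℕ.* 4 ⊎ k ≡ suc (j ℕ.* 4))
  coset-exponent 0 _ = 0 , inj₁ ≡.refl
  coset-exponent 1 _ = 0 , inj₂ ≡.refl
  coset-exponent 2 ()
  coset-exponent 3 ()
  coset-exponent (suc (suc (suc (suc k)))) eq = step (coset-exponent k (≡.trans (≡.sym (≡.cong₂ _⊕_ (⊖-involutive (cos k)) (⊖-involutive (sin k)))) eq))
    where
    step : (∃[ j ] (k ≡ j ℕ.* 4 ⊎ k ≡ suc (j ℕ.* 4))) → ∃[ j ] (4 ℕ.+ k ≡ j ℕ.* 4 ⊎ 4 ℕ.+ k ≡ suc (j ℕ.* 4))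
    step (j , inj₁ ≡.refl) = suc j , inj₁ ≡.refl
    step (j , inj₂ ≡.refl) = suc j , inj₂ ≡.refl

  private
    w0^4^ : ∀ j → w0 ^ (j ℕ.* 4) ≈ (w0 ^ 4) ^ j
    w0^4^ j = trans (reflexive (≡.cong (w0 ^_) (ℕ.*-comm j 4))) (^-* w0 4 j)

    wᶠ^ : ℕ → Fin q
    wᶠ^ = FieldNotation._^_ subfield w

  κ≡𝟙⇒coset : ∀ u → FF.κ u ≡ 𝟙 → InC₀∪C₁ (el u)
  κ≡𝟙⇒coset u κ≡𝟙 = powers (w-generates u u≢0)
    where
    u≢0 : ¬ u ≡ 0ᶠ
    u≢0 u≡0 = absurd (≡.trans (≡.sym (FF.κ-0 u≡0)) κ≡𝟙)
      where
      absurd : ¬ 𝟘 ≡ 𝟙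
      absurd ()
    powers : (∃[ k ] u ≡ wᶠ^ k) → InC₀∪C₁ (el u)
    powers (k , u≡w^k) = cases (coset-exponent k (≡.trans (≡.sym (≡.cong₂ _⊕_ (FF.α-w k) (FF.β-w k))) (≡.trans (≡.cong FF.κ (≡.sym u≡w^k)) κ≡𝟙)))
      where
      el-u : el u ≈ w0 ^ k
      el-u = trans (reflexive (≡.cong el u≡w^k)) (el-w^ k)
      cases : (∃[ j ] (k ≡ j ℕ.* 4 ⊎ k ≡ suc (j ℕ.* 4))) → InC₀∪C₁ (el u)
      cases (j , inj₁ k≡) = inj₁ ((w0 ^ 4) ^ j , j , refl , trans el-u (trans (reflexive (≡.cong (w0 ^_) k≡)) (trans (w0^4^ j) (sym (*-identityˡ _)))))
      cases (j , inj₂ k≡) = inj₂ ((w0 ^ 4) ^ j , j , refl , trans el-u (trans (reflexive (≡.cong (w0 ^_) k≡)) (*-cong (sym (*-identityʳ w0)) (w0^4^ j))))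

  coset⇒κ≡𝟙 : ∀ u → InC₀∪C₁ (el u) → FF.κ u ≡ 𝟙
  coset⇒κ≡𝟙 u (inj₁ (y , j , y≈ , el-u≈)) = ≡.trans (≡.cong FF.κ u≡) (≡.trans (≡.cong₂ _⊕_ (FF.α-w (j ℕ.* 4 ℕ.+ 0)) (FF.β-w (j ℕ.* 4 ℕ.+ 0))) (≡.cong₂ _⊕_ (cos-period j 0) (sin-period j 0)))
    where
    u≡ : u ≡ wᶠ^ (j ℕ.* 4 ℕ.+ 0)
    u≡ = el-injective (trans el-u≈ (trans (*-identityˡ y) (trans y≈ (trans (sym (w0^4^ j)) (trans (reflexive (≡.cong (w0 ^_) (≡.sym (ℕ.+-identityʳ (j ℕ.* 4))))) (sym (el-w^ (j ℕ.* 4 ℕ.+ 0))))))))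
  coset⇒κ≡𝟙 u (inj₂ (y , j , y≈ , el-u≈)) = ≡.trans (≡.cong FF.κ u≡) (≡.trans (≡.cong₂ _⊕_ (FF.α-w (j ℕ.* 4 ℕ.+ 1)) (FF.β-w (j ℕ.* 4 ℕ.+ 1))) (≡.cong₂ _⊕_ (cos-period j 1) (sin-period j 1)))
    where
    u≡ : u ≡ wᶠ^ (j ℕ.* 4 ℕ.+ 1)
    u≡ = el-injective (trans el-u≈ (trans (*-cong (*-identityʳ w0) (trans y≈ (sym (w0^4^ j)))) (trans (reflexive (≡.cong (w0 ^_) (ℕ.+-comm 1 (j ℕ.* 4)))) (sym (el-w^ (j ℕ.* 4 ℕ.+ 1))))))

  coset-≉0 : ∀ {x} → InC₀∪C₁ x → ¬ x ≈ 0#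
  coset-≉0 (inj₁ (y , j , y≈ , x≈)) x≈0 = *-≉0 (^-≉0 0 w0≉0) (λ y≈0 → ^-≉0 j (^-≉0 4 w0≉0) (trans (sym y≈) y≈0)) (trans (sym x≈) x≈0)
  coset-≉0 (inj₂ (y , j , y≈ , x≈)) x≈0 = *-≉0 (^-≉0 1 w0≉0) (λ y≈0 → ^-≉0 j (^-≉0 4 w0≉0) (trans (sym y≈) y≈0)) (trans (sym x≈) x≈0)

  coset-cong : ∀ {x y} → x ≈ y → InC₀∪C₁ x → InC₀∪C₁ y
  coset-cong x≈y (inj₁ (z , k , p , x≈)) = inj₁ (z , k , p , trans (sym x≈y) x≈)
  coset-cong x≈y (inj₂ (z , k , p , x≈)) = inj₂ (z , k , p , trans (sym x≈y) x≈)

  𝒦 : Fin N → Set (c Level.⊔ ℓ)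
  𝒦 k = InC₀∪C₁ (Tr q (w1 ^ toℕ k))

  -- If x = t w1^j has trace 1 then Tr(w1^j) = 1/t, and κ(1/t) = κ(t³) = κ(Nm x).
  𝒦-criterion : ∀ {x t j} → ¬ el t ≈ 0# → x ≈ el t * w1 ^ toℕ {N} j → FF.cube t ≡ NmF x → tr x ≈ 1# →
    (FF.κ (NmF x) ≡ 𝟙 → 𝒦 j) × (𝒦 j → FF.κ (NmF x) ≡ 𝟙)
  𝒦-criterion {x} {t} {j} t≉0 x≈ cube-t tr-x = (λ κ≡𝟙 → coset-cong el-u (κ≡𝟙⇒coset u (≡.trans κu κ≡𝟙))) , (λ member → ≡.trans (≡.sym κu) (coset⇒κ≡𝟙 u (coset-cong (sym el-u) member)))
    where
    u : Fin q
    u = t Sub.⁻¹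
    t≢0 : ¬ t ≡ 0ᶠ
    t≢0 t≡0 = t≉0 (reflexive (≡.cong el t≡0))
    κu : FF.κ u ≡ FF.κ (NmF x)
    κu = ≡.trans (FF.κ-⁻¹ t) (≡.trans (≡.sym (FF.κ-cube t)) (≡.cong FF.κ cube-t))
    el-u : el u ≈ Tr q (w1 ^ toℕ j)
    el-u = *-cancelˡ t≉0 (begin
      el t * el u  ≈⟨ el-* t u ⟨
      el (t *ᶠ u)  ≡⟨ ≡.cong el (Sub.inverseʳ t≢0) ⟩
      el 1ᶠ  ≈⟨ el-1 ⟩
      1#  ≈⟨ tr-x ⟨
      tr x  ≈⟨ trans (tr-cong x≈) (tr-scale _ (el-fixed t)) ⟩
      el t * tr (w1 ^ toℕ j)  ≈⟨ *-congˡ (Tr≈tr _) ⟨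
      el t * Tr q (w1 ^ toℕ j)  ∎)

  -- A line of the affine plane {Tr x = 1}

  σ-- : ∀ x y → σ (x - y) ≈ σ x - σ y
  σ-- x y = trans (σ-+ x (- y)) (+-congˡ (σ-neg y))

  el-- : ∀ x y → el (x +ᶠ -ᶠ y) ≈ el x - el y
  el-- x y = trans (el-+ x (-ᶠ y)) (+-congˡ (el-neg y))

  module Line (Y : Carrier) (Y∉F : ¬ Fixed Y) where

    -- `B` and `C` are the conjugates of Y, and `D` is the product of differences, fixed by σ
    -- because a cyclic permutation of three elements is even. If f is the minimal polynomial of Y,
    -- then (C - B)/D = 1/f′(Y), and Euler's formula says that Y^i/f′(Y) has trace 0, 0, 1 for i =
    -- 0, 1, 2. Hence β = Y/f′(Y) gives β(Y + s) trace 1, and β(Y + s)/Y trace 0, for every s in F.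
    B C D Di β : Carrier
    B = σ Y
    C = σ B
    D = (Y - B) * (B - C) * (C - Y)
    Di = D ⁻¹
    β = Y * (C - B) * Di

    point : Fin q → Carrier
    point s = β * (Y + el s)

    σC : σ C ≈ Y
    σC = σσσ Y

    Y-B≉0 : ¬ Y - B ≈ 0#
    Y-B≉0 eq = Y∉F (sym (x-y≈0⇒x≈y eq))

    B-C≉0 : ¬ B - C ≈ 0#
    B-C≉0 eq = σ-≉0 Y-B≉0 (trans (σ-- Y B) eq)

    C-Y≉0 : ¬ C - Y ≈ 0#
    C-Y≉0 eq = σ-≉0 B-C≉0 (trans (σ-- B C) (trans (+-congˡ (-‿cong σC)) eq))

    D≉0 : ¬ D ≈ 0#
    D≉0 = *-≉0 (*-≉0 Y-B≉0 B-C≉0) C-Y≉0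

    D-fixed : Fixed D
    D-fixed = trans (σ-* ((Y - B) * (B - C)) (C - Y)) (trans (*-cong (trans (σ-* (Y - B) (B - C)) (*-cong (σ-- Y B) (trans (σ-- B C) (+-congˡ (-‿cong σC))))) (trans (σ-- C Y) (+-congʳ σC)))
      (solve 3 (λ a b c → ((b :- c) :* (c :- a)) :* (a :- b) := (a :- b) :* (b :- c) :* (c :- a)) refl Y B C))

    Di-fixed : Fixed Di
    Di-fixed = fixed-inverse D-fixed (inverseʳ D≉0)

    Y≉0 : ¬ Y ≈ 0#
    Y≉0 Y≈0 = Y∉F (trans (σ-cong Y≈0) (trans σ-0 (sym Y≈0)))

    C-B≉0 : ¬ C - B ≈ 0#
    C-B≉0 eq = B-C≉0 (trans (solve 2 (λ b c → b :- c := :- (c :- b)) refl B C) (trans (-‿cong eq) (solve 0 (:- con 0₃ := con 0₃) refl)))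

    β≉0 : ¬ β ≈ 0#
    β≉0 = *-≉0 (*-≉0 Y≉0 C-B≉0) (⁻¹-≉0 D≉0)

    Y+s≉0 : ∀ s → ¬ Y + el s ≈ 0#
    Y+s≉0 s eq = Y∉F (trans (σ-cong Y≈-s) (trans (fixed-neg (el-fixed s)) (sym Y≈-s)))
      where
      Y≈-s : Y ≈ - el s
      Y≈-s = x-y≈0⇒x≈y (trans (solve 2 (λ y s → y :- (:- s) := y :+ s) refl Y (el s)) eq)

    point≉0 : ∀ s → ¬ point s ≈ 0#
    point≉0 s = *-≉0 β≉0 (Y+s≉0 s)

    σ-shift : ∀ x s → σ (x + el s) ≈ σ x + el s
    σ-shift x s = trans (σ-+ x (el s)) (+-congˡ (el-fixed s))

    y : Fin q → Carrier
    y s = (C - B) * Di * (Y + el s)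

    σ-y : ∀ s → σ (y s) ≈ (Y - C) * Di * (B + el s)
    σ-y s = trans (σ-* ((C - B) * Di) (Y + el s)) (*-cong (trans (σ-* (C - B) Di) (*-cong (trans (σ-- C B) (+-congʳ σC)) Di-fixed)) (σ-shift Y s))

    σσ-y : ∀ s → σ (σ (y s)) ≈ (B - Y) * Di * (C + el s)
    σσ-y s = trans (σ-cong (σ-y s)) (trans (σ-* ((Y - C) * Di) (B + el s)) (*-cong (trans (σ-* (Y - C) Di) (*-cong (trans (σ-- Y C) (+-congˡ (-‿cong σC))) Di-fixed)) (σ-shift B s)))

    tr-y : ∀ s → tr (y s) ≈ 0#
    tr-y s = trans (+-cong (+-congˡ (σ-y s)) (σσ-y s)) (solve 5 (λ a b c d s → (c :- b) :* d :* (a :+ s) :+ (a :- c) :* d :* (b :+ s) :+ (b :- a) :* d :* (c :+ s) := con 0₃) refl Y B C Di (el s))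

    point≈Yy : ∀ s → point s ≈ Y * y s
    point≈Yy s = solve 4 (λ a u d v → a :* u :* d :* v := a :* (u :* d :* v)) refl Y (C - B) Di (Y + el s)

    σ-point : ∀ s → σ (point s) ≈ B * ((Y - C) * Di * (B + el s))
    σ-point s = trans (σ-cong (point≈Yy s)) (trans (σ-* Y (y s)) (*-congˡ (σ-y s)))

    σσ-point : ∀ s → σ (σ (point s)) ≈ C * ((B - Y) * Di * (C + el s))
    σσ-point s = trans (σ-cong (trans (σ-cong (point≈Yy s)) (σ-* Y (y s)))) (trans (σ-* B (σ (y s))) (*-congˡ (σσ-y s)))

    tr-point : ∀ s → tr (point s) ≈ 1#
    tr-point s = trans (+-cong (+-cong (point≈Yy s) (σ-point s)) (σσ-point s))
      (trans (solve 5 (λ a b c d s → a :* ((c :- b) :* d :* (a :+ s)) :+ b :* ((a :- c) :* d :* (b :+ s)) :+ c :* ((b :- a) :* d :* (c :+ s)) := ((a :- b) :* (b :- c) :* (c :- a)) :* d) refl Y B C Di (el s))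
        (inverseʳ D≉0))

    -- Nm β = −Nm(Y)/D²
    k-value : Carrier
    k-value = - Nm Y * (Di * Di)

    k : Fin q
    k = idx (fixed-* (fixed-neg (Nm-fixed Y)) (fixed-* Di-fixed Di-fixed))

    el-k : el k ≈ k-value
    el-k = el-idx (fixed-* (fixed-neg (Nm-fixed Y)) (fixed-* Di-fixed Di-fixed))

    k≢0 : ¬ k ≡ 0ᶠ
    k≢0 k≡0 = *-≉0 (-‿≉0 (Nm-≉0 Y≉0)) (*-≉0 (⁻¹-≉0 D≉0) (⁻¹-≉0 D≉0)) (trans (sym el-k) (reflexive (≡.cong el k≡0)))

    Nm-point : ∀ s → Nm (point s) ≈ k-value * ((Y + el s) * (B + el s) * (C + el s))
    Nm-point s = begin
      Nm (point s)  ≈⟨ *-cong (*-cong (point≈Yy s) (σ-point s)) (σσ-point s) ⟩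
      Y * y s * (B * ((Y - C) * Di * (B + el s))) * (C * ((B - Y) * Di * (C + el s)))  ≈⟨ solve 7 (λ a b c d u v w → a :* ((c :- b) :* d :* u) :* (b :* ((a :- c) :* d :* v)) :* (c :* ((b :- a) :* d :* w)) :=
           ((:- (a :* b :* c)) :* (d :* d) :* (u :* v :* w)) :* (((a :- b) :* (b :- c) :* (c :- a)) :* d)) refl Y B C Di (Y + el s) (B + el s) (C + el s) ⟩
      k-value * ((Y + el s) * (B + el s) * (C + el s)) * (D * Di)  ≈⟨ *-congˡ (inverseʳ D≉0) ⟩
      k-value * ((Y + el s) * (B + el s) * (C + el s)) * 1#  ≈⟨ *-identityʳ _ ⟩
      k-value * ((Y + el s) * (B + el s) * (C + el s))  ∎

    e₂-fixed : Fixed (Y * B + B * C + C * Y)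
    e₂-fixed = trans (σ-+ (Y * B + B * C) (C * Y)) (trans (+-cong (trans (σ-+ (Y * B) (B * C)) (+-cong (σ-* Y B) (trans (σ-* B C) (*-congˡ σC)))) (trans (σ-* C Y) (*-congʳ σC)))
      (solve 3 (λ a b c → (b :* c :+ c :* a) :+ a :* b := a :* b :+ b :* c :+ c :* a) refl Y B C))

    c₁ c₂ c₃ Δ : Fin q
    c₁ = idx (tr-fixed Y)
    c₂ = idx e₂-fixed
    c₃ = NmF Y
    Δ  = idx D-fixed

    g : Fin q → Fin q
    g = FF.cubic c₁ c₂ c₃

    el-g : ∀ s → el (g s) ≈ (Y + el s) * (B + el s) * (C + el s)
    el-g s = begin
      el (g s)  ≈⟨ trans (el-+ (FF.cube s +ᶠ c₁ *ᶠ (s *ᶠ s) +ᶠ c₂ *ᶠ s) c₃) (+-cong (trans (el-+ (FF.cube s +ᶠ c₁ *ᶠ (s *ᶠ s)) (c₂ *ᶠ s)) (+-cong (trans (el-+ (FF.cube s) (c₁ *ᶠ (s *ᶠ s))) (+-cong (el-cube s) (trans (el-* c₁ (s *ᶠ s)) (*-cong (el-idx (tr-fixed Y)) (el-* s s))))) (trans (el-* c₂ s) (*-congʳ (el-idx e₂-fixed))))) (el-NmF Y)) ⟩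
      el s * el s * el s + tr Y * (el s * el s) + (Y * B + B * C + C * Y) * el s + Nm Y  ≈⟨ solve 4 (λ a b c s → s :* s :* s :+ (a :+ b :+ c) :* (s :* s) :+ (a :* b :+ b :* c :+ c :* a) :* s :+ a :* b :* c := (a :+ s) :* (b :+ s) :* (c :+ s)) refl Y B C (el s) ⟩
      (Y + el s) * (B + el s) * (C + el s)  ∎

    el-g≈Nm : ∀ s → el (g s) ≈ Nm (Y + el s)
    el-g≈Nm s = trans (el-g s) (*-cong (*-congˡ (sym (σ-shift Y s))) (sym (trans (σ-cong (σ-shift Y s)) (σ-shift B s))))

    g≢0 : ∀ s → ¬ g s ≡ 0ᶠ
    g≢0 s eq = Nm-≉0 (Y+s≉0 s) (trans (sym (el-g≈Nm s)) (reflexive (≡.cong el eq)))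

    discriminant : Δ *ᶠ Δ ≡ (c₁ *ᶠ c₁ *ᶠ (c₂ *ᶠ c₂) +ᶠ -ᶠ FF.cube c₂) +ᶠ -ᶠ (FF.cube c₁ *ᶠ c₃)
    discriminant = el-injective {Δ *ᶠ Δ} {(c₁ *ᶠ c₁ *ᶠ (c₂ *ᶠ c₂) +ᶠ -ᶠ FF.cube c₂) +ᶠ -ᶠ (FF.cube c₁ *ᶠ c₃)} (begin
      el (Δ *ᶠ Δ)  ≈⟨ trans (el-* Δ Δ) (*-cong (el-idx D-fixed) (el-idx D-fixed)) ⟩
      D * D  ≈⟨ solve 3 (λ a b c → ((a :- b) :* (b :- c) :* (c :- a)) :* ((a :- b) :* (b :- c) :* (c :- a)) :=
         ((a :+ b :+ c) :* (a :+ b :+ c) :* ((a :* b :+ b :* c :+ c :* a) :* (a :* b :+ b :* c :+ c :* a))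
         :- (a :* b :+ b :* c :+ c :* a) :* (a :* b :+ b :* c :+ c :* a) :* (a :* b :+ b :* c :+ c :* a))
         :- ((a :+ b :+ c) :* (a :+ b :+ c) :* (a :+ b :+ c)) :* (a :* b :* c)) refl Y B C ⟩
      (t * t * (u * u) - u * u * u) - (t * t * t) * Nm Y  ≈⟨ +-cong (+-cong (*-cong (*-cong t≈ t≈) (*-cong u≈ u≈)) (-‿cong (*-cong (*-cong u≈ u≈) u≈))) (-‿cong (*-cong (*-cong (*-cong t≈ t≈) t≈) (sym (el-NmF Y)))) ⟩
      (el c₁ * el c₁ * (el c₂ * el c₂) - el c₂ * el c₂ * el c₂) - (el c₁ * el c₁ * el c₁) * el c₃  ≈⟨ sym (trans (el-- (c₁ *ᶠ c₁ *ᶠ (c₂ *ᶠ c₂) +ᶠ -ᶠ FF.cube c₂) (FF.cube c₁ *ᶠ c₃)) (+-cong (trans (el-- (c₁ *ᶠ c₁ *ᶠ (c₂ *ᶠ c₂)) (FF.cube c₂)) (+-cong (trans (el-* (c₁ *ᶠ c₁) (c₂ *ᶠ c₂)) (*-cong (el-* c₁ c₁) (el-* c₂ c₂))) (-‿cong (el-cube c₂)))) (-‿cong (trans (el-* (FF.cube c₁) c₃) (*-congʳ (el-cube c₁)))))) ⟩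
      el ((c₁ *ᶠ c₁ *ᶠ (c₂ *ᶠ c₂) +ᶠ -ᶠ FF.cube c₂) +ᶠ -ᶠ (FF.cube c₁ *ᶠ c₃))  ∎)
      where
      t u : Carrier
      t = tr Y
      u = Y * B + B * C + C * Y
      t≈ : t ≈ el c₁
      t≈ = sym (el-idx (tr-fixed Y))
      u≈ : u ≈ el c₂
      u≈ = sym (el-idx e₂-fixed)

    opaque
      twisted : FF.Twisted g
      twisted = FF.cubic-twisted c₁ c₂ c₃ Δ discriminant g≢0

    NmF-point : ∀ s → NmF (point s) ≡ k *ᶠ g s
    NmF-point s = el-injective {NmF (point s)} {k *ᶠ g s} (trans (el-NmF (point s)) (trans (Nm-point s) (sym (trans (el-* k (g s)) (*-cong el-k (el-g s))))))

    P? : ∀ s → Dec (FF.κ (k *ᶠ g s) ≡ 𝟙)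
    P? s = FF.κ (k *ᶠ g s) ≟ᶻ 𝟙

    hits : List (Fin q)
    hits = filter P? (allFin q)

    decomposition : ∀ s → Decomposition (point s)
    decomposition s = decompose (point s) (point≉0 s)

    scale : Fin q → Fin q
    scale s = proj₁ (decomposition s)

    place : Fin q → Fin N
    place s = proj₁ (proj₂ (decomposition s))

    scale≉0 : ∀ s → ¬ el (scale s) ≈ 0#
    scale≉0 s = proj₁ (proj₂ (proj₂ (decomposition s)))

    point≈ : ∀ s → point s ≈ el (scale s) * w1 ^ toℕ (place s)
    point≈ s = proj₁ (proj₂ (proj₂ (proj₂ (decomposition s))))

    cube-scale : ∀ s → FF.cube (scale s) ≡ NmF (point s)
    cube-scale s = proj₂ (proj₂ (proj₂ (proj₂ (decomposition s))))

    scale-tr : ∀ s → el (scale s) * tr (w1 ^ toℕ (place s)) ≈ 1#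
    scale-tr s = trans (sym (tr-scale _ (el-fixed (scale s)))) (trans (tr-cong (sym (point≈ s))) (tr-point s))

    place-criterion : ∀ s → (FF.κ (k *ᶠ g s) ≡ 𝟙 → 𝒦 (place s)) × (𝒦 (place s) → FF.κ (k *ᶠ g s) ≡ 𝟙)
    place-criterion s = (λ eq → proj₁ criterion (≡.trans (≡.cong FF.κ (NmF-point s)) eq)) , (λ member → ≡.trans (≡.cong FF.κ (≡.sym (NmF-point s))) (proj₂ criterion member))
      where
      criterion : (FF.κ (NmF (point s)) ≡ 𝟙 → 𝒦 (place s)) × (𝒦 (place s) → FF.κ (NmF (point s)) ≡ 𝟙)
      criterion = 𝒦-criterion {point s} {scale s} {place s} (scale≉0 s) (point≈ s) (cube-scale s) (tr-point s)

    -- Normalising points to trace 1 makes the scale a function of the place, namely the inverse of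
    -- the trace of `w1 ^ toℕ (place s)`; equal places thus give equal points.
    place-injective : ∀ {s s′} → place s ≡ place s′ → s ≡ s′
    place-injective {s} {s′} eq = el-injective {s} {s′} (begin
      el s  ≈⟨ solve 2 (λ y s → s := (y :+ s) :- y) refl Y (el s) ⟩
      (Y + el s) - Y  ≈⟨ +-congʳ (*-cancelˡ {β} {Y + el s} {Y + el s′} β≉0 same-point) ⟩
      (Y + el s′) - Y  ≈⟨ solve 2 (λ y s → (y :+ s) :- y := s) refl Y (el s′) ⟩
      el s′  ∎)
      where
      W W′ : Carrier
      W  = w1 ^ toℕ (place s)
      W′ = w1 ^ toℕ (place s′)
      W≈W′ : W ≈ W′
      W≈W′ = reflexive (≡.cong (λ j → w1 ^ toℕ j) eq)
      τ≉0 : ¬ tr W ≈ 0#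
      τ≉0 τ≈0 = 0≉1 (trans (sym (zeroʳ (el (scale s)))) (trans (*-congˡ (sym τ≈0)) (scale-tr s)))
      same-scale : el (scale s) ≈ el (scale s′)
      same-scale = *-cancelˡ {tr W} {el (scale s)} {el (scale s′)} τ≉0 (trans (*-comm _ _) (trans (scale-tr s) (trans (sym (scale-tr s′)) (trans (*-congˡ (tr-cong (sym W≈W′))) (*-comm _ _)))))
      same-point : point s ≈ point s′
      same-point = trans (point≈ s) (trans (*-cong same-scale W≈W′) (sym (point≈ s′)))

    -- Membership in line i is the condition tr(w1^i x) = 0, which is tr(x/Y) = 0 up to the factor
    -- `t₀`. The factor is left free because Y₀ + a is the inverse of a power of w1 only up to an
    -- element of F.
    module Incidence (i : Fin N) (t₀ : Fin q) (t₀≉0 : ¬ el t₀ ≈ 0#) (w1^i*Y≈t₀ : w1 ^ toℕ i * Y ≈ el t₀) where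

      v : Carrier
      v = w1 ^ toℕ i

      tr-v-point : ∀ s → tr (v * point s) ≈ 0#
      tr-v-point s = begin
        tr (v * point s)  ≈⟨ tr-cong (trans (*-congˡ (point≈Yy s)) (trans (sym (*-assoc v Y (y s))) (*-congʳ w1^i*Y≈t₀))) ⟩
        tr (el t₀ * y s)  ≈⟨ tr-scale (y s) (el-fixed t₀) ⟩
        el t₀ * tr (y s)  ≈⟨ trans (*-congˡ (tr-y s)) (zeroʳ (el t₀)) ⟩
        0#  ∎

      Tr-product : ∀ (j : Fin N) → Tr q (w1 ^ (toℕ i ℕ.+ toℕ j)) ≈ tr (v * w1 ^ toℕ j)
      Tr-product j = trans (Tr≈tr _) (tr-cong (^-+ w1 (toℕ i) (toℕ j)))

      place-on-line : ∀ s → OnLine i (place s)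
      place-on-line s = (λ inJ → 0≉1 (trans (sym (zeroʳ (el (scale s)))) (trans (*-congˡ (trans (sym inJ) (Tr≈tr _))) (scale-tr s))))
        , trans (Tr-product (place s)) (*-cancelˡ {el (scale s)} {tr (v * W)} {0#} (scale≉0 s) (begin
          el (scale s) * tr (v * W)  ≈⟨ tr-scale (v * W) (el-fixed (scale s)) ⟨
          tr (el (scale s) * (v * W))  ≈⟨ tr-cong (trans (solve 3 (λ t v w → t :* (v :* w) := v :* (t :* w)) refl (el (scale s)) v W) (*-congˡ (sym (point≈ s)))) ⟩
          tr (v * point s)  ≈⟨ tr-v-point s ⟩
          0#  ≈⟨ zeroʳ (el (scale s)) ⟨
          el (scale s) * 0#  ∎))
        where
        W : Carrier
        W = w1 ^ toℕ (place s)

      -- The two trace conditions determine x up to the parameter s = −z(Y − Y′)(Y″ − Y) − Y, z = x/Y.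
      parametrised : ∀ x → tr x ≈ 1# → tr (v * x) ≈ 0# → ∃[ s ] point s ≈ x
      parametrised x tr-x tr-vx = s , (begin
        β * (Y + el s)  ≈⟨ *-congˡ (+-congˡ (el-idx s-fixed)) ⟩
        β * (Y + s-value)  ≈⟨ solve 5 (λ a b c d z → a :* (c :- b) :* d :* (a :+ ((:- (z :* (a :- b) :* (c :- a))) :- a)) := (a :* z) :* (((a :- b) :* (b :- c) :* (c :- a)) :* d)) refl Y B C Di z ⟩
        Y * z * (D * Di)  ≈⟨ trans (*-cong Yz≈x (inverseʳ D≉0)) (*-identityʳ x) ⟩
        x  ∎)
        where
        z s-value : Carrier
        z = Y ⁻¹ * x
        s-value = - (z * (Y - B) * (C - Y)) - Y
        Yz≈x : Y * z ≈ x
        Yz≈x = trans (sym (*-assoc _ _ _)) (trans (*-congʳ (inverseʳ Y≉0)) (*-identityˡ x))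
        tr-z : tr z ≈ 0#
        tr-z = *-cancelˡ {el t₀} {tr z} {0#} t₀≉0 (begin
          el t₀ * tr z  ≈⟨ tr-scale z (el-fixed t₀) ⟨
          tr (el t₀ * z)  ≈⟨ tr-cong (trans (*-congʳ (sym w1^i*Y≈t₀)) (trans (*-assoc v Y z) (*-congˡ Yz≈x))) ⟩
          tr (v * x)  ≈⟨ tr-vx ⟩
          0#  ≈⟨ zeroʳ (el t₀) ⟨
          el t₀ * 0#  ∎)
        tr-Yz : Y * z + B * σ z + C * σ (σ z) ≈ 1#
        tr-Yz = trans (sym (+-cong (+-congˡ (σ-* Y z)) (σσ-* Y z))) (trans (tr-cong Yz≈x) tr-x)
        σ-s : σ s-value ≈ - (σ z * (B - C) * (Y - B)) - B
        σ-s = trans (σ-- _ Y) (+-congʳ (trans (σ-neg _) (-‿cong (trans (σ-* (z * (Y - B)) (C - Y)) (*-cong (trans (σ-* z (Y - B)) (*-congˡ (σ-- Y B))) (trans (σ-- C Y) (+-congʳ σC)))))))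
        s-fixed : Fixed s-value
        s-fixed = sym (x-y≈0⇒x≈y (begin
          s-value - σ s-value  ≈⟨ +-congˡ (-‿cong σ-s) ⟩
          s-value - (- (σ z * (B - C) * (Y - B)) - B)  ≈⟨ solve 6 (λ a b c z z′ z″ → ((:- (z :* (a :- b) :* (c :- a))) :- a) :- ((:- (z′ :* (b :- c) :* (a :- b))) :- b) :=
               (a :- b) :* (((a :* z :+ b :* z′ :+ c :* z″) :- con 1₃) :- c :* (z :+ z′ :+ z″))) refl Y B C z (σ z) (σ (σ z)) ⟩
          (Y - B) * (((Y * z + B * σ z + C * σ (σ z)) - 1#) - C * tr z)  ≈⟨ *-congˡ (+-cong (+-congʳ tr-Yz) (-‿cong (*-congˡ tr-z))) ⟩
          (Y - B) * ((1# - 1#) - C * 0#)  ≈⟨ solve 2 (λ d c → d :* ((con 1₃ :- con 1₃) :- c :* con 0₃) := con 0₃) refl (Y - B) C ⟩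
          0#  ∎))
        s : Fin q
        s = idx s-fixed

      on-line⇒place : ∀ j → OnLine i j → ∃[ s ] j ≡ place s
      on-line⇒place j (not-inJ , on) = s , ≡.sym (proj₂ (decomposition-unique {scale s} {t} {place s} {j} (scale≉0 s) (trans (sym (point≈ s)) (trans (proj₂ solution) (*-congʳ (sym el-t))))))
        where
        W τ x : Carrier
        W = w1 ^ toℕ j
        τ = tr W
        x = τ ⁻¹ * W
        τ≉0 : ¬ τ ≈ 0#
        τ≉0 τ≈0 = not-inJ (trans (Tr≈tr W) τ≈0)
        τ⁻¹-fixed : Fixed (τ ⁻¹)
        τ⁻¹-fixed = fixed-inverse (tr-fixed W) (inverseʳ τ≉0)
        t : Fin q
        t = idx τ⁻¹-fixed
        el-t : el t ≈ τ ⁻¹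
        el-t = el-idx τ⁻¹-fixed
        solution : ∃[ s ] point s ≈ x
        solution = parametrised x (trans (tr-scale W τ⁻¹-fixed) (inverseˡ τ≉0))
          (trans (tr-cong (solve 3 (λ v t w → v :* (t :* w) := t :* (v :* w)) refl v (τ ⁻¹) W)) (trans (tr-scale (v * W) τ⁻¹-fixed) (trans (*-congˡ (trans (sym (Tr-product j)) on)) (zeroʳ (τ ⁻¹)))))
        s : Fin q
        s = proj₁ solution

      size : HasSize (λ j → OnLine i j × 𝒦 j) (length hits)
      size = map place hits
        , Unique.map⁺ (λ {s} {s′} → place-injective {s} {s′}) (Unique.filter⁺ P? (allFin⁺ q))
        , All.map⁺ (All.map (λ {s} eq → place-on-line s , proj₁ (place-criterion s) eq) (All.all-filter P? (allFin q)))
        , (λ j (on , member) → complete j member (on-line⇒place j on))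
        , length-map place hits
        where
        complete : ∀ j → 𝒦 j → (∃[ s ] j ≡ place s) → j ∈ map place hits
        complete j member (s , j≡) = ≡.subst (_∈ map place hits) (≡.sym j≡) (∈-map⁺ place (∈-filter⁺ P? (∈-allFin s) (proj₂ (place-criterion s) (≡.subst 𝒦 j≡ member))))

  -- Intersection numbers

  r : ℕ
  r = 3 ℕ.^ suc e

  Intersection : Fin N → ℕ → Set (c Level.⊔ ℓ)
  Intersection i = HasSize (λ j → OnLine i j × 𝒦 j)

  r*r≡q : r ℕ.* r ≡ q
  r*r≡q = FF.r*r≡q

  private
    ι±⇒ℕ⁺ : ∀ n → + 2 ℤ.* + n ℤ.- + q ≡ + r → 2 ℕ.* n ≡ q ℕ.+ r
    ι±⇒ℕ⁺ n eq = ℤ.+-injective (≡.trans (ℤ.pos-* 2 n) (≡.trans (isolate (+ 2 ℤ.* + n) (+ q)) (≡.cong (λ u → + q ℤ.+ u) eq)))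
      where
      isolate : ∀ x q → x ≡ q ℤ.+ (x ℤ.- q)
      isolate = solve-∀

    ι±⇒ℕ⁻ : ∀ n → + 2 ℤ.* + n ℤ.- + q ≡ ℤ.- + r → 2 ℕ.* n ℕ.+ r ≡ q
    ι±⇒ℕ⁻ n eq = ℤ.+-injective (≡.trans (≡.cong (ℤ._+ + r) (ℤ.pos-* 2 n)) (≡.trans (isolate (+ 2 ℤ.* + n) (+ q) (+ r)) (≡.trans (≡.cong (λ u → (u ℤ.+ + r) ℤ.+ + q) eq) (cancel (+ r) (+ q)))))
      where
      isolate : ∀ x q r → x ℤ.+ r ≡ ((x ℤ.- q) ℤ.+ r) ℤ.+ q
      isolate = solve-∀
      cancel : ∀ r q → (ℤ.- r ℤ.+ r) ℤ.+ q ≡ q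
      cancel = solve-∀

  signed-total : ∀ {ε s} → FF.PlusMinus ε → Sign s → ∃[ a ] (ι ε ⊗ s ≡ ι a × FF.PlusMinus a)
  signed-total {ε} p plus  = ε , FiniteSums.⊗-identityʳ (ι ε) , p
  signed-total {ε} p minus = ℤ.- ε , ≡.trans (≡.sym (Eisenstein.ι-* ε -1ℤ)) (≡.cong ι (≡.trans (ℤ.*-comm ε -1ℤ) (ℤ.-1*i≡-i ε))) , FF.±-negate p

  module LineCount (Y : Carrier) (Y∉F : ¬ Fixed Y) where
    open Line Y Y∉F

    hits-total : FF.κ-sum g k ≡ ι (+ 2 ℤ.* + length hits ℤ.- + q)
    hits-total = SignSums.∑-signs (λ s → FF.κ (k *ᶠ g s)) (λ s → FF.κ-sign (k *ᶠ g s) (Sub.*-≉0 {k} {g s} k≢0 (g≢0 s))) (λ s → s)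

    from-total : ∀ {a} → FF.κ-sum g k ≡ ι a → + 2 ℤ.* + length hits ℤ.- + q ≡ a
    from-total eq = ι-injective (≡.trans (≡.sym hits-total) eq)

    dichotomy : (2 ℕ.* length hits ≡ q ℕ.+ r) ⊎ (2 ℕ.* length hits ℕ.+ r ≡ q)
    dichotomy = from-twisted twisted
      where
      from-twisted : FF.Twisted g → (2 ℕ.* length hits ≡ q ℕ.+ r) ⊎ (2 ℕ.* length hits ℕ.+ r ≡ q)
      from-twisted (ε , m , ε± , m≢0 , eq) = signs (signed-total ε± (FF.κ-sign (k *ᶠ m) (Sub.*-≉0 {k} {m} k≢0 m≢0)))
        where
        signs : (∃[ a ] (ι ε ⊗ FF.κ (k *ᶠ m) ≡ ι a × FF.PlusMinus a)) → (2 ℕ.* length hits ≡ q ℕ.+ r) ⊎ (2 ℕ.* length hits ℕ.+ r ≡ q)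
        signs (a , total , inj₁ a≡r)  = inj₁ (ι±⇒ℕ⁺ (length hits) (≡.trans (from-total (≡.trans (eq k k≢0) total)) a≡r))
        signs (a , total , inj₂ a≡-r) = inj₂ (ι±⇒ℕ⁻ (length hits) (≡.trans (from-total (≡.trans (eq k k≢0) total)) a≡-r))

  -- An element of F that is also a power of w1 has two decompositions, and uniqueness forces the
  -- exponent 0, the one excluded from the line indices.
  w1^i∉F : ∀ i → 1 ℕ.≤ toℕ {N} i → ¬ Fixed ((w1 ^ toℕ i) ⁻¹)
  w1^i∉F i 1≤i fixed = ℕ.<⇒≢ 1≤i (≡.trans (≡.sym (Fin.toℕ-fromℕ< 0<N)) (≡.cong toℕ same-index))
    where
    W : Carrier
    W = w1 ^ toℕ i
    W≉0 : ¬ W ≈ 0#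
    W≉0 = ^-≉0 (toℕ i) w1≉0
    W-fixed : Fixed W
    W-fixed = fixed-inverse fixed (inverseˡ W≉0)
    t : Fin q
    t = idx W-fixed
    i₀ : Fin N
    i₀ = fromℕ< 0<N
    same : el t * w1 ^ toℕ i₀ ≈ el 1ᶠ * W
    same = begin
      el t * w1 ^ toℕ i₀  ≈⟨ *-cong (el-idx W-fixed) (reflexive (≡.cong (w1 ^_) (Fin.toℕ-fromℕ< 0<N))) ⟩
      W * 1#  ≈⟨ *-comm W 1# ⟩
      1# * W  ≈⟨ *-congʳ el-1 ⟨
      el 1ᶠ * W  ∎
    same-index : i₀ ≡ i
    same-index = proj₂ (decomposition-unique {t} {1ᶠ} {i₀} {i} (λ t≈0 → W≉0 (trans (sym (el-idx W-fixed)) t≈0)) same)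

  Even-split : ℕ → Set
  Even-split n = (2 ℕ.* n ≡ q ℕ.+ r) ⊎ (2 ℕ.* n ℕ.+ r ≡ q)

  every-line : ∀ i → IsLineIndex i → ∃[ n ] (Intersection i n × Even-split n)
  every-line i 1≤i = length hits , Incidence.size i 1ᶠ (λ el≈0 → 0≉1 (trans (sym el≈0) el-1)) (trans (inverseʳ W≉0) (sym el-1)) , dichotomy
    where
    W≉0 : ¬ w1 ^ toℕ i ≈ 0#
    W≉0 = ^-≉0 (toℕ i) w1≉0
    open Line ((w1 ^ toℕ i) ⁻¹) (w1^i∉F i 1≤i)
    open LineCount ((w1 ^ toℕ i) ⁻¹) (w1^i∉F i 1≤i)

  ⁻¹-cong-≉0 : ∀ {x y} → ¬ x ≈ 0# → x ≈ y → x ⁻¹ ≈ y ⁻¹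
  ⁻¹-cong-≉0 {x} {y} x≉0 x≈y = *-cancelˡ {x} {x ⁻¹} {y ⁻¹} x≉0 (trans (inverseʳ x≉0) (sym (trans (*-congʳ x≈y) (inverseʳ (λ y≈0 → x≉0 (trans x≈y y≈0))))))

  -- Decomposing Y⁻¹ as t·w1^i exhibits the index; i = 0 would put Y itself into F.
  line-through : ∀ Y → ¬ Fixed Y → ∃[ i ] ∃[ t ] (IsLineIndex i × (¬ el t ≈ 0#) × (w1 ^ toℕ i * Y ≈ el t))
  line-through Y Y∉F = from-decomposition (decompose (Y ⁻¹) (⁻¹-≉0 Y≉0))
    where
    Y≉0 : ¬ Y ≈ 0#
    Y≉0 = Line.Y≉0 Y Y∉F
    from-decomposition : Decomposition (Y ⁻¹) → ∃[ i ] ∃[ t ] (IsLineIndex i × (¬ el t ≈ 0#) × (w1 ^ toℕ i * Y ≈ el t))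
    from-decomposition (t , i , t≉0 , Y⁻¹≈ , _) = i , idx t⁻¹-fixed , positive (toℕ i) WY≈ , (λ el≈0 → ⁻¹-≉0 t≉0 (trans (sym (el-idx t⁻¹-fixed)) el≈0)) , WY≈
      where
      t⁻¹-fixed : Fixed (el t ⁻¹)
      t⁻¹-fixed = fixed-inverse (el-fixed t) (inverseʳ t≉0)
      WY≈ : w1 ^ toℕ i * Y ≈ el (idx t⁻¹-fixed)
      WY≈ = trans (*-cancelˡ {el t} {w1 ^ toℕ i * Y} {el t ⁻¹} t≉0 (trans (sym (*-assoc _ _ _)) (trans (*-congʳ (sym Y⁻¹≈)) (trans (inverseˡ Y≉0) (sym (inverseʳ t≉0)))))) (sym (el-idx t⁻¹-fixed))
      positive : ∀ n → w1 ^ n * Y ≈ el (idx t⁻¹-fixed) → 1 ℕ.≤ n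
      positive zero    eq = ⊥-elim (Y∉F (trans (σ-cong Y≈) (trans (el-fixed (idx t⁻¹-fixed)) (sym Y≈))))
        where
        Y≈ : Y ≈ el (idx t⁻¹-fixed)
        Y≈ = trans (sym (*-identityˡ Y)) eq
      positive (suc n) _ = ℕ.s≤s ℕ.z≤n

  1<N : 1 ℕ.< N
  1<N = ℕ.≤-trans (ℕ.s≤s 0<q*q+q) (ℕ.≤-reflexive (ℕ.+-comm 1 (q ℕ.* q ℕ.+ q)))
    where
    0<q*q+q : 1 ℕ.≤ q ℕ.* q ℕ.+ q
    0<q*q+q = ℕ.≤-trans (ℕ.s≤s ℕ.z≤n) (ℕ.m≤n+m q (q ℕ.* q))

  Y₀ : Carrier
  Y₀ = (w1 ^ toℕ (fromℕ< 1<N)) ⁻¹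

  Y₀∉F : ¬ Fixed Y₀
  Y₀∉F = w1^i∉F (fromℕ< 1<N) (ℕ.≤-reflexive (≡.sym (Fin.toℕ-fromℕ< 1<N)))

  module L₀ = Line Y₀ Y₀∉F

  -- The part of Nm β that all translates share: D does not change under Y ↦ Y + a, so for Y₀ + a
  -- the scalar -Nm(Y)/D² is ν·g(a), with g the cubic of Y₀.
  ν : Fin q
  ν = idx (fixed-neg (fixed-* L₀.Di-fixed L₀.Di-fixed))

  el-ν : el ν ≈ - (L₀.Di * L₀.Di)
  el-ν = el-idx (fixed-neg (fixed-* L₀.Di-fixed L₀.Di-fixed))

  ν≢0 : ¬ ν ≡ 0ᶠ
  ν≢0 ν≡0 = -‿≉0 (*-≉0 (⁻¹-≉0 L₀.D≉0) (⁻¹-≉0 L₀.D≉0)) (trans (sym el-ν) (reflexive (≡.cong el ν≡0)))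

  -- The lines given by Y₀ + a, a ∈ F, share one cubic up to translation of its argument.
  module Translate (a : Fin q) where
    Y : Carrier
    Y = Y₀ + el a

    Y∉F : ¬ Fixed Y
    Y∉F fixed = Y₀∉F (x-y≈0⇒x≈y (trans (solve 3 (λ s y a → s :- y := (s :+ a) :- (y :+ a)) refl (σ Y₀) Y₀ (el a)) (x≈y⇒x-y≈0 (trans (sym (L₀.σ-shift Y₀ a)) fixed))))

    module L = Line Y Y∉F

    g-translate : ∀ s → L.g s ≡ L₀.g (s +ᶠ a)
    g-translate s = el-injective {L.g s} {L₀.g (s +ᶠ a)} (trans (L.el-g≈Nm s) (trans (Nm-cong (trans (solve 3 (λ y a s → (y :+ a) :+ s := y :+ (s :+ a)) refl Y₀ (el a) (el s)) (+-congˡ (sym (el-+ s a))))) (sym (L₀.el-g≈Nm (s +ᶠ a)))))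

    D≈ : L.D ≈ L₀.D
    D≈ = trans (*-cong (*-cong (+-congˡ (-‿cong B≈)) (+-cong B≈ (-‿cong C≈))) (+-congʳ C≈))
      (solve 4 (λ a b c t → ((a :+ t) :- (b :+ t)) :* ((b :+ t) :- (c :+ t)) :* ((c :+ t) :- (a :+ t)) := (a :- b) :* (b :- c) :* (c :- a)) refl Y₀ L₀.B L₀.C (el a))
      where
      B≈ : L.B ≈ L₀.B + el a
      B≈ = L₀.σ-shift Y₀ a
      C≈ : L.C ≈ L₀.C + el a
      C≈ = trans (σ-cong B≈) (L₀.σ-shift L₀.B a)

    Di≈ : L.Di ≈ L₀.Di
    Di≈ = ⁻¹-cong-≉0 L.D≉0 D≈

    k-translate : L.k ≡ L₀.g a *ᶠ ν
    k-translate = el-injective {L.k} {L₀.g a *ᶠ ν} (begin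
      el L.k  ≈⟨ L.el-k ⟩
      - Nm Y * (L.Di * L.Di)  ≈⟨ *-cong (-‿cong (sym (L₀.el-g≈Nm a))) (*-cong Di≈ Di≈) ⟩
      - el (L₀.g a) * (L₀.Di * L₀.Di)  ≈⟨ solve 2 (λ g d → (:- g) :* d := g :* (:- d)) refl (el (L₀.g a)) (L₀.Di * L₀.Di) ⟩
      el (L₀.g a) * - (L₀.Di * L₀.Di)  ≈⟨ *-congˡ el-ν ⟨
      el (L₀.g a) * el ν  ≈⟨ el-* (L₀.g a) ν ⟨
      el (L₀.g a *ᶠ ν)  ∎)

    -- The cubic of Y₀ + a is that of Y₀ with shifted argument, so its sum is the one of Y₀ at the
    -- scalar ν·g(a). The whole dependence on a is the sign κ(νm·g(a)).
    total : ∀ {ε m} → (∀ k → ¬ k ≡ 0ᶠ → FF.κ-sum L₀.g k ≡ ι ε ⊗ FF.κ (k *ᶠ m)) → FF.κ-sum L.g L.k ≡ ι ε ⊗ FF.κ ((ν *ᶠ m) *ᶠ L₀.g a)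
    total {ε} {m} eq = ≡.trans (sum-cong-≗ (λ s → ≡.cong (λ t → FF.κ (L.k *ᶠ t)) (g-translate s)))
      (≡.trans (≡.sym (FF.∑-shift (λ s → FF.κ (L.k *ᶠ L₀.g s)) a)) (≡.trans (eq L.k L.k≢0)
        (≡.cong (λ u → ι ε ⊗ FF.κ u) (≡.trans (≡.cong (_*ᶠ m) k-translate) (FF.S.solve 3 (λ g ν m → (g FF.S.:* ν) FF.S.:* m FF.S.:= (ν FF.S.:* m) FF.S.:* g) ≡.refl (L₀.g a) ν m)))))

    index : Fin N
    index = proj₁ (line-through Y Y∉F)

    index-valid : IsLineIndex index
    index-valid = proj₁ (proj₂ (proj₂ (line-through Y Y∉F)))

    size : Intersection index (length L.hits)
    size = L.Incidence.size index (proj₁ (proj₂ (line-through Y Y∉F))) (proj₁ (proj₂ (proj₂ (proj₂ (line-through Y Y∉F))))) (proj₂ (proj₂ (proj₂ (proj₂ (line-through Y Y∉F)))))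

    open LineCount Y Y∉F using (from-total)

    large : ∀ {a} → FF.κ-sum L.g L.k ≡ ι a → a ≡ + r → ∃[ i ] ∃[ n ] (IsLineIndex i × Intersection i n × 2 ℕ.* n ≡ q ℕ.+ r)
    large total≡ a≡ = index , length L.hits , index-valid , size , ι±⇒ℕ⁺ (length L.hits) (≡.trans (from-total total≡) a≡)

    small : ∀ {a} → FF.κ-sum L.g L.k ≡ ι a → a ≡ ℤ.- + r → ∃[ i ] ∃[ n ] (IsLineIndex i × Intersection i n × 2 ℕ.* n ℕ.+ r ≡ q)
    small total≡ a≡ = index , length L.hits , index-valid , size , ι±⇒ℕ⁻ (length L.hits) (≡.trans (from-total total≡) a≡)

  q≢q*q : ¬ q ℕ.* q ≡ q
  q≢q*q eq = ℕ.<⇒≢ 0<M (≡.sym (ℕ.suc-injective (ℕ.*-cancelˡ-≡ q 1 q (≡.trans eq (≡.sym (ℕ.*-identityʳ q))))))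

  private
    module ER = ≡.≡-Reasoning

  -- A sum of q equal signs is ±q, not ±√q.
  not-constant : ∀ {f : Fin q → ℤ[ζ]} {s ε t} → Sign s → Sign t → FF.PlusMinus ε → FF.∑ f ≡ ι ε ⊗ t → ¬ (∀ a → f a ≡ s)
  not-constant {f} {s} {ε} {t} s± t± ε± total constant = q≢q*q (ℤ.+-injective (≡.trans (ℤ.pos-* q q) (ι-injective (ER.begin
    ι (+ q ℤ.* + q)  ER.≡⟨ Eisenstein.ι-* (+ q) (+ q) ⟩
    ι (+ q) ⊗ ι (+ q)  ER.≡⟨ square s± (ι (+ q)) ⟨
    (ι (+ q) ⊗ s) ⊗ (ι (+ q) ⊗ s)  ER.≡⟨ ≡.cong (λ u → u ⊗ u) constant-sum ⟨
    FF.∑ f ⊗ FF.∑ f  ER.≡⟨ ≡.cong (λ u → u ⊗ u) total ⟩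
    (ι ε ⊗ t) ⊗ (ι ε ⊗ t)  ER.≡⟨ square t± (ι ε) ⟩
    ι ε ⊗ ι ε  ER.≡⟨ Eisenstein.ι-* ε ε ⟨
    ι (ε ℤ.* ε)  ER.≡⟨ ≡.cong ι (IntegerLemmas.±-square ε±) ⟨
    ι (+ r ℤ.* + r)  ER.≡⟨ ≡.cong ι (≡.trans (≡.sym (ℤ.pos-* r r)) (≡.cong +_ r*r≡q)) ⟩
    ι (+ q)  ER.∎))))
    where
    square : ∀ {s} → Sign s → ∀ u → (u ⊗ s) ⊗ (u ⊗ s) ≡ u ⊗ u
    square {s} s± u = ≡.trans (solveᶻ 2 (λ u s → (u :⊗ s) :⊗ (u :⊗ s) :≡ (u :⊗ u) :⊗ (s :⊗ s)) ≡.refl u s) (≡.trans (≡.cong ((u ⊗ u) ⊗_) (Sign-square s±)) (FiniteSums.⊗-identityʳ (u ⊗ u)))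
      where open FiniteSums.ℤ[ζ]-Solver
    constant-sum : FF.∑ f ≡ ι (+ q) ⊗ s
    constant-sum = ≡.trans (sum-cong-≗ (λ a → ≡.trans (constant a) (≡.sym (Eisenstein.⊗-identityˡ s)))) (≡.trans (≡.sym (FiniteSums.*-distribʳ-sum {q} s (λ _ → 𝟙))) (≡.cong (_⊗ s) (FiniteSums.∑-𝟙 {q})))

  Sign-split : ∀ {s} → Sign s → s ≡ 𝟙 ⊎ s ≡ ⊖ 𝟙
  Sign-split plus  = inj₁ ≡.refl
  Sign-split minus = inj₂ ≡.refl

  takes-value : ∀ {f : Fin q → ℤ[ζ]} {ε t} → (∀ a → Sign (f a)) → Sign t → FF.PlusMinus ε → FF.∑ f ≡ ι ε ⊗ t → (∃[ a ] f a ≡ 𝟙) × (∃[ a ] f a ≡ ⊖ 𝟙)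
  takes-value {f} {ε} {t} f± t± ε± total = search 𝟙 (⊖ 𝟙) minus (λ a ≢ → [ (λ p → ⊥-elim (≢ p)) , (λ p → p) ]′ (Sign-split (f± a)))
    , search (⊖ 𝟙) 𝟙 plus (λ a ≢ → [ (λ p → p) , (λ p → ⊥-elim (≢ p)) ]′ (Sign-split (f± a)))
    where
    search : ∀ s s′ → Sign s′ → (∀ a → ¬ f a ≡ s → f a ≡ s′) → ∃[ a ] f a ≡ s
    search s s′ s′± otherwise = cases (Fin.any? (λ a → f a ≟ᶻ s))
      where
      cases : Dec (∃[ a ] f a ≡ s) → ∃[ a ] f a ≡ s
      cases (yes found) = found
      cases (no  none)  = ⊥-elim (not-constant {f} {s′} {ε} {t} s′± t± ε± total (λ a → otherwise a (λ p → none (a , p))))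

  -- One `Twisted` relation is used twice: at the scalar of each translate it gives T as ε times a
  -- sign, and at the scalar `μ` it evaluates the sum of these q signs as ±√q. So the signs are not
  -- all equal.
  both-occur : (∃[ i ] ∃[ n ] (IsLineIndex i × Intersection i n × 2 ℕ.* n ≡ q ℕ.+ r)) × (∃[ i ] ∃[ n ] (IsLineIndex i × Intersection i n × 2 ℕ.* n ℕ.+ r ≡ q))
  both-occur = from-twisted L₀.twisted
    where
    Result : Set (c Level.⊔ ℓ)
    Result = (∃[ i ] ∃[ n ] (IsLineIndex i × Intersection i n × 2 ℕ.* n ≡ q ℕ.+ r)) × (∃[ i ] ∃[ n ] (IsLineIndex i × Intersection i n × 2 ℕ.* n ℕ.+ r ≡ q))
    from-twisted : FF.Twisted L₀.g → Result
    from-twisted (ε , m , ε± , m≢0 , eq) = conclude ε± (takes-value (λ a → FF.κ-sign (μ *ᶠ L₀.g a) (Sub.*-≉0 {μ} {L₀.g a} μ≢0 (L₀.g≢0 a))) (FF.κ-sign (μ *ᶠ m) (Sub.*-≉0 {μ} {m} μ≢0 m≢0)) ε± (eq μ μ≢0))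
      where
      μ : Fin q
      μ = ν *ᶠ m
      μ≢0 : ¬ μ ≡ 0ᶠ
      μ≢0 = Sub.*-≉0 {ν} {m} ν≢0 m≢0
      total⁺ : ∀ a → FF.κ (μ *ᶠ L₀.g a) ≡ 𝟙 → FF.κ-sum (Translate.L.g a) (Translate.L.k a) ≡ ι ε
      total⁺ a p = ≡.trans (Translate.total a {ε} {m} eq) (≡.trans (≡.cong (ι ε ⊗_) p) (FiniteSums.⊗-identityʳ (ι ε)))
      total⁻ : ∀ a → FF.κ (μ *ᶠ L₀.g a) ≡ ⊖ 𝟙 → FF.κ-sum (Translate.L.g a) (Translate.L.k a) ≡ ι (ℤ.- ε)
      total⁻ a p = ≡.trans (Translate.total a {ε} {m} eq) (≡.trans (≡.cong (ι ε ⊗_) p) (≡.trans (≡.sym (Eisenstein.ι-* ε -1ℤ)) (≡.cong ι (≡.trans (ℤ.*-comm ε -1ℤ) (ℤ.-1*i≡-i ε)))))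
      conclude : FF.PlusMinus ε → (∃[ a ] FF.κ (μ *ᶠ L₀.g a) ≡ 𝟙) × (∃[ a ] FF.κ (μ *ᶠ L₀.g a) ≡ ⊖ 𝟙) → Result
      conclude (inj₁ ε≡r)  ((a , p) , (b , p′)) = Translate.large a (total⁺ a p) ε≡r , Translate.small b (total⁻ b p′) (≡.cong ℤ.-_ ε≡r)
      conclude (inj₂ ε≡-r) ((a , p) , (b , p′)) = Translate.large b (total⁻ b p′) (≡.trans (≡.cong ℤ.-_ ε≡-r) (ℤ.neg-involutive (+ r))) , Translate.small a (total⁺ a p) ε≡-r

  half-sum : ∀ {n} → 2 ℕ.* n ≡ q ℕ.+ r → (q ℕ.+ r) / 2 ≡ n
  half-sum {n} eq = ≡.trans (≡.cong (_/ 2) (≡.trans (≡.sym eq) (ℕ.*-comm 2 n))) (m*n/n≡m n 2)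

  half-difference : ∀ {n} → 2 ℕ.* n ℕ.+ r ≡ q → (q ℕ.∸ r) / 2 ≡ n
  half-difference {n} eq = ≡.trans (≡.cong (λ x → (x ℕ.∸ r) / 2) (≡.sym eq)) (≡.trans (≡.cong (_/ 2) (≡.trans (ℕ.m+n∸n≡m (2 ℕ.* n) r) (ℕ.*-comm 2 n))) (m*n/n≡m n 2))

  half-< : ∀ {m n} → 2 ℕ.* m ≡ q ℕ.+ r → 2 ℕ.* n ℕ.+ r ≡ q → n ℕ.< m
  half-< {m} {n} large small = ℕ.*-cancelˡ-< 2 n m (ℕ.≤-trans (ℕ.m<m+n (2 ℕ.* n) (ℕ.m^n>0 3 (suc e))) (ℕ.≤-trans (ℕ.≤-reflexive small) (ℕ.≤-trans (ℕ.m≤m+n q r) (ℕ.≤-reflexive (≡.sym large)))))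

  set-of-type : IsSetOfType 𝒦 ((q ℕ.∸ r) / 2) ((q ℕ.+ r) / 2)
  set-of-type = (λ k member inJ → coset-≉0 member inJ) , less both-occur
    , (λ i valid → classify i (every-line i valid)) , lower (proj₂ both-occur) , upper (proj₁ both-occur)
    where
    less : (∃[ i ] ∃[ n ] (IsLineIndex i × Intersection i n × 2 ℕ.* n ≡ q ℕ.+ r)) × (∃[ i ] ∃[ n ] (IsLineIndex i × Intersection i n × 2 ℕ.* n ℕ.+ r ≡ q)) → (q ℕ.∸ r) / 2 ℕ.< (q ℕ.+ r) / 2
    less ((_ , m , _ , _ , large) , (_ , n , _ , _ , small)) = ≡.subst₂ ℕ._<_ (≡.sym (half-difference {n} small)) (≡.sym (half-sum {m} large)) (half-< {m} {n} large small)
    classify : ∀ i → (∃[ n ] (Intersection i n × Even-split n)) → Intersection i ((q ℕ.∸ r) / 2) ⊎ Intersection i ((q ℕ.+ r) / 2)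
    classify i (n , size , inj₁ large) = inj₂ (≡.subst (Intersection i) (≡.sym (half-sum {n} large)) size)
    classify i (n , size , inj₂ small) = inj₁ (≡.subst (Intersection i) (≡.sym (half-difference {n} small)) size)
    lower : (∃[ i ] ∃[ n ] (IsLineIndex i × Intersection i n × 2 ℕ.* n ℕ.+ r ≡ q)) → ∃[ i ] (IsLineIndex i × Intersection i ((q ℕ.∸ r) / 2))
    lower (i , n , valid , size , small) = i , valid , ≡.subst (Intersection i) (≡.sym (half-difference {n} small)) size
    upper : (∃[ i ] ∃[ n ] (IsLineIndex i × Intersection i n × 2 ℕ.* n ≡ q ℕ.+ r)) → ∃[ i ] (IsLineIndex i × Intersection i ((q ℕ.+ r) / 2))
    upper (i , n , valid , size , large) = i , valid , ≡.subst (Intersection i) (≡.sym (half-sum {n} large)) size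

-- Specialisation to q = 3^(2e).

9^n≡1+8h : ∀ n → ∃[ h ] 3 ℕ.^ (2 ℕ.* n) ≡ suc (8 ℕ.* h)
9^n≡1+8h zero    = 0 , ≡.refl
9^n≡1+8h (suc n) = step (9^n≡1+8h n)
  where
  expand : ∀ h → 3 ℕ.* (3 ℕ.* suc (8 ℕ.* h)) ≡ suc (8 ℕ.* (1 ℕ.+ 9 ℕ.* h))
  expand = ℕ-solve-∀
  step : (∃[ h ] 3 ℕ.^ (2 ℕ.* n) ≡ suc (8 ℕ.* h)) → ∃[ h ] 3 ℕ.^ (2 ℕ.* suc n) ≡ suc (8 ℕ.* h)
  step (h , eq) = 1 ℕ.+ 9 ℕ.* h , ≡.trans (≡.cong (3 ℕ.^_) (ℕ.*-suc 2 n)) (≡.trans (≡.cong (λ x → 3 ℕ.* (3 ℕ.* x)) eq) (expand h))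

-- `q` is a variable so that it can be matched with `suc M`, the form in which a q-th power unfolds.
-- The exponent is `suc e`, which builds in that it is positive.
set-of-type-for : ∀ {c ℓ} {q M h} e → q ≡ suc M → M ≡ 8 ℕ.* h → q ≡ 3 ℕ.^ (2 ℕ.* suc e) →
  (E : CommutativeRing c ℓ) → IsField E → HasCardinality E (q ℕ.^ 3) →
  (ω w1 : CommutativeRing.Carrier E) →
  FieldNotation.HasOrder E ω (q ℕ.^ 3 ℕ.∸ 1) → FieldNotation.HasOrder E w1 (AGModel.N E q w1) →
  AGModel.IsSetOfType E q w1
    (λ k → FieldNotation.InCoset E (FieldNotation._^_ E ω (AGModel.N E q w1)) 0 (FieldNotation.Tr E q (FieldNotation._^_ E w1 (toℕ k)))
         ⊎ FieldNotation.InCoset E (FieldNotation._^_ E ω (AGModel.N E q w1)) 1 (FieldNotation.Tr E q (FieldNotation._^_ E w1 (toℕ k))))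
    ((q ℕ.∸ 3 ℕ.^ suc e) / 2) ((q ℕ.+ 3 ℕ.^ suc e) / 2)
set-of-type-for {M = M} {h} e ≡.refl M≡8h q≡3^2e E isField card ω w1 ω-order w1-order =
  CubicExtension.set-of-type E isField e M h M≡8h q≡3^2e card ω w1 ω-order w1-order

open import Data.Nat using (_^_; _*_; _∸_; _+_; _≤_)

theorem5p3 : ∀ {c ℓ} (e : ℕ) → 1 ≤ e →
    (E : CommutativeRing c ℓ) → IsField E → HasCardinality E ((3 ^ (2 * e)) ^ 3) →
    (ω w1 : CommutativeRing.Carrier E) →
    FieldNotation.HasOrder E ω ((3 ^ (2 * e)) ^ 3 ∸ 1) →
    FieldNotation.HasOrder E w1 (AGModel.N E (3 ^ (2 * e)) w1) →
    AGModel.IsSetOfType E (3 ^ (2 * e)) w1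
    (λ k → FieldNotation.InCoset E (FieldNotation._^_ E ω (AGModel.N E (3 ^ (2 * e)) w1)) 0
    (FieldNotation.Tr E (3 ^ (2 * e)) (FieldNotation._^_ E w1 (toℕ k)))
    ⊎ FieldNotation.InCoset E (FieldNotation._^_ E ω (AGModel.N E (3 ^ (2 * e)) w1)) 1
    (FieldNotation.Tr E (3 ^ (2 * e)) (FieldNotation._^_ E w1 (toℕ k))))
    ((3 ^ (2 * e) ∸ 3 ^ e) / 2)
    ((3 ^ (2 * e) + 3 ^ e) / 2)
theorem5p3 (suc e) _ E isField card ω w1 ω-order w1-order =
  set-of-type-for {h = proj₁ (9^n≡1+8h (suc e))} e (proj₂ (9^n≡1+8h (suc e))) ≡.refl ≡.refl E isField card ω w1 ω-order w1-order
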